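{- Let $D = \{ -, 0, +\}$ be a set of three distinct symbols. Let $$P = \{(-,-,-),\ (-,0,-),\ (-,+,-),\ (-,+,0),\ (-,+,+),\ (0,-,-)\} \subseteq D^3, \qquad Q = P \cup \{(0,0,0)\},$$ and let $$R := (P \times \{0\}) \cup (Q \times \{+\}) \subseteq D^4.$$ Then, for positive integers $n$, $$\mathrm{NRD}(R, n) \leq O\big(n \cdot f^{(3)}(n, 6, 3)\big) \le \frac{n^3}{2^{\Omega(\log^*(n))}}$$ and $$\mathrm{CL}(R, n) \geq \Omega(n^3).$$
   Context: Given a relation $R \subseteq D^r$ over a finite domain $D$, an instance of $\mathrm{CSP}(R)$ is a pair $(V, C)$ with $V$ a finite set of variables (typically $V = [n] = \{1,\dots,n\}$) and $C \subseteq V^r$ a set of constraints. For an assignment $\varphi : V \to D$ and $S = (v_1,\dots,v_r) \in C$, write $\varphi(S) := (\varphi(v_1),\dots,\varphi(v_r))$; the constraint $S$ is satisfied by $\varphi$ if $\varphi(S) \in R$. An instance on variables $[n]$ with constraints $S_1,\dots,S_m$ is non-redundant if for each $i \in [m]$ there is an assignment $\varphi_i : [n] \to D$ with $\varphi_i(S_i) \notin R$ and $\varphi_i(S_j) \in R$ for all $j \in [m]$ with $j \neq i$. $\mathrm{NRD}(R,n)$ is the maximum $m$ such that there is a non-redundant instance of $\mathrm{CSP}(R)$ with $n$ variables and $m$ constraints. An instance on variables $[n]$ with an ordered list of constraints $S_1,\dots,S_m$ is a valid witness to chain length if for each $i \in [m]$ there is an assignment $\varphi_i : [n] \to D$ with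 $\varphi_i(S_i) \notin R$ and $\varphi_i(S_j) \in R$ for all $j < i$. $\mathrm{CL}(R,n)$ is the maximum $m$ such that there is an instance of $\mathrm{CSP}(R)$ with $n$ variables and $m$ constraints that is a valid witness to chain length. $f^{(3)}(n,6,3)$ is the maximum number of hyperedges in a $3$-uniform hypergraph on $n$ vertices such that no $6$ vertices completely contain $3$ hyperedges. $\log^*(n)$ is the iterated logarithm: the number of times $\log_2$ must be applied to $n$ before the result is at most $1$. Asymptotic notation is as $n \to \infty$: there are constants $c_1,c_2,c_3>0$ and $n_0$ such that for all $n \ge n_0$: $\mathrm{NRD}(R,n) \le c_1\, n\, f^{(3)}(n,6,3)$, $c_1\, n\, f^{(3)}(n,6,3) \le n^3/2^{c_2\log^*(n)}$, and $\mathrm{CL}(R,n) \ge c_3 n^3$. -}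

module Defs where

open import Algebra.Definitions.RawSemiring as RawSemiring using ()
open import Data.Bool.Base using (Bool)
open import Data.Fin.Base as Fin using (Fin)
open import Data.Fin.Properties as Fin using (2↔Bool; 1↔⊤; *↔×; injective⇒≤)
open import Data.Fin.Subset using (Subset; ∣_∣)
open import Data.Fin.Subset.Properties using (_⊆?_)
open import Data.Integer.Base using (+_; -[1+_])
open import Data.List.Base as List using (List)
open import Data.List.Membership.Propositional using (_∈_)
import Data.List.Membership.DecPropositional as DecMembership
open import Data.Nat.Base as ℕ using (ℕ; zero; suc; z≤n; s≤s; NonZero)
open import Data.Nat.Induction using (Acc; acc; <-wellFounded)
open import Data.Nat.Logarithm using (⌈log₂_⌉; ⌈log₂⌉-mono-≤; ⌈log₂2^n⌉≡n)
import Data.Nat.Properties as ℕ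
open import Data.Product.Base using (∃; _×_; _,_; proj₁; proj₂; uncurry)
open import Data.Product.Function.NonDependent.Propositional using (_×-↔_)
open import Data.Rational.Unnormalised.Base as ℚ using (ℚᵘ; mkℚᵘ; ↥_; ↧ₙ_)
open import Data.Unit.Base using (tt)
open import Data.Vec.Base as Vec using (Vec; []; _∷_; _∷ʳ_; lookup; count)
open import Data.Vec.Relation.Unary.All as All using (All; [])
open import Data.Vec.Relation.Unary.AllPairs using (allPairs?; [])
open import Data.Vec.Relation.Unary.Unique.Propositional using (Unique)
open import Data.Vec.Relation.Unary.Unique.Propositional.Properties using (lookup-injective)
open import Function.Base using (_∘_)
open import Function.Bundles using (_↔_; Inverse; Injection; mk↔ₛ′)
open import Function.Definitions using (Injective)
open import Function.Properties.Inverse using (↔-refl; ↔-sym; ↔-trans; ↔⇒↣)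
open import Relation.Binary.Definitions using (DecidableEquality; tri<; tri≈; tri>)
open import Relation.Binary.PropositionalEquality
  using (_≡_; _≢_; refl; sym; cong; subst)
open import Relation.Nullary using (¬_; Dec; yes; no; ¬?; contradiction)
open import Relation.Nullary.Decidable as Dec using (_×-dec_; _→-dec_; map′; decidable-stable)
open import Relation.Unary using (Decidable)

------------------------------------------------------------------------
-- Finite types

record Finite (A : Set) : Set where
  field
    {size} : ℕ
    enum   : A ↔ Fin size

open Finite {{...}} public

module _ {A : Set} {{fin : Finite A}} where

  code : A → Fin (size {{fin}})
  code = Inverse.to enum

  code-injective : Injective _≡_ _≡_ code
  code-injective = Injection.injective (↔⇒↣ enum)

  _≟_ : DecidableEquality A
  _≟_ = Dec.via-injection (↔⇒↣ enum) Fin._≟_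

  any? : {P : A → Set} → Decidable P → Dec (∃ P)
  any? {P} P? = map′
    (λ (i , p) → Inverse.from enum i , p)
    (λ (x , p) → code x , subst P (sym (Inverse.strictlyInverseʳ enum x)) p)
    (Fin.any? (P? ∘ Inverse.from enum))

  all? : {P : A → Set} → Decidable P → Dec (∀ x → P x)
  all? P? with any? (¬? ∘ P?)
  ... | yes (x , ¬p) = no λ ∀p → ¬p (∀p x)
  ... | no ¬∃        = yes λ x → decidable-stable (P? x) λ ¬p → ¬∃ (x , ¬p)

  distinct⇒≤size : ∀ {m} (xs : Vec A m) → Injective _≡_ _≡_ (lookup xs) → m ℕ.≤ size {{fin}}
  distinct⇒≤size xs inj = injective⇒≤ {f = code ∘ lookup xs} (inj ∘ code-injective)

instance
  Fin-finite : ∀ {n} → Finite (Fin n)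
  Fin-finite = record { enum = ↔-refl }

  Bool-finite : Finite Bool
  Bool-finite = record { enum = ↔-sym 2↔Bool }

Vec↔Fin : ∀ {A : Set} {k} → A ↔ Fin k → ∀ n → Vec A n ↔ Fin (k ℕ.^ n)
Vec↔Fin A↔ zero    = ↔-trans (mk↔ₛ′ (λ _ → tt) (λ _ → []) (λ _ → refl) (λ { [] → refl })) (↔-sym 1↔⊤)
Vec↔Fin A↔ (suc n) = ↔-trans
  (mk↔ₛ′ (λ { (x ∷ xs) → x , xs }) (uncurry _∷_) (λ _ → refl) (λ { (_ ∷ _) → refl }))
  (↔-trans (A↔ ×-↔ Vec↔Fin A↔ n) (↔-sym *↔×))

instance
  Vec-finite : ∀ {A n} → {{Finite A}} → Finite (Vec A n)
  Vec-finite {n = n} = record { enum = Vec↔Fin enum n }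

------------------------------------------------------------------------
-- Maxima of sets of natural numbers

IsMaximum : (ℕ → Set) → ℕ → Set
IsMaximum P m = P m × (∀ {k} → P k → k ℕ.≤ m)

maximum : {P : ℕ → Set} → Decidable P → P 0 →
          ∀ b → (∀ {k} → P k → k ℕ.≤ b) → ∃ (IsMaximum P)
maximum P? p₀ zero    P≤b = 0 , p₀ , P≤b
maximum {P} P? p₀ (suc b) P≤b with P? (suc b)
... | yes p = suc b , p , P≤b
... | no ¬p = maximum P? p₀ b λ {k} q → ℕ.s≤s⁻¹
  (ℕ.≤∧≢⇒< (P≤b q) λ { refl → ¬p q })

------------------------------------------------------------------------
-- Constraint satisfaction problems

Relation : Set → ℕ → Set
Relation D r = List (Vec D r)

-- The constraints S₁, …, Sₘ of an instance on variables Fin n, in order.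
-- Distinctness is not required here because both properties below force
-- it; see nonRedundant-distinct and chain-distinct.
Instance : (n r m : ℕ) → Set
Instance n r m = Vec (Vec (Fin n) r) m

module _ {D : Set} {r : ℕ} (R : Relation D r) where

  Satisfies : ∀ {n} → Vec D n → Vec (Fin n) r → Set
  Satisfies φ S = Vec.map (lookup φ) S ∈ R

  NonRedundant : ∀ {n m} → Instance n r m → Set
  NonRedundant I = ∀ i → ∃ λ φ →
    ¬ Satisfies φ (lookup I i) × (∀ j → j ≢ i → Satisfies φ (lookup I j))

  ChainWitness : ∀ {n m} → Instance n r m → Set
  ChainWitness I = ∀ i → ∃ λ φ →
    ¬ Satisfies φ (lookup I i) × (∀ j → j Fin.< i → Satisfies φ (lookup I j))

  nonRedundant-distinct : ∀ {n m} (I : Instance n r m) →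
                          NonRedundant I → Injective _≡_ _≡_ (lookup I)
  nonRedundant-distinct I nr {i} {j} eq with i Fin.≟ j
  ... | yes i≡j = i≡j
  ... | no  i≢j = let φ , ¬sat , sat = nr j in
    contradiction (subst (Satisfies φ) eq (sat i i≢j)) ¬sat

  chain-distinct : ∀ {n m} (I : Instance n r m) →
                   ChainWitness I → Injective _≡_ _≡_ (lookup I)
  chain-distinct I ch {i} {j} eq with Fin.<-cmp i j
  ... | tri≈ _ i≡j _ = i≡j
  ... | tri< i<j _ _ = let φ , ¬sat , sat = ch j in
    contradiction (subst (Satisfies φ) eq (sat i i<j)) ¬sat
  ... | tri> _ _ j<i = let φ , ¬sat , sat = ch i in
    contradiction (subst (Satisfies φ) (sym eq) (sat j j<i)) ¬sat

module _ {D : Set} {{_ : Finite D}} {r : ℕ} (R : Relation D r) where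

  satisfies? : ∀ {n} (φ : Vec D n) → Decidable (Satisfies R φ)
  satisfies? φ S = DecMembership._∈?_ _≟_ (Vec.map (lookup φ) S) R

  nonRedundant? : ∀ {n m} → Decidable (NonRedundant R {n} {m})
  nonRedundant? I = Fin.all? λ i → any? λ φ →
    ¬? (satisfies? φ (lookup I i)) ×-dec
    Fin.all? λ j → ¬? (j Fin.≟ i) →-dec satisfies? φ (lookup I j)

  chainWitness? : ∀ {n m} → Decidable (ChainWitness R {n} {m})
  chainWitness? I = Fin.all? λ i → any? λ φ →
    ¬? (satisfies? φ (lookup I i)) ×-dec
    Fin.all? λ j → (j Fin.<? i) →-dec satisfies? φ (lookup I j)

  NRD-maximum : ∀ n → ∃ (IsMaximum λ m → ∃ λ (I : Instance n r m) → NonRedundant R I)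
  NRD-maximum n = maximum (λ _ → any? nonRedundant?) ([] , λ ()) (n ℕ.^ r) λ (I , nr) →
    distinct⇒≤size I (nonRedundant-distinct R I nr)

  CL-maximum : ∀ n → ∃ (IsMaximum λ m → ∃ λ (I : Instance n r m) → ChainWitness R I)
  CL-maximum n = maximum (λ _ → any? chainWitness?) ([] , λ ()) (n ℕ.^ r) λ (I , ch) →
    distinct⇒≤size I (chain-distinct R I ch)

  NRD CL : ℕ → ℕ
  NRD = proj₁ ∘ NRD-maximum
  CL  = proj₁ ∘ CL-maximum

------------------------------------------------------------------------
-- Hypergraphs

IsUniform : ∀ {n m} → ℕ → Vec (Subset n) m → Set
IsUniform r E = Unique E × All (λ e → ∣ e ∣ ≡ r) E

-- No v vertices completely contain e hyperedges.
IsSparse : ∀ {n m} → ℕ → ℕ → Vec (Subset n) m → Set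
IsSparse v e E = ∀ W → ∣ W ∣ ≡ v → count (_⊆? W) E ℕ.< e

-- f⁽ʳ⁾(n, v, e); for e = 0 even the edgeless hypergraph can fail to be sparse.
f-maximum : ∀ r n v e → .{{NonZero e}} →
  ∃ (IsMaximum λ m → ∃ λ (E : Vec (Subset n) m) → IsUniform r E × IsSparse v e E)
f-maximum r n v e = maximum
  (λ _ → any? λ E →
    (allPairs? (λ x y → ¬? (x ≟ y)) E ×-dec All.all? (λ x → ∣ x ∣ ℕ.≟ r) E) ×-dec
    all? λ W → (∣ W ∣ ℕ.≟ v) →-dec (count (_⊆? W) E ℕ.<? e))
  ([] , ([] , []) , λ _ _ → ℕ.>-nonZero⁻¹ e)
  (2 ℕ.^ n)
  λ (E , (unique , _) , _) → distinct⇒≤size E (lookup-injective unique _ _)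

f : ∀ r n v e → .{{NonZero e}} → ℕ
f r n v e = proj₁ (f-maximum r n v e)

------------------------------------------------------------------------
-- Iterated logarithm

⌈log₂n⌉<n : ∀ n → ⌈log₂ suc (suc n) ⌉ ℕ.< suc (suc n)
⌈log₂n⌉<n n = s≤s (ℕ.≤-trans (⌈log₂⌉-mono-≤ (2+n≤2^[1+n] n)) (ℕ.≤-reflexive (⌈log₂2^n⌉≡n (suc n))))
  where
  2+n≤2^[1+n] : ∀ n → suc (suc n) ℕ.≤ 2 ℕ.^ suc n
  2+n≤2^[1+n] zero    = ℕ.≤-refl
  2+n≤2^[1+n] (suc n) = ℕ.≤-trans
    (ℕ.+-mono-≤ (ℕ.m^n>0 2 (suc n)) (2+n≤2^[1+n] n))
    (ℕ.≤-reflexive (cong (2 ℕ.^ suc n ℕ.+_) (sym (ℕ.+-identityʳ _))))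

log*-acc : ∀ n → Acc ℕ._<_ n → ℕ
log*-acc 0 _ = 0
log*-acc 1 _ = 0
log*-acc (suc (suc n)) (acc rs) = suc (log*-acc ⌈log₂ suc (suc n) ⌉ (rs (⌈log₂n⌉<n n)))

-- Rounding up at each step does not change the number of steps: for a
-- natural number t, log₂ x ≤ t iff ⌈log₂ ⌈x⌉⌉ ≤ t, so by induction both the
-- exact and the rounded k-th iterates are ≤ 1 precisely when x is at most a
-- tower of k twos.
log* : ℕ → ℕ
log* n = log*-acc n (<-wellFounded n)

log*-step : ∀ n → log* (suc (suc n)) ≡ suc (log* ⌈log₂ suc (suc n) ⌉)
log*-step n = irrelevant (suc (suc n)) (<-wellFounded _) (acc λ {m} _ → <-wellFounded m)
  where
  irrelevant : ∀ n (p q : Acc ℕ._<_ n) → log*-acc n p ≡ log*-acc n q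
  irrelevant 0 _ _ = refl
  irrelevant 1 _ _ = refl
  irrelevant (suc (suc n)) (acc rs) (acc rs′) = cong suc (irrelevant _ (rs _) (rs′ _))

------------------------------------------------------------------------
-- Rational bounds

⟦_⟧ : ℕ → ℚᵘ
⟦ n ⟧ = mkℚᵘ (+ n) 0

infixr 8 _^_
_^_ : ℚᵘ → ℕ → ℚᵘ
_^_ = RawSemiring._^_ ℚ.+-*-rawSemiring

-- x ≤ y / 2^e for nonnegative x and y, where the real power 2^e with
-- e = ± p / q is cleared by raising both sides to the q-th power.
infix 4 _≤[_/2^_]
_≤[_/2^_] : ℚᵘ → ℚᵘ → ℚᵘ → Set
x ≤[ y /2^ e ] with ↥ e
... | + p      = x ^ ↧ₙ e ℚ.* ⟦ 2 ⟧ ^ p ℚ.≤ y ^ ↧ₙ e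
... | -[1+ p ] = x ^ ↧ₙ e ℚ.≤ y ^ ↧ₙ e ℚ.* ⟦ 2 ⟧ ^ suc p

------------------------------------------------------------------------
-- The relation R

data Sign : Set where
  ⊖ 𝟎 ⊕ : Sign

instance
  Sign-finite : Finite Sign
  Sign-finite = record
    { size = 3
    ; enum = mk↔ₛ′
        (λ { ⊖ → Fin.zero ; 𝟎 → Fin.suc Fin.zero ; ⊕ → Fin.suc (Fin.suc Fin.zero) })
        (λ { Fin.zero → ⊖ ; (Fin.suc Fin.zero) → 𝟎 ; (Fin.suc (Fin.suc Fin.zero)) → ⊕ })
        (λ { Fin.zero → refl ; (Fin.suc Fin.zero) → refl ; (Fin.suc (Fin.suc Fin.zero)) → refl })
        (λ { ⊖ → refl ; 𝟎 → refl ; ⊕ → refl })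
    }

P Q : Relation Sign 3
P = (⊖ ∷ ⊖ ∷ ⊖ ∷ [])
  List.∷ (⊖ ∷ 𝟎 ∷ ⊖ ∷ [])
  List.∷ (⊖ ∷ ⊕ ∷ ⊖ ∷ [])
  List.∷ (⊖ ∷ ⊕ ∷ 𝟎 ∷ [])
  List.∷ (⊖ ∷ ⊕ ∷ ⊕ ∷ [])
  List.∷ (𝟎 ∷ ⊖ ∷ ⊖ ∷ [])
  List.∷ List.[]
Q = P List.++ List.[ 𝟎 ∷ 𝟎 ∷ 𝟎 ∷ [] ]

R : Relation Sign 4
R = List.map (_∷ʳ 𝟎) P List.++ List.map (_∷ʳ ⊕) Q

{-# OPTIONS --safe #-}
module Submission where

-- The bound on f follows Fox's proof of the triangle removal lemma. Up to a
-- factor 2, a sparse hypergraph on n vertices is a system of m triangles in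
-- a tripartite graph in which every edge lies in exactly one triangle.
-- Partition the parts. If three cells A, B, C are pairwise dense, every box
-- N_B(a) × N_C(a) contains at most n edges, because an edge between two
-- neighbours of a lies in a triangle at a. Choose vertices a greedily until
-- their boxes cover an eighth of B × C or no further box adds much. In the
-- second case few b have half of C covered; a typical a either has few
-- neighbours among the other b, or has one, b(a), such that almost all
-- neighbours of a in C are covered with b(a). Each time one of the three pairs
-- of cells has an eighth of its area in a union of subcells that carries only
-- 1/32 of its edges, and a potential of entropy type grows. If m ≥ 10 n² / 2^h,
-- it grows by a constant multiple of m in each round of refinement; as it never
-- exceeds O(h) m, there are O(h) rounds. Each costs boundedly many
-- exponentials, so n is at most a tower of height O(h).
--
-- For NRD, sort the constraints of a non-redundant instance by how their
-- witness violates them. Violating the last coordinate or a binary projection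
-- of R leaves O(n²) constraints; the violations (𝟎,𝟎,⊖) and (⊖,𝟎,𝟎) form,
-- for each second variable, the edges of a forest. In the remaining case
-- (𝟎,𝟎,𝟎,𝟎), the other constraints with the same last variable must lie in
-- P × {𝟎}, which makes those triples a linear triangle-free system; three
-- directed cuts turn a fraction 1/64 of it into a sparse hypergraph.
--
-- For CL, the chain runs through triples (a , b , a + b), each with all last
-- variables d, so that (𝟎,𝟎,𝟎) can be reused with ⊕ in the last coordinate.

-- The choice of potential decides the strength of the bound. With a mean-square energy the gain of
-- a round would shrink with a power of the density `2 ^ - h`, the number of rounds would be
-- exponential in `h`, and only a power of `log* n` would be saved. With the entropy, gain and bound
-- differ by a factor `O(h)` only, so the saving is exponential in `log* n`.
--
-- The gap between NRD and CL comes from the second coordinate. Let `s` be violated as `(𝟎,𝟎,𝟎,𝟎)`.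
-- A constraint with the same first and last variable must then read `(𝟎,⊖,⊖,𝟎)`, one with the same
-- third and last variable `(⊖,⊕,𝟎,𝟎)`, so these two cannot share their second variable.
-- Non-redundancy asks this of all other constraints and thereby forbids triangles. A chain asks it
-- of earlier ones only: in lexicographic order the first kind has a smaller `b` and the second a
-- larger `b`, so they never clash, although the triples `(a , b , a + b)` are full of triangles.

module Combinatorics where

  open import Data.Bool.Base using (Bool; true; false; _∧_; _∨_; not)
  import Data.Bool.Properties as Bool
  open import Data.Fin.Base as Fin using
    ( Fin; zero; suc; toℕ; fromℕ; fromℕ<; inject₁; combine; remQuot; funToFin; finToFun
    ; punchIn; punchOut; splitAt; _↑ˡ_; _↑ʳ_)
  open import Data.Fin.Patterns using (0F; 1F; 2F; 3F)
  import Data.Fin.Properties as Fin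
  open import Data.Fin.Subset using (Subset; inside; outside; _∈_; _∉_; _⊆_; _∪_; ⁅_⁆; ∣_∣)
    renaming (⊥ to ∅)
  open import Data.Fin.Subset.Properties as Subset using (_∈?_; _⊆?_)
  open import Data.List.Base as List using (List; length)
  import Data.List.Membership.DecPropositional as DecMembership
  import Data.List.Membership.Propositional as List
  open import Data.List.Relation.Unary.Any using () renaming (here to hereᴸ; there to thereᴸ)
  open import Data.Nat.Base using
    ( ℕ; zero; suc; _+_; _*_; _∸_; _^_; _≤_; _<_; z≤n; s≤s; s≤s⁻¹; NonZero; >-nonZero
    ; ⌈_/2⌉; ⌊_/2⌋)
  open import Data.Nat.DivMod using (_/_; _%_; m≡m%n+[m/n]*n; m%n<n)
  open import Data.Nat.Induction using (<-rec)
  open import Data.Nat.Logarithm using (⌈log₂_⌉; ⌈log₂⌉-mono-≤; ⌈log₂2^n⌉≡n; ⌈log₂⌈n/2⌉⌉≡⌈log₂n⌉∸1)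
  open import Data.Nat.Properties as ℕ hiding (_≟_)
  open import Data.Nat.Tactic.RingSolver using (solve-∀)
  open import Data.Product.Base using (∃; _×_; _,_; proj₁; proj₂)
  open import Data.Sum.Base as Sum using (_⊎_; inj₁; inj₂; [_,_]′)
  open import Data.Vec.Base using
    (Vec; []; _∷_; head; tail; map; replicate; lookup; count; tabulate; here; there)
  open import Data.Vec.Membership.Propositional.Properties using (∈-lookup)
  open import Data.Vec.Properties using (lookup∘tabulate; ∷-injectiveʳ)
  open import Data.Vec.Relation.Unary.All as All using (All; []; _∷_)
  import Data.Vec.Relation.Unary.All.Properties as All
  open import Data.Vec.Relation.Unary.AllPairs using ([]; _∷_)
  open import Data.Vec.Relation.Unary.Unique.Propositional using (Unique)
  import Data.Vec.Relation.Unary.Unique.Propositional.Properties as Unique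
  open import Function.Base using (_∘_; id)
  open import Function.Bundles using (Inverse)
  open import Relation.Binary.Definitions using (tri<; tri≈; tri>)
  open import Relation.Binary.PropositionalEquality
  open import Relation.Nullary using (¬_; ¬?; Dec; yes; no; does; contradiction)
  open import Relation.Nullary.Decidable using (dec-true; dec-false; _×-dec_)
  open import Algebra.Properties.Semiring.Sum ℕ.+-*-semiring
    using () renaming
    (sum to ∑; sum-cong-≗ to ∑-cong; ∑-distrib-+ to ∑-+; ∑-comm to ∑-swap; *-distribˡ-sum to ∑-*ˡ; *-distribʳ-sum to ∑-*ʳ)
  import Defs
  open import Defs using
    ( Finite; Vec-finite; Bool-finite; Sign-finite; code; enum; Relation; Instance; NonRedundant
    ; ChainWitness; Satisfies; satisfies?; NRD; NRD-maximum; CL; CL-maximum; IsUniform; IsSparse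
    ; f; f-maximum; log*; log*-step; ⌈log₂n⌉<n; Sign; ⊖; 𝟎; ⊕; R)

  -- Finite sums and indicator functions.

  ∑-mono : ∀ {n} {f g : Fin n → ℕ} → (∀ i → f i ≤ g i) → ∑ f ≤ ∑ g
  ∑-mono {zero}  f≤g = z≤n
  ∑-mono {suc n} f≤g = +-mono-≤ (f≤g zero) (∑-mono (f≤g ∘ suc))

  ∑-const : ∀ n c → ∑ {n} (λ _ → c) ≡ n * c
  ∑-const zero    c = refl
  ∑-const (suc n) c = cong (c +_) (∑-const n c)

  ∑-bound : ∀ {n} {f : Fin n → ℕ} {c} → (∀ i → f i ≤ c) → ∑ f ≤ n * c
  ∑-bound {n} {f} {c} f≤c = ≤-trans (∑-mono f≤c) (≤-reflexive (∑-const n c))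

  ∑-product : ∀ {m n} (f : Fin m → ℕ) (g : Fin n → ℕ) → ∑ f * ∑ g ≡ ∑ (λ i → ∑ (λ j → f i * g j))
  ∑-product f g = trans (∑-*ʳ (∑ g) f) (∑-cong λ i → ∑-*ˡ (f i) g)

  ∑-bump : ∀ {n} {f g : Fin n → ℕ} i {x} → (∀ j → f j ≤ g j) → f i + x ≤ g i → ∑ f + x ≤ ∑ g
  ∑-bump {suc n} {f} {g} zero {x} f≤g fi+x≤gi = begin
    f zero + ∑ (f ∘ suc) + x  ≡⟨ lemma (f zero) _ x ⟩
    f zero + x + ∑ (f ∘ suc)  ≤⟨ +-mono-≤ fi+x≤gi (∑-mono (f≤g ∘ suc)) ⟩
    g zero + ∑ (g ∘ suc)  ∎
    where
    open ≤-Reasoning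
    lemma : ∀ a b c → a + b + c ≡ a + c + b
    lemma = solve-∀
  ∑-bump {suc n} {f} {g} (suc i) {x} f≤g fi+x≤gi = begin
    f zero + ∑ (f ∘ suc) + x  ≡⟨ +-assoc (f zero) _ x ⟩
    f zero + (∑ (f ∘ suc) + x)  ≤⟨ +-mono-≤ (f≤g zero) (∑-bump i (f≤g ∘ suc) fi+x≤gi) ⟩
    g zero + ∑ (g ∘ suc)  ∎
    where open ≤-Reasoning

  term≤∑ : ∀ {n} (f : Fin n → ℕ) i → f i ≤ ∑ f
  term≤∑ {suc n} f zero    = m≤m+n (f zero) _
  term≤∑ {suc n} f (suc i) = ≤-trans (term≤∑ (f ∘ suc) i) (m≤n+m _ (f zero))

  χ : Bool → ℕ
  χ true  = 1
  χ false = 0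

  χ≤1 : ∀ b → χ b ≤ 1
  χ≤1 true  = ≤-refl
  χ≤1 false = z≤n

  χ-∧ : ∀ a b → χ (a ∧ b) ≡ χ a * χ b
  χ-∧ true  b = sym (+-identityʳ (χ b))
  χ-∧ false b = refl

  χ-not : ∀ b → χ b + χ (not b) ≡ 1
  χ-not true  = refl
  χ-not false = refl

  χ-*≤ : ∀ b k → χ b * k ≤ k
  χ-*≤ true  k = ≤-reflexive (+-identityʳ k)
  χ-*≤ false k = z≤n

  χ-mono : ∀ {a b} → (a ≡ true → b ≡ true) → χ a ≤ χ b
  χ-mono {true}  {b} a⇒b = ≤-reflexive (cong χ (sym (a⇒b refl)))
  χ-mono {false}     a⇒b = z≤n

  χ-≤* : ∀ b {j k} → (b ≡ true → j ≤ k) → χ b * j ≤ χ b * k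
  χ-≤* true  j≤k = *-monoʳ-≤ 1 (j≤k refl)
  χ-≤* false j≤k = z≤n

  ∧-trueˡ : ∀ {a b} → a ∧ b ≡ true → a ≡ true
  ∧-trueˡ {true} _ = refl

  ∧-trueʳ : ∀ {a b} → a ∧ b ≡ true → b ≡ true
  ∧-trueʳ {true} eq = eq

  ∧-true : ∀ {a b} → a ≡ true → b ≡ true → a ∧ b ≡ true
  ∧-true refl refl = refl

  does-sound : ∀ {A : Set} (d : Dec A) → does d ≡ true → A
  does-sound (yes a) _ = a

  infix 5 _==_
  _==_ : ∀ {n} → Fin n → Fin n → Bool
  i == j = does (i Fin.≟ j)

  ==-sound : ∀ {n} {i j : Fin n} → (i == j) ≡ true → i ≡ j
  ==-sound {i = i} {j} = does-sound (i Fin.≟ j)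

  ==-refl : ∀ {n} (i : Fin n) → (i == i) ≡ true
  ==-refl i = dec-true (i Fin.≟ i) refl

  ==-complete : ∀ {n} {i j : Fin n} → i ≡ j → (i == j) ≡ true
  ==-complete {i = i} refl = ==-refl i

  ==-false : ∀ {n} {i j : Fin n} → i ≢ j → (i == j) ≡ false
  ==-false {i = i} {j} = dec-false (i Fin.≟ j)

  exists : ∀ {n} → (Fin n → Bool) → Bool
  exists p = does (Fin.any? λ i → p i Bool.≟ true)

  exists-intro : ∀ {n} {p : Fin n → Bool} i → p i ≡ true → exists p ≡ true
  exists-intro i pi = dec-true (Fin.any? _) (i , pi)

  exists-elim : ∀ {n} {p : Fin n → Bool} → exists p ≡ true → ∃ λ i → p i ≡ true
  exists-elim = does-sound (Fin.any? _)

  ∑-none : ∀ {n} {p : Fin n → Bool} → (∀ i → p i ≡ false) → ∑ (χ ∘ p) ≡ 0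
  ∑-none {n} ¬p = trans (∑-cong (cong χ ∘ ¬p)) (trans (∑-const n 0) (*-zeroʳ n))

  ∑-atMostOne : ∀ {n} {p : Fin n → Bool} → (∀ i j → p i ≡ true → p j ≡ true → i ≡ j) →
                ∑ (χ ∘ p) ≤ χ (exists p)
  ∑-atMostOne {zero}  _ = z≤n
  ∑-atMostOne {suc n} {p} unique with p zero in eq
  ... | true  = ≤-reflexive (cong suc (∑-none λ i →
    Bool.¬-not λ pi → contradiction (unique zero (suc i) eq pi) λ ()))
  ... | false = ∑-atMostOne λ i j pi pj → Fin.suc-injective (unique (suc i) (suc j) pi pj)

  ∑-pick : ∀ {n} j (f : Fin n → ℕ) → ∑ (λ i → χ (j == i) * f i) ≡ f j
  ∑-pick {suc n} zero f = trans
    (cong₂ _+_ (+-identityʳ (f zero)) (trans (∑-const n 0) (*-zeroʳ n)))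
    (+-identityʳ (f zero))
  ∑-pick {suc n} (suc j) f = ∑-pick j (f ∘ suc)

  ∑-fibres : ∀ {n k} (γ : Fin n → Fin k) (f : Fin n → ℕ) →
             ∑ f ≡ ∑ (λ c → ∑ (λ i → χ (γ i == c) * f i))
  ∑-fibres γ f = sym (trans (∑-swap (λ c i → χ (γ i == c) * f i))
    (∑-cong λ i → ∑-pick (γ i) (λ _ → f i)))

  ∑-injective : ∀ {m n} (p : Fin m → Bool) (g : Fin m → Fin n) →
                (∀ i j → p i ≡ true → p j ≡ true → g i ≡ g j → i ≡ j) → ∑ (χ ∘ p) ≤ n
  ∑-injective {m} {n} p g inj = begin
    ∑ (χ ∘ p)  ≡⟨ ∑-fibres g (χ ∘ p) ⟩
    ∑ (λ c → ∑ (λ i → χ (g i == c) * χ (p i)))  ≡⟨ ∑-cong (λ c → ∑-cong λ i → sym (χ-∧ (g i == c) (p i))) ⟩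
    ∑ (λ c → ∑ (λ i → χ ((g i == c) ∧ p i)))  ≤⟨ ∑-mono (λ c → ≤-trans (∑-atMostOne λ i j ti tj →
                                                         inj i j (∧-trueʳ {g i == c} ti) (∧-trueʳ {g j == c} tj)
                                                           (trans (==-sound (∧-trueˡ ti)) (sym (==-sound (∧-trueˡ tj)))))
                                                         (χ≤1 _)) ⟩
    ∑ {n} (λ _ → 1)  ≡⟨ ∑-const n 1 ⟩
    n * 1  ≡⟨ *-identityʳ n ⟩
    n  ∎
    where open ≤-Reasoning

  -- The potential

  -- The sum over l of (2 ^ h * e - 2 ^ l * s)⁺ stands in for the entropy
  -- e log (e / s): as a function of e it is convex and piecewise linear, with
  -- breaks at the densities e / s = 2 ^ - j. The subtraction is meant to truncate.
  Φ : ℕ → ℕ → ℕ → ℕ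
  Φ h e s = ∑ {suc h} λ l → 2 ^ h * e ∸ 2 ^ toℕ l * s

  Φ-bound : ∀ h e s → Φ h e s ≤ suc h * (2 ^ h * e)
  Φ-bound h e s = ∑-bound {suc h} λ l → m∸n≤m (2 ^ h * e) (2 ^ toℕ l * s)

  -- Picks the scale at which `Φ-gain` works: there `2 ^ l * s` is below `X` but within a factor 2
  -- of it, so the subtraction in `Φ` does not truncate and a share of the area is worth a
  -- comparable share of the edges.
  dyadic-scale : ∀ h {s X} → s ≤ X → X ≤ 2 * (2 ^ h * s) →
                 ∃ λ (l : Fin (suc h)) → 2 ^ toℕ l * s ≤ X × X ≤ 2 * (2 ^ toℕ l * s)
  dyadic-scale zero {s} s≤X X≤ =
    zero , ≤-trans (≤-reflexive (+-identityʳ s)) s≤X , X≤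
  dyadic-scale (suc h) {s} {X} s≤X X≤ with 2 ^ suc h * s ≤? X
  ... | yes p = fromℕ (suc h) , subst (λ k → 2 ^ k * s ≤ X) (sym (Fin.toℕ-fromℕ (suc h))) p ,
    subst (λ k → X ≤ 2 * (2 ^ k * s)) (sym (Fin.toℕ-fromℕ (suc h))) X≤
  ... | no ¬p = let l , p , q = dyadic-scale h s≤X (≤-trans (≰⇒≥ ¬p) (≤-reflexive (*-assoc 2 (2 ^ h) s))) in
    inject₁ l , subst (λ k → 2 ^ k * s ≤ X) (sym (Fin.toℕ-inject₁ l)) p ,
    subst (λ k → X ≤ 2 * (2 ^ k * s)) (sym (Fin.toℕ-inject₁ l)) q

  module _ (h : ℕ) {N : ℕ} (member : Fin N → Bool) (e s : Fin N → ℕ) where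

    private
      E = ∑ λ c → χ (member c) * e c
      S = ∑ λ c → χ (member c) * s c
      M = 2 ^ h

      refined : ℕ → ℕ
      refined L = ∑ λ c → χ (member c) * (M * e c ∸ L * s c)

      ∑-refined : ∑ (λ c → χ (member c) * Φ h (e c) (s c)) ≡ ∑ {suc h} (λ l → refined (2 ^ toℕ l))
      ∑-refined = trans
        (∑-cong λ c → ∑-*ˡ {suc h} (χ (member c)) λ l → M * e c ∸ 2 ^ toℕ l * s c)
        (∑-swap λ c (l : Fin (suc h)) → χ (member c) * (M * e c ∸ 2 ^ toℕ l * s c))

    module _ (U : Fin N → Bool) where

      private
        E∩ = ∑ λ c → χ (member c) * χ (U c) * e c
        S∩ = ∑ λ c → χ (member c) * χ (U c) * s c

      -- On the subcells in `U` the truncated difference is estimated by 0, elsewhere by its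
      -- untruncated value. Against the untruncated sum this wins `L` times the area of `U` and
      -- loses `M` times its edges.
      refined-gain : ∀ L → M * E + L * S∩ ≤ refined L + L * S + M * E∩
      refined-gain L = begin
        M * E + L * S∩
          ≡⟨ cong₂ _+_ (∑-*ˡ M (λ c → χ (member c) * e c)) (∑-*ˡ L (λ c → χ (member c) * χ (U c) * s c)) ⟩
        ∑ (λ c → M * (χ (member c) * e c)) + ∑ (λ c → L * (χ (member c) * χ (U c) * s c))
          ≡⟨ ∑-+ (λ c → M * (χ (member c) * e c)) (λ c → L * (χ (member c) * χ (U c) * s c)) ⟨
        ∑ (λ c → M * (χ (member c) * e c) + L * (χ (member c) * χ (U c) * s c))
          ≤⟨ ∑-mono termwise ⟩
        ∑ (λ c → χ (member c) * (M * e c ∸ L * s c) + L * (χ (member c) * s c) + M * (χ (member c) * χ (U c) * e c))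
          ≡⟨ ∑-+ (λ c → χ (member c) * (M * e c ∸ L * s c) + L * (χ (member c) * s c)) (λ c → M * (χ (member c) * χ (U c) * e c)) ⟩
        ∑ (λ c → χ (member c) * (M * e c ∸ L * s c) + L * (χ (member c) * s c)) + ∑ (λ c → M * (χ (member c) * χ (U c) * e c))
          ≡⟨ cong₂ _+_ (trans (∑-+ (λ c → χ (member c) * (M * e c ∸ L * s c)) (λ c → L * (χ (member c) * s c)))
               (cong (refined L +_) (sym (∑-*ˡ L (λ c → χ (member c) * s c)))))
               (sym (∑-*ˡ M (λ c → χ (member c) * χ (U c) * e c))) ⟩
        refined L + L * S + M * E∩ ∎
        where
        open ≤-Reasoning
        termwise : ∀ c → M * (χ (member c) * e c) + L * (χ (member c) * χ (U c) * s c) ≤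
          χ (member c) * (M * e c ∸ L * s c) + L * (χ (member c) * s c) + M * (χ (member c) * χ (U c) * e c)
        termwise c with member c | U c
        ... | false | _ = ≤-reflexive (lemma M L) where
          lemma : ∀ M L → M * 0 + L * 0 ≡ L * 0 + M * 0
          lemma = solve-∀
        ... | true | true = ≤-trans (≤-reflexive (lemma M L (e c) (s c)))
          (+-monoˡ-≤ (M * (e c + 0)) (m≤n+m (L * (s c + 0)) (M * e c ∸ L * s c + 0))) where
          lemma : ∀ M L e s → M * (e + 0) + L * (s + 0) ≡ L * (s + 0) + M * (e + 0)
          lemma = solve-∀
        ... | true | false = ≤-trans (≤-reflexive (lemma M L (e c)))
          (≤-trans (m≤n+m∸n (M * e c) (L * s c)) (≤-reflexive (lemma′ M L (s c) (M * e c ∸ L * s c)))) where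
          lemma : ∀ M L e → M * (e + 0) + L * 0 ≡ M * e
          lemma = solve-∀
          lemma′ : ∀ M L s x → L * s + x ≡ x + 0 + L * (s + 0) + M * 0
          lemma′ = solve-∀

    private
      -- Convexity of the truncated difference, read off from `refined-gain` with an empty union.
      refined-mono : ∀ L → M * E ∸ L * S ≤ refined L
      refined-mono L = m≤n+o⇒m∸n≤o (M * E) (L * S) (begin
        M * E  ≤⟨ m≤m+n (M * E) (L * nothing) ⟩
        M * E + L * nothing  ≤⟨ refined-gain (λ _ → false) L ⟩
        refined L + L * S + M * nothing′ ≡⟨ cong (λ k → refined L + L * S + M * k) nothing′≡0 ⟩
        refined L + L * S + M * 0 ≡⟨ lemma M (refined L) (L * S) ⟩
        L * S + refined L  ∎)
        where
        open ≤-Reasoning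
        nothing = ∑ λ c → χ (member c) * 0 * s c
        nothing′ = ∑ λ c → χ (member c) * 0 * e c
        nothing′≡0 : nothing′ ≡ 0
        nothing′≡0 = trans (∑-cong λ c → cong (_* e c) (*-zeroʳ (χ (member c)))) (trans (∑-const N 0) (*-zeroʳ N))
        lemma : ∀ M x y → x + y + M * 0 ≡ y + x
        lemma = solve-∀

    Φ-mono : Φ h E S ≤ ∑ λ c → χ (member c) * Φ h (e c) (s c)
    Φ-mono = ≤-trans (∑-mono {suc h} λ l → refined-mono (2 ^ toℕ l)) (≤-reflexive (sym ∑-refined))

    -- A gain at the single scale `l₀` suffices, since no scale loses. There the area of `U` wins at
    -- least `L * S / 8 ≥ M * E / 16` and its edges cost at most `M * E / 32`, which leaves a 32nd
    -- of `M * E`.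
    Φ-gain : (U : Fin N → Bool) → E ≤ S → S ≤ M * E →
             S ≤ 8 * ∑ (λ c → χ (member c) * χ (U c) * s c) →
             32 * ∑ (λ c → χ (member c) * χ (U c) * e c) ≤ E →
             32 * Φ h E S + M * E ≤ 32 * ∑ (λ c → χ (member c) * Φ h (e c) (s c))
    Φ-gain U E≤S S≤ME S≤8S∩ 32E∩≤E = begin
      32 * Φ h E S + M * E
        ≡⟨ cong (_+ M * E) (∑-*ˡ {suc h} 32 (λ l → M * E ∸ 2 ^ toℕ l * S)) ⟩
      ∑ {suc h} (λ l → 32 * (M * E ∸ 2 ^ toℕ l * S)) + M * E
        ≤⟨ ∑-bump {suc h} {f = λ l → 32 * (M * E ∸ 2 ^ toℕ l * S)} {g = λ l → 32 * refined (2 ^ toℕ l)} l₀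
             (λ l → *-monoʳ-≤ 32 (refined-mono (2 ^ toℕ l))) bump ⟩
      ∑ {suc h} (λ l → 32 * refined (2 ^ toℕ l))
        ≡⟨ ∑-*ˡ {suc h} 32 (λ l → refined (2 ^ toℕ l)) ⟨
      32 * ∑ {suc h} (λ l → refined (2 ^ toℕ l))
        ≡⟨ cong (32 *_) ∑-refined ⟨
      32 * ∑ (λ c → χ (member c) * Φ h (e c) (s c)) ∎
      where
      open ≤-Reasoning
      E∩ = ∑ λ c → χ (member c) * χ (U c) * e c
      S∩ = ∑ λ c → χ (member c) * χ (U c) * s c
      scale = dyadic-scale h S≤ME (≤-trans (*-monoʳ-≤ M E≤S) (m≤n*m (M * S) 2))
      l₀ = proj₁ scale
      L = 2 ^ toℕ l₀
      LS≤ME = proj₁ (proj₂ scale)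
      ME≤2LS = proj₂ (proj₂ scale)
      D = M * E ∸ L * S
      D+LS≡ME : D + L * S ≡ M * E
      D+LS≡ME = m∸n+n≡m LS≤ME
      bump : 32 * D + M * E ≤ 32 * refined L
      bump = +-cancelʳ-≤ (32 * (L * S) + 32 * (M * E∩)) _ _ (begin
        32 * D + M * E + (32 * (L * S) + 32 * (M * E∩))
          ≡⟨ l₁ D (L * S) (M * E) M E∩ ⟩
        32 * (D + L * S) + M * E + M * (32 * E∩)
          ≤⟨ +-mono-≤ (≤-reflexive (cong (λ k → 32 * k + M * E) D+LS≡ME)) (*-monoʳ-≤ M 32E∩≤E) ⟩
        32 * (M * E) + M * E + M * E
          ≡⟨ l₂ (M * E) ⟩
        32 * (M * E) + 2 * (M * E)
          ≤⟨ +-monoʳ-≤ (32 * (M * E)) (*-monoʳ-≤ 2 ME≤2LS) ⟩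
        32 * (M * E) + 2 * (2 * (L * S))
          ≤⟨ +-monoʳ-≤ (32 * (M * E)) (*-monoʳ-≤ 2 (*-monoʳ-≤ 2 (*-monoʳ-≤ L S≤8S∩))) ⟩
        32 * (M * E) + 2 * (2 * (L * (8 * S∩)))
          ≡⟨ l₃ (M * E) L S∩ ⟩
        32 * (M * E + L * S∩)
          ≤⟨ *-monoʳ-≤ 32 (refined-gain U L) ⟩
        32 * (refined L + L * S + M * E∩)
          ≡⟨ l₄ (refined L) (L * S) (M * E∩) ⟩
        32 * refined L + (32 * (L * S) + 32 * (M * E∩)) ∎)
        where
        l₁ : ∀ d x y m z → 32 * d + y + (32 * x + 32 * (m * z)) ≡ 32 * (d + x) + y + m * (32 * z)
        l₁ = solve-∀
        l₂ : ∀ x → 32 * x + x + x ≡ 32 * x + 2 * x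
        l₂ = solve-∀
        l₃ : ∀ x l y → 32 * x + 2 * (2 * (l * (8 * y))) ≡ 32 * (x + l * y)
        l₃ = solve-∀
        l₄ : ∀ r x y → 32 * (r + x + y) ≡ 32 * r + (32 * x + 32 * y)
        l₄ = solve-∀

  -- Bipartite graphs and the potential of a colouring of pairs.

  ∑∑-mono : ∀ {m n} {f g : Fin m → Fin n → ℕ} → (∀ i j → f i j ≤ g i j) →
            ∑ (λ i → ∑ (f i)) ≤ ∑ (λ i → ∑ (g i))
  ∑∑-mono f≤g = ∑-mono λ i → ∑-mono (f≤g i)

  ∑∑-cong : ∀ {m n} {f g : Fin m → Fin n → ℕ} → (∀ i j → f i j ≡ g i j) →
            ∑ (λ i → ∑ (f i)) ≡ ∑ (λ i → ∑ (g i))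
  ∑∑-cong f≡g = ∑-cong λ i → ∑-cong (f≡g i)

  ∑-pick′ : ∀ {n} j (f : Fin n → ℕ) → ∑ (λ i → f i * χ (j == i)) ≡ f j
  ∑-pick′ j f = trans (∑-cong λ i → *-comm (f i) (χ (j == i))) (∑-pick j f)

  ∑-classes : ∀ {n k} (w : Fin k → ℕ) (γ : Fin n → Fin k) →
              ∑ (λ c → w c * ∑ (λ i → χ (γ i == c))) ≡ ∑ (λ i → w (γ i))
  ∑-classes w γ = trans
    (trans (∑-cong λ c → ∑-*ˡ (w c) (λ i → χ (γ i == c))) (∑-swap λ c i → w c * χ (γ i == c)))
    (∑-cong λ i → ∑-pick′ (γ i) w)

  ∑∑-classes : ∀ {m n k} (w : Fin k → ℕ) (γ : Fin m → Fin n → Fin k) →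
               ∑ (λ c → w c * ∑ (λ a → ∑ λ b → χ (γ a b == c))) ≡ ∑ (λ a → ∑ λ b → w (γ a b))
  ∑∑-classes w γ = trans
    (trans (∑-cong λ c → ∑-*ˡ (w c) (λ a → ∑ λ b → χ (γ a b == c))) (∑-swap λ c a → w c * ∑ λ b → χ (γ a b == c)))
    (∑-cong λ a → ∑-classes w (γ a))

  module Bipartite {m n : ℕ} (u v : Fin m → Fin n) where

    adj : Fin n → Fin n → Bool
    adj a b = exists λ t → (u t == a) ∧ (v t == b)

    adj-elim : ∀ {a b} → adj a b ≡ true → ∃ λ t → u t ≡ a × v t ≡ b
    adj-elim e = let t , q = exists-elim e in t , ==-sound (∧-trueˡ q) , ==-sound (∧-trueʳ {u t == _} q)

    edges : ∀ {κ} → (Fin n → Fin n → Fin κ) → Fin κ → ℕ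
    edges γ c = ∑ λ t → χ (γ (u t) (v t) == c)

    pairs : ∀ {κ} → (Fin n → Fin n → Fin κ) → Fin κ → ℕ
    pairs γ c = ∑ λ a → ∑ λ b → χ (γ a b == c)

    Ψ : ∀ {κ} → ℕ → (Fin n → Fin n → Fin κ) → ℕ
    Ψ h γ = ∑ λ c → Φ h (edges γ c) (pairs γ c)

    Ψ-bound : ∀ {κ} h (γ : Fin n → Fin n → Fin κ) → Ψ h γ ≤ suc h * (2 ^ h * m)
    Ψ-bound h γ = begin
      Ψ h γ  ≤⟨ ∑-mono (λ c → Φ-bound h (edges γ c) (pairs γ c)) ⟩
      ∑ (λ c → suc h * (2 ^ h * edges γ c))  ≡⟨ ∑-*ˡ (suc h) (λ c → 2 ^ h * edges γ c) ⟨
      suc h * ∑ (λ c → 2 ^ h * edges γ c)  ≡⟨ cong (suc h *_) (∑-*ˡ (2 ^ h) (edges γ)) ⟨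
      suc h * (2 ^ h * ∑ (edges γ))  ≡⟨ cong (λ k → suc h * (2 ^ h * k)) total ⟩
      suc h * (2 ^ h * m)  ∎
      where
      open ≤-Reasoning
      total : ∑ (edges γ) ≡ m
      total = trans (∑-cong λ c → sym (*-identityˡ (edges γ c)))
        (trans (∑-classes (λ _ → 1) (λ t → γ (u t) (v t))) (trans (∑-const m 1) (*-identityʳ m)))

    module Simple (simple : ∀ s t → u s ≡ u t → v s ≡ v t → s ≡ t) where

      edge≤adj : ∀ a b → ∑ (λ t → χ (u t == a) * χ (v t == b)) ≤ χ (adj a b)
      edge≤adj a b = ≤-trans (≤-reflexive (∑-cong λ t → sym (χ-∧ (u t == a) (v t == b))))
        (∑-atMostOne λ s t ps pt → simple s t
          (trans (==-sound (∧-trueˡ ps)) (sym (==-sound (∧-trueˡ pt))))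
          (trans (==-sound (∧-trueʳ {u s == a} ps)) (sym (==-sound (∧-trueʳ {u t == a} pt)))))

      ∑-edges : (F : Fin n → Fin n → ℕ) → ∑ (λ t → F (u t) (v t)) ≤ ∑ λ a → ∑ λ b → F a b * χ (adj a b)
      ∑-edges F = begin
        ∑ (λ t → F (u t) (v t))
          ≡⟨ ∑-cong (λ t → trans (∑-cong (λ a → cong (χ (u t == a) *_) (∑-pick (v t) (F a)))) (∑-pick (u t) (λ a → F a (v t)))) ⟨
        ∑ (λ t → ∑ λ a → χ (u t == a) * ∑ λ b → χ (v t == b) * F a b)
          ≡⟨ ∑-swap (λ t a → χ (u t == a) * ∑ λ b → χ (v t == b) * F a b) ⟩
        ∑ (λ a → ∑ λ t → χ (u t == a) * ∑ λ b → χ (v t == b) * F a b)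
          ≡⟨ ∑-cong (λ a → trans (∑-cong λ t → ∑-*ˡ (χ (u t == a)) (λ b → χ (v t == b) * F a b))
               (∑-swap λ t b → χ (u t == a) * (χ (v t == b) * F a b))) ⟩
        ∑ (λ a → ∑ λ b → ∑ λ t → χ (u t == a) * (χ (v t == b) * F a b))
          ≡⟨ ∑∑-cong (λ a b → trans (∑-cong λ t → lemma (χ (u t == a)) (χ (v t == b)) (F a b))
               (sym (∑-*ˡ (F a b) (λ t → χ (u t == a) * χ (v t == b))))) ⟩
        ∑ (λ a → ∑ λ b → F a b * ∑ λ t → χ (u t == a) * χ (v t == b))
          ≤⟨ ∑∑-mono (λ a b → *-monoʳ-≤ (F a b) (edge≤adj a b)) ⟩
        ∑ (λ a → ∑ λ b → F a b * χ (adj a b)) ∎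
        where
        open ≤-Reasoning
        lemma : ∀ x y z → x * (y * z) ≡ z * (x * y)
        lemma = solve-∀

      ∑-edges≤∑-pairs : (F : Fin n → Fin n → ℕ) → ∑ (λ t → F (u t) (v t)) ≤ ∑ λ a → ∑ λ b → F a b
      ∑-edges≤∑-pairs F = ≤-trans (∑-edges F) (∑∑-mono λ a b →
        ≤-trans (*-monoʳ-≤ (F a b) (χ≤1 (adj a b))) (≤-reflexive (*-identityʳ (F a b))))

      module Refinement {κ κ′ : ℕ} (h : ℕ)
        (γ : Fin n → Fin n → Fin κ) (γ′ : Fin n → Fin n → Fin κ′)
        (π : Fin κ′ → Fin κ) (π∘γ′ : ∀ a b → π (γ′ a b) ≡ γ a b) where

        Shattered : Fin κ → Set
        Shattered c = ∃ λ (U : Fin κ′ → Bool) →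
          (∑ λ a → ∑ λ b → χ (γ a b == c)) ≤ 8 * (∑ λ a → ∑ λ b → χ (γ a b == c) * χ (U (γ′ a b))) ×
          32 * (∑ λ t → χ (γ (u t) (v t) == c) * χ (U (γ′ (u t) (v t)))) ≤ ∑ λ t → χ (γ (u t) (v t) == c)

        private
          edges-push : ∀ c → ∑ (λ c′ → χ (π c′ == c) * edges γ′ c′) ≡ edges γ c
          edges-push c = trans (∑-classes (λ c′ → χ (π c′ == c)) (λ t → γ′ (u t) (v t)))
            (∑-cong λ t → cong (λ i → χ (i == c)) (π∘γ′ (u t) (v t)))

          pairs-push : ∀ c → ∑ (λ c′ → χ (π c′ == c) * pairs γ′ c′) ≡ pairs γ c
          pairs-push c = trans (∑∑-classes (λ c′ → χ (π c′ == c)) γ′)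
            (∑∑-cong λ a b → cong (λ i → χ (i == c)) (π∘γ′ a b))

          edges-push-U : ∀ c (U : Fin κ′ → Bool) → ∑ (λ c′ → χ (π c′ == c) * χ (U c′) * edges γ′ c′) ≡
            ∑ λ t → χ (γ (u t) (v t) == c) * χ (U (γ′ (u t) (v t)))
          edges-push-U c U = trans (∑-classes (λ c′ → χ (π c′ == c) * χ (U c′)) (λ t → γ′ (u t) (v t)))
            (∑-cong λ t → cong (λ i → χ (i == c) * _) (π∘γ′ (u t) (v t)))

          pairs-push-U : ∀ c (U : Fin κ′ → Bool) → ∑ (λ c′ → χ (π c′ == c) * χ (U c′) * pairs γ′ c′) ≡
            ∑ λ a → ∑ λ b → χ (γ a b == c) * χ (U (γ′ a b))
          pairs-push-U c U = trans (∑∑-classes (λ c′ → χ (π c′ == c) * χ (U c′)) γ′)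
            (∑∑-cong λ a b → cong (λ i → χ (i == c) * _) (π∘γ′ a b))

          refined : Fin κ → ℕ
          refined c = ∑ λ c′ → χ (π c′ == c) * Φ h (edges γ′ c′) (pairs γ′ c′)

          class-mono : ∀ c → Φ h (edges γ c) (pairs γ c) ≤ refined c
          class-mono c = subst₂ (λ e s → Φ h e s ≤ refined c) (edges-push c) (pairs-push c)
            (Φ-mono h (λ c′ → π c′ == c) (edges γ′) (pairs γ′))

          class-gain : ∀ c → pairs γ c ≤ 2 ^ h * edges γ c → Shattered c →
            32 * Φ h (edges γ c) (pairs γ c) + 2 ^ h * edges γ c ≤ 32 * refined c
          class-gain c dense (U , big , few) =
            subst₂ (λ e s → 32 * Φ h e s + 2 ^ h * e ≤ 32 * refined c) (edges-push c) (pairs-push c)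
            (Φ-gain h (λ c′ → π c′ == c) (edges γ′) (pairs γ′) U
              (subst₂ _≤_ (sym (edges-push c)) (sym (pairs-push c))
                (∑-edges≤∑-pairs λ a b → χ (γ a b == c)))
              (subst₂ (λ e s → s ≤ 2 ^ h * e) (sym (edges-push c)) (sym (pairs-push c)) dense)
              (subst₂ (λ s s∩ → s ≤ 8 * s∩) (sym (pairs-push c)) (sym (pairs-push-U c U)) big)
              (subst₂ (λ e e∩ → 32 * e∩ ≤ e) (sym (edges-push c)) (sym (edges-push-U c U)) few))

        -- Shattered classes gain by `class-gain`, and by convexity the remaining ones do not lose.
        -- So one common refinement can serve all classes in `G` at once and the gains add up.
        Ψ-gain : (G : Fin κ → Bool) →
                 (∀ c → G c ≡ true → pairs γ c ≤ 2 ^ h * edges γ c × Shattered c) →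
                 32 * Ψ h γ + 2 ^ h * ∑ (λ t → χ (G (γ (u t) (v t)))) ≤ 32 * Ψ h γ′
        Ψ-gain G gain = begin
          32 * Ψ h γ + 2 ^ h * ∑ (λ t → χ (G (γ (u t) (v t))))
            ≡⟨ cong₂ _+_ (∑-*ˡ 32 λ c → Φ h (edges γ c) (pairs γ c))
                 (trans (cong (2 ^ h *_) (sym (∑-classes (χ ∘ G) (λ t → γ (u t) (v t)))))
                   (∑-*ˡ (2 ^ h) λ c → χ (G c) * edges γ c)) ⟩
          ∑ (λ c → 32 * Φ h (edges γ c) (pairs γ c)) + ∑ (λ c → 2 ^ h * (χ (G c) * edges γ c))
            ≡⟨ ∑-+ (λ c → 32 * Φ h (edges γ c) (pairs γ c)) (λ c → 2 ^ h * (χ (G c) * edges γ c)) ⟨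
          ∑ (λ c → 32 * Φ h (edges γ c) (pairs γ c) + 2 ^ h * (χ (G c) * edges γ c))
            ≤⟨ ∑-mono step ⟩
          ∑ (λ c → 32 * refined c)
            ≡⟨ ∑-*ˡ 32 refined ⟨
          32 * ∑ refined
            ≡⟨ cong (32 *_) (∑-fibres π λ c′ → Φ h (edges γ′ c′) (pairs γ′ c′)) ⟨
          32 * Ψ h γ′ ∎
          where
          open ≤-Reasoning
          step : ∀ c → 32 * Φ h (edges γ c) (pairs γ c) + 2 ^ h * (χ (G c) * edges γ c) ≤ 32 * refined c
          step c with G c in eq
          ... | true  = ≤-trans
            (≤-reflexive (cong (λ k → 32 * Φ h (edges γ c) (pairs γ c) + 2 ^ h * k) (+-identityʳ (edges γ c))))
            (class-gain c (proj₁ (gain c eq)) (proj₂ (gain c eq)))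
          ... | false = ≤-trans
            (≤-reflexive (trans (cong (32 * Φ h (edges γ c) (pairs γ c) +_) (*-zeroʳ (2 ^ h))) (+-identityʳ _)))
            (*-monoʳ-≤ 32 (class-mono c))

  -- The local step

  does-complete : ∀ {A : Set} (d : Dec A) → does d ≡ false → ¬ A
  does-complete (no ¬a) _ = ¬a

  not-true : ∀ {b} → not b ≡ true → b ≡ false
  not-true {false} _ = refl

  ∣_∣ₚ : ∀ {n} → (Fin n → Bool) → ℕ
  ∣ A ∣ₚ = ∑ (χ ∘ A)

  ∑-split : ∀ {n} (w : Fin n → ℕ) (p : Fin n → Bool) →
            ∑ (λ i → w i * χ (p i)) + ∑ (λ i → w i * χ (not (p i))) ≡ ∑ w
  ∑-split w p = trans (sym (∑-+ (λ i → w i * χ (p i)) (λ i → w i * χ (not (p i)))))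
    (∑-cong λ i → trans (sym (*-distribˡ-+ (w i) (χ (p i)) (χ (not (p i)))))
      (trans (cong (w i *_) (χ-not (p i))) (*-identityʳ (w i))))

  majority : ∀ {k l t} → k + l ≡ t → ¬ t ≤ 2 * k → t ≤ 2 * l
  majority {k} {l} {t} k+l≡t ¬t≤2k = +-cancelˡ-≤ t _ _ (begin
    t + t  ≡⟨ cong (t +_) (+-identityʳ t) ⟨
    2 * t  ≡⟨ cong (2 *_) k+l≡t ⟨
    2 * (k + l)  ≡⟨ *-distribˡ-+ 2 k l ⟩
    2 * k + 2 * l  ≤⟨ +-monoˡ-≤ (2 * l) (≰⇒≥ ¬t≤2k) ⟩
    t + 2 * l  ∎)
    where open ≤-Reasoning

  -- A 3-partite linear 3-graph without three edges on six vertices: the edges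
  -- are (x t , y t , z t), and each part is a copy of Fin n.
  record TriangleSystem (n m : ℕ) : Set where
    field
      x y z : Fin m → Fin n
      xy-simple : ∀ s t → x s ≡ x t → y s ≡ y t → s ≡ t
      xz-simple : ∀ s t → x s ≡ x t → z s ≡ z t → s ≡ t
      yz-simple : ∀ s t → y s ≡ y t → z s ≡ z t → s ≡ t
      induced : ∀ r s t → x r ≡ x s → y r ≡ y t → z s ≡ z t → r ≡ t

  -- For `row L b` and `col L c` a common true entry means that `(b , c)` lies in the box of a
  -- vertex of `L`. Being covered can thus be read from the colours of `b` and `c`.
  meet : ∀ {k} → Vec Bool k → Vec Bool k → Bool
  meet []       []       = false
  meet (a ∷ as) (b ∷ bs) = (a ∧ b) ∨ meet as bs

  module _ {m n : ℕ} (u v : Fin m → Fin n) (A B : Fin n → Bool) where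

    edgesBetween : ℕ
    edgesBetween = ∑ λ t → χ (A (u t)) * χ (B (v t))

    -- The union of subcells is a predicate on colours, not on vertices, so it remains a union of
    -- cells when the colours of many splits are combined into one refinement.
    record Splits {s} (p q : Fin n → Vec Bool s) : Set where
      constructor splits
      field
        subcells : Vec Bool s → Vec Bool s → Bool
        big      : ∣ A ∣ₚ * ∣ B ∣ₚ ≤ 8 * ∑ (λ a → ∑ λ b → χ (A a) * χ (B b) * χ (subcells (p a) (q b)))
        few      : 32 * ∑ (λ t → χ (A (u t)) * χ (B (v t)) * χ (subcells (p (u t)) (q (v t)))) ≤ edgesBetween

  module LocalStep {n m : ℕ} (T : TriangleSystem n m) (h β : ℕ) (β≡ : β ≡ 32 * 2 ^ h) where
    open TriangleSystem T
    module XY = Bipartite x y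
    module XZ = Bipartite x z

    -- A box is worth taking if it adds `1 / β²` of the area, the product of the two thresholds
    -- `1 / β` in `isolated` and `Partner`; after `β²` such boxes everything would be covered.
    steps = β * β

    -- One bit for each vertex of the greedy list and a leading bit for `isolated`, which is
    -- constantly `false` in the colours of the other two parts.
    Colour = Vec Bool (suc steps)

    row : ∀ {k} → Vec (Fin n) k → Fin n → Vec Bool k
    row L b = map (λ a → XY.adj a b) L

    col : ∀ {k} → Vec (Fin n) k → Fin n → Vec Bool k
    col L c = map (λ a → XZ.adj a c) L

    covered : ∀ {k} → Vec (Fin n) k → Fin n → Fin n → Bool
    covered L b c = meet (row L b) (col L c)

    degree≤n : ∀ a → ∑ (λ t → χ (x t == a)) ≤ n
    degree≤n a = ∑-injective (λ t → x t == a) y λ s t ps pt →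
      xy-simple s t (trans (==-sound ps) (sym (==-sound pt)))

    -- An edge between two neighbours of a lies in a triangle at a.
    neighbourhood-edges : ∀ a → ∑ (λ t → χ (XY.adj a (y t) ∧ XZ.adj a (z t))) ≤ n
    neighbourhood-edges a = ≤-trans (∑-mono λ t → χ-mono λ e →
      let r , xr , yr = XY.adj-elim (∧-trueˡ e)
          s , xs , zs = XZ.adj-elim (∧-trueʳ {XY.adj a (y t)} e)
          r≡t = induced r s t (trans xr (sym xs)) yr zs
      in ==-complete (trans (cong x (sym r≡t)) xr)) (degree≤n a)

    covered-edges : ∀ {k} (L : Vec (Fin n) k) → ∑ (λ t → χ (covered L (y t) (z t))) ≤ k * n
    covered-edges []      = ≤-reflexive (trans (∑-const m 0) (*-zeroʳ m))
    covered-edges (a ∷ L) = begin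
      ∑ (λ t → χ ((XY.adj a (y t) ∧ XZ.adj a (z t)) ∨ covered L (y t) (z t)))
        ≤⟨ ∑-mono (λ t → χ-∨ (XY.adj a (y t) ∧ XZ.adj a (z t)) _) ⟩
      ∑ (λ t → χ (XY.adj a (y t) ∧ XZ.adj a (z t)) + χ (covered L (y t) (z t)))
        ≡⟨ ∑-+ (λ t → χ (XY.adj a (y t) ∧ XZ.adj a (z t))) (λ t → χ (covered L (y t) (z t))) ⟩
      ∑ (λ t → χ (XY.adj a (y t) ∧ XZ.adj a (z t))) + ∑ (λ t → χ (covered L (y t) (z t)))
        ≤⟨ +-mono-≤ (neighbourhood-edges a) (covered-edges L) ⟩
      n + _ ∎
      where
      open ≤-Reasoning
      χ-∨ : ∀ a b → χ (a ∨ b) ≤ χ a + χ b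
      χ-∨ true  b = s≤s z≤n
      χ-∨ false b = ≤-refl

    module _ (A B C : Fin n → Bool) where

      private
        ∣A∣ = ∣ A ∣ₚ
        ∣B∣ = ∣ B ∣ₚ
        ∣C∣ = ∣ C ∣ₚ

      cover : ∀ {k} → Vec (Fin n) k → ℕ
      cover L = ∑ λ b → ∑ λ c → χ (B b) * χ (C c) * χ (covered L b c)

      fresh : ∀ {k} → Vec (Fin n) k → Fin n → ℕ
      fresh L a = ∑ λ b → ∑ λ c → χ (B b) * χ (C c) * χ ((XY.adj a b ∧ XZ.adj a c) ∧ not (covered L b c))

      cover-∷ : ∀ {k} a (L : Vec (Fin n) k) → cover (a ∷ L) ≡ fresh L a + cover L
      cover-∷ a L = trans
        (∑∑-cong λ b c → trans
          (cong (χ (B b) * χ (C c) *_) (lemma (XY.adj a b ∧ XZ.adj a c) (covered L b c)))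
          (*-distribˡ-+ (χ (B b) * χ (C c)) (χ ((XY.adj a b ∧ XZ.adj a c) ∧ not (covered L b c))) (χ (covered L b c))))
        (trans (∑-cong λ b → ∑-+ (λ c → χ (B b) * χ (C c) * χ ((XY.adj a b ∧ XZ.adj a c) ∧ not (covered L b c)))
                                 (λ c → χ (B b) * χ (C c) * χ (covered L b c)))
          (∑-+ (λ b → ∑ λ c → χ (B b) * χ (C c) * χ ((XY.adj a b ∧ XZ.adj a c) ∧ not (covered L b c)))
               (λ b → ∑ λ c → χ (B b) * χ (C c) * χ (covered L b c))))
        where
        lemma : ∀ p u → χ (p ∨ u) ≡ χ (p ∧ not u) + χ u
        lemma true  true  = refl
        lemma true  false = refl
        lemma false u     = refl

      Exhausted : ∀ {k} → Vec (Fin n) k → Set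
      Exhausted L = ∀ a → steps * fresh L a < ∣B∣ * ∣C∣

      exhausted-∷ : ∀ {k} a₀ (L : Vec (Fin n) k) → Exhausted L → Exhausted (a₀ ∷ L)
      exhausted-∷ a₀ L exhausted a = ≤-<-trans (*-monoʳ-≤ steps (∑∑-mono λ b c →
        *-monoʳ-≤ (χ (B b) * χ (C c)) (lemma (XY.adj a b ∧ XZ.adj a c) (XY.adj a₀ b ∧ XZ.adj a₀ c) (covered L b c))))
        (exhausted a)
        where
        lemma : ∀ p q u → χ (p ∧ not (q ∨ u)) ≤ χ (p ∧ not u)
        lemma true  true  u = z≤n
        lemma true  false u = ≤-refl
        lemma false q     u = z≤n

      -- The vertex a₀ only pads the list when no box adds enough.
      greedy : Fin n → ∀ k → ∃ λ (L : Vec (Fin n) k) → k * (∣B∣ * ∣C∣) ≤ steps * cover L ⊎ Exhausted L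
      greedy a₀ zero    = [] , inj₁ z≤n
      greedy a₀ (suc k) with greedy a₀ k
      ... | L , inj₂ exhausted = a₀ ∷ L , inj₂ (exhausted-∷ a₀ L exhausted)
      ... | L , inj₁ big with Fin.any? (λ a → ∣B∣ * ∣C∣ ≤? steps * fresh L a)
      ...   | no ¬new       = a₀ ∷ L , inj₂ (exhausted-∷ a₀ L λ a → ≰⇒> λ new → ¬new (a , new))
      ...   | yes (a , new) = a ∷ L , inj₁ (begin
        ∣B∣ * ∣C∣ + k * (∣B∣ * ∣C∣)  ≤⟨ +-mono-≤ new big ⟩
        steps * fresh L a + steps * cover L  ≡⟨ *-distribˡ-+ steps (fresh L a) (cover L) ⟨
        steps * (fresh L a + cover L)  ≡⟨ cong (steps *_) (cover-∷ a L) ⟨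
        steps * cover (a ∷ L)  ∎)
        where open ≤-Reasoning

      module _ (L : Vec (Fin n) steps)
               (dense-xy : ∣A∣ * ∣B∣ ≤ 2 ^ h * edgesBetween x y A B)
               (dense-xz : ∣A∣ * ∣C∣ ≤ 2 ^ h * edgesBetween x z A C)
               (many-yz : 32 * (steps * n) ≤ edgesBetween y z B C) where

        -- Each of the `steps` boxes contains at most `n` edges, and `many-yz` makes their total at
        -- most a 32nd of the edges between `B` and `C`.
        cover-splits : ∣B∣ * ∣C∣ ≤ 8 * cover L → Splits y z B C (λ b → false ∷ row L b) (λ c → false ∷ col L c)
        cover-splits big = splits (λ u v → meet (tail u) (tail v)) big
          (≤-trans (*-monoʳ-≤ 32 (≤-trans
            (∑-mono λ t → ≤-trans (*-monoˡ-≤ (χ (covered L (y t) (z t))) (*-mono-≤ (χ≤1 (B (y t))) (χ≤1 (C (z t)))))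
              (≤-reflexive (+-identityʳ _)))
            (covered-edges L))) many-yz)

        module _ (small : 8 * cover L < ∣B∣ * ∣C∣) (exhausted : Exhausted L) where

          -- Defined on vectors instead of vertices, so that `isolated-splits` can evaluate it on
          -- the colour of `b`.
          rich : Vec Bool steps → Bool
          rich v = does (∣C∣ ≤? 2 * ∑ λ c → χ (C c) * χ (meet v (col L c)))

          poor : Fin n → Bool
          poor b = not (rich (row L b))

          ∣rich∣ = ∑ λ b → χ (B b) * χ (rich (row L b))
          ∣poor∣ = ∑ λ b → χ (B b) * χ (poor b)

          rich≤cover : ∣rich∣ * ∣C∣ ≤ 2 * cover L
          rich≤cover = begin
            ∣rich∣ * ∣C∣
              ≡⟨ ∑-*ʳ ∣C∣ (λ b → χ (B b) * χ (rich (row L b))) ⟩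
            ∑ (λ b → χ (B b) * χ (rich (row L b)) * ∣C∣)
              ≤⟨ ∑-mono (λ b → ≤-trans (≤-reflexive (*-assoc (χ (B b)) (χ (rich (row L b))) ∣C∣))
                   (*-monoʳ-≤ (χ (B b)) (≤-trans
                     (χ-≤* (rich (row L b)) λ r → does-sound (∣C∣ ≤? _) r)
                     (χ-*≤ (rich (row L b)) (2 * ∑ λ c → χ (C c) * χ (covered L b c)))))) ⟩
            ∑ (λ b → χ (B b) * (2 * ∑ λ c → χ (C c) * χ (covered L b c)))
              ≡⟨ ∑-cong (λ b → lemma (χ (B b)) (∑ λ c → χ (C c) * χ (covered L b c))) ⟩
            ∑ (λ b → 2 * (χ (B b) * ∑ λ c → χ (C c) * χ (covered L b c)))
              ≡⟨ ∑-*ˡ 2 (λ b → χ (B b) * ∑ λ c → χ (C c) * χ (covered L b c)) ⟨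
            2 * ∑ (λ b → χ (B b) * ∑ λ c → χ (C c) * χ (covered L b c))
              ≡⟨ cong (2 *_) (∑-cong λ b → trans (∑-*ˡ (χ (B b)) (λ c → χ (C c) * χ (covered L b c)))
                   (∑-cong λ c → sym (*-assoc (χ (B b)) (χ (C c)) (χ (covered L b c))))) ⟩
            2 * cover L ∎
            where
            open ≤-Reasoning
            lemma : ∀ b k → b * (2 * k) ≡ 2 * (b * k)
            lemma = solve-∀

          rich-few : 4 * ∣rich∣ < ∣B∣
          rich-few = *-cancelʳ-< ∣C∣ (4 * ∣rich∣) ∣B∣ (begin-strict
            4 * ∣rich∣ * ∣C∣  ≡⟨ *-assoc 4 ∣rich∣ ∣C∣ ⟩
            4 * (∣rich∣ * ∣C∣)  ≤⟨ *-monoʳ-≤ 4 rich≤cover ⟩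
            4 * (2 * cover L)  ≡⟨ *-assoc 4 2 (cover L) ⟨
            8 * cover L  <⟨ small ⟩
            ∣B∣ * ∣C∣  ∎)
            where open ≤-Reasoning

          -- More than three quarters of `B` are poor. A quarter is what remains to be shown: with
          -- half of `A` it makes the eighth in `Splits`.
          poor-many : ∣B∣ ≤ 4 * ∣poor∣
          poor-many = +-cancelˡ-≤ (4 * ∣rich∣) _ _ (begin
            4 * ∣rich∣ + ∣B∣  ≤⟨ +-monoˡ-≤ ∣B∣ (<⇒≤ rich-few) ⟩
            ∣B∣ + ∣B∣  ≤⟨ m≤m+n (∣B∣ + ∣B∣) (2 * ∣B∣) ⟩
            ∣B∣ + ∣B∣ + 2 * ∣B∣  ≡⟨ lemma ∣B∣ ⟩
            4 * ∣B∣  ≡⟨ cong (4 *_) (∑-split (χ ∘ B) (rich ∘ row L)) ⟨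
            4 * (∣rich∣ + ∣poor∣)  ≡⟨ *-distribˡ-+ 4 ∣rich∣ ∣poor∣ ⟩
            4 * ∣rich∣ + 4 * ∣poor∣  ∎)
            where
            open ≤-Reasoning
            lemma : ∀ b → b + b + 2 * b ≡ 4 * b
            lemma = solve-∀

          poorDegree : Fin n → ℕ
          poorDegree a = ∑ λ b → χ (B b) * χ (poor b) * χ (XY.adj a b)

          isolated : Fin n → Bool
          isolated a = does (β * poorDegree a ≤? ∣B∣)

          uncoveredDegree : Fin n → Fin n → ℕ
          uncoveredDegree a b = ∑ λ c → χ (C c) * χ (XZ.adj a c ∧ not (covered L b c))

          Partner : Fin n → Fin n → Set
          Partner a b = poor b ≡ true × β * uncoveredDegree a b ≤ ∣C∣

          -- Without a partner, each of the at least `∣B∣ / β` poor neighbours of `a` would see at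
          -- least `∣C∣ / β` uncovered neighbours of `a` in `C`, and the box of `a` would still add
          -- `1 / β²` of the area, against `exhausted`.
          find-partner : ∀ a → isolated a ≡ false → ∃ (Partner a)
          find-partner a ¬iso with Fin.any? (λ b → poor b Bool.≟ true ×-dec β * uncoveredDegree a b ≤? ∣C∣)
          ... | yes partner = partner
          ... | no ¬partner = contradiction (exhausted a) (≤⇒≯ (begin
            ∣B∣ * ∣C∣  ≤⟨ *-monoˡ-≤ ∣C∣ (≰⇒≥ (does-complete (β * poorDegree a ≤? ∣B∣) ¬iso)) ⟩
            β * poorDegree a * ∣C∣  ≡⟨ *-assoc β (poorDegree a) ∣C∣ ⟩
            β * (poorDegree a * ∣C∣)  ≤⟨ *-monoʳ-≤ β poor≤fresh ⟩
            β * (β * fresh L a)  ≡⟨ *-assoc β β (fresh L a) ⟨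
            steps * fresh L a  ∎))
            where
            open ≤-Reasoning
            termwise : ∀ b → χ (B b) * χ (poor b) * χ (XY.adj a b) * ∣C∣ ≤ β * (χ (B b) * (χ (XY.adj a b) * uncoveredDegree a b))
            termwise b with B b | poor b in is-poor | XY.adj a b
            ... | false | _     | _     = z≤n
            ... | true  | false | _     = z≤n
            ... | true  | true  | false = z≤n
            ... | true  | true  | true  = ≤-trans (≤-reflexive (+-identityʳ ∣C∣))
              (≤-trans (≰⇒≥ λ ≤C → ¬partner (b , is-poor , ≤C)) (≤-reflexive (lemma β (uncoveredDegree a b)))) where
              lemma : ∀ β k → β * k ≡ β * (k + 0 + 0)
              lemma = solve-∀
            poor≤fresh : poorDegree a * ∣C∣ ≤ β * fresh L a
            poor≤fresh = begin
              poorDegree a * ∣C∣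
                ≡⟨ ∑-*ʳ ∣C∣ (λ b → χ (B b) * χ (poor b) * χ (XY.adj a b)) ⟩
              ∑ (λ b → χ (B b) * χ (poor b) * χ (XY.adj a b) * ∣C∣)
                ≤⟨ ∑-mono termwise ⟩
              ∑ (λ b → β * (χ (B b) * (χ (XY.adj a b) * uncoveredDegree a b)))
                ≡⟨ ∑-*ˡ β (λ b → χ (B b) * (χ (XY.adj a b) * uncoveredDegree a b)) ⟨
              β * ∑ (λ b → χ (B b) * (χ (XY.adj a b) * uncoveredDegree a b))
                ≡⟨ cong (β *_) (∑-cong λ b → trans (sym (*-assoc (χ (B b)) (χ (XY.adj a b)) _))
                     (trans (∑-*ˡ (χ (B b) * χ (XY.adj a b)) λ c → χ (C c) * χ (XZ.adj a c ∧ not (covered L b c)))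
                     (∑-cong λ c → regroup (χ (B b)) (XY.adj a b) (χ (C c)) (XZ.adj a c) (not (covered L b c))))) ⟩
              β * fresh L a ∎
              where
              regroup : ∀ i p j q r → i * χ p * (j * χ (q ∧ r)) ≡ i * j * χ ((p ∧ q) ∧ r)
              regroup i true  j q r = lemma i j (χ (q ∧ r)) where
                lemma : ∀ i j k → i * 1 * (j * k) ≡ i * j * k
                lemma = solve-∀
              regroup i false j q r = lemma i j (χ (q ∧ r)) where
                lemma : ∀ i j k → i * 0 * (j * k) ≡ i * j * 0
                lemma = solve-∀

          choose-partner : ∀ a → ∃ λ b → isolated a ≡ false → Partner a b
          choose-partner a with isolated a Bool.≟ false
          ... | yes ¬iso = let b , p = find-partner a ¬iso in b , λ _ → p
          -- A dummy for isolated vertices; `connected-splits` excludes them by the leading bit of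
          -- their colour.
          ... | no iso   = a , λ ¬iso → contradiction ¬iso iso

          partner : Fin n → Fin n
          partner a = proj₁ (choose-partner a)

          partner-property : ∀ a → isolated a ≡ false → Partner a (partner a)
          partner-property a = proj₂ (choose-partner a)

          -- The vertex `a` inherits the row of its partner. Whether `c` is covered together with
          -- `partner a` thereby becomes a function of the colours of `a` and `c`, although it
          -- speaks about a third vertex.
          colour-x : Fin n → Colour
          colour-x a = isolated a ∷ row L (partner a)

          ∣isolated∣ = ∑ λ a → χ (A a) * χ (isolated a)
          ∣connected∣ = ∑ λ a → χ (A a) * χ (not (isolated a))

          -- The origin of `β`: in a pair of density at least `2 ^ - h`, a number of edges below
          -- `1 / β` of the area is at most a 32nd of all edges.
          cancel-density : ∀ {k l e} → β * k ≤ l → l ≤ 2 ^ h * e → 32 * k ≤ e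
          cancel-density {k} {l} {e} βk≤l l≤ = *-cancelˡ-≤ (2 ^ h) {{m^n≢0 2 h}}
            (≤-trans (≤-reflexive (trans (lemma (2 ^ h) k) (cong (_* k) (sym β≡)))) (≤-trans βk≤l l≤))
            where
            lemma : ∀ p k → p * (32 * k) ≡ 32 * p * k
            lemma = solve-∀

          -- The subcells are isolated times poor. By definition an isolated vertex sends at most
          -- `∣B∣ / β` edges to poor ones.
          isolated-splits : ∣A∣ ≤ 2 * ∣isolated∣ → Splits x y A B colour-x (λ b → false ∷ row L b)
          isolated-splits many = splits (λ u v → head u ∧ not (rich (tail v))) big (cancel-density few dense-xy)
            where
            open ≤-Reasoning
            big : ∣A∣ * ∣B∣ ≤ 8 * ∑ (λ a → ∑ λ b → χ (A a) * χ (B b) * χ (isolated a ∧ poor b))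
            big = begin
              ∣A∣ * ∣B∣  ≤⟨ *-mono-≤ many poor-many ⟩
              2 * ∣isolated∣ * (4 * ∣poor∣)  ≡⟨ lemma ∣isolated∣ ∣poor∣ ⟩
              8 * (∣isolated∣ * ∣poor∣)  ≡⟨ cong (8 *_) (∑-product (λ a → χ (A a) * χ (isolated a)) (λ b → χ (B b) * χ (poor b))) ⟩
              8 * ∑ (λ a → ∑ λ b → χ (A a) * χ (isolated a) * (χ (B b) * χ (poor b)))
                ≡⟨ cong (8 *_) (∑∑-cong λ a b → trans (lemma′ (χ (A a)) (χ (isolated a)) (χ (B b)) (χ (poor b)))
                     (cong (χ (A a) * χ (B b) *_) (sym (χ-∧ (isolated a) (poor b))))) ⟩
              8 * ∑ (λ a → ∑ λ b → χ (A a) * χ (B b) * χ (isolated a ∧ poor b)) ∎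
              where
              lemma : ∀ i p → 2 * i * (4 * p) ≡ 8 * (i * p)
              lemma = solve-∀
              lemma′ : ∀ a i b p → a * i * (b * p) ≡ a * b * (i * p)
              lemma′ = solve-∀
            few : β * ∑ (λ t → χ (A (x t)) * χ (B (y t)) * χ (isolated (x t) ∧ poor (y t))) ≤ ∣A∣ * ∣B∣
            few = begin
              β * ∑ (λ t → χ (A (x t)) * χ (B (y t)) * χ (isolated (x t) ∧ poor (y t)))
                ≤⟨ *-monoʳ-≤ β (XY.Simple.∑-edges xy-simple λ a b → χ (A a) * χ (B b) * χ (isolated a ∧ poor b)) ⟩
              β * ∑ (λ a → ∑ λ b → χ (A a) * χ (B b) * χ (isolated a ∧ poor b) * χ (XY.adj a b))
                ≡⟨ cong (β *_) (∑-cong λ a → trans (∑-cong λ b → trans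
                     (cong (λ k → χ (A a) * χ (B b) * k * χ (XY.adj a b)) (χ-∧ (isolated a) (poor b)))
                     (lemma (χ (A a)) (χ (B b)) (χ (isolated a)) (χ (poor b)) (χ (XY.adj a b))))
                     (sym (∑-*ˡ (χ (A a) * χ (isolated a)) λ b → χ (B b) * χ (poor b) * χ (XY.adj a b)))) ⟩
              β * ∑ (λ a → χ (A a) * χ (isolated a) * poorDegree a)
                ≡⟨ ∑-*ˡ β (λ a → χ (A a) * χ (isolated a) * poorDegree a) ⟩
              ∑ (λ a → β * (χ (A a) * χ (isolated a) * poorDegree a))
                ≤⟨ ∑-mono (λ a → ≤-trans (≤-reflexive (lemma′ β (χ (A a)) (χ (isolated a)) (poorDegree a)))
                     (*-monoʳ-≤ (χ (A a)) (≤-trans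
                       (χ-≤* (isolated a) (does-sound (β * poorDegree a ≤? ∣B∣)))
                       (χ-*≤ (isolated a) ∣B∣)))) ⟩
              ∑ (λ a → χ (A a) * ∣B∣)
                ≡⟨ ∑-*ʳ ∣B∣ (χ ∘ A) ⟨
              ∣A∣ * ∣B∣ ∎
              where
              lemma : ∀ a b i p d → a * b * (i * p) * d ≡ a * i * (b * p * d)
              lemma = solve-∀
              lemma′ : ∀ β a i d → β * (a * i * d) ≡ a * (i * (β * d))
              lemma′ = solve-∀

          uncovered-many : ∀ b → poor b ≡ true → ∣C∣ ≤ 2 * ∑ λ c → χ (C c) * χ (not (covered L b c))
          uncovered-many b is-poor = +-cancelˡ-≤ (2 * ∑ λ c → χ (C c) * χ (covered L b c)) _ _ (begin
            2 * ∑ (λ c → χ (C c) * χ (covered L b c)) + ∣C∣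
              ≤⟨ +-monoˡ-≤ ∣C∣ (≰⇒≥ (does-complete (∣C∣ ≤? _) (not-true is-poor))) ⟩
            ∣C∣ + ∣C∣
              ≡⟨ lemma ∣C∣ ⟩
            2 * ∣C∣
              ≡⟨ cong (2 *_) (∑-split (χ ∘ C) (covered L b)) ⟨
            2 * (∑ (λ c → χ (C c) * χ (covered L b c)) + ∑ (λ c → χ (C c) * χ (not (covered L b c))))
              ≡⟨ *-distribˡ-+ 2 (∑ λ c → χ (C c) * χ (covered L b c)) _ ⟩
            2 * ∑ (λ c → χ (C c) * χ (covered L b c)) + 2 * ∑ (λ c → χ (C c) * χ (not (covered L b c))) ∎)
            where
            open ≤-Reasoning
            lemma : ∀ c → c + c ≡ 2 * c
            lemma = solve-∀

          -- The subcells hold the pairs `(a , c)` not covered through `partner a`. For each `a`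
          -- they take up at least half of `C`, since the partner is poor, yet at most `∣C∣ / β` of
          -- them are edges, by the choice of the partner.
          connected-splits : ∣A∣ ≤ 2 * ∣connected∣ → Splits x z A C colour-x (λ c → false ∷ col L c)
          connected-splits many = splits (λ u v → not (head u) ∧ not (meet (tail u) (tail v))) big (cancel-density few dense-xz)
            where
            open ≤-Reasoning
            U : Fin n → Fin n → Bool
            U a c = not (covered L (partner a) c)
            big : ∣A∣ * ∣C∣ ≤ 8 * ∑ (λ a → ∑ λ c → χ (A a) * χ (C c) * χ (not (isolated a) ∧ U a c))
            big = begin
              ∣A∣ * ∣C∣
                ≤⟨ *-monoˡ-≤ ∣C∣ many ⟩
              2 * ∣connected∣ * ∣C∣
                ≡⟨ *-assoc 2 ∣connected∣ ∣C∣ ⟩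
              2 * (∣connected∣ * ∣C∣)
                ≡⟨ cong (2 *_) (∑-*ʳ ∣C∣ (λ a → χ (A a) * χ (not (isolated a)))) ⟩
              2 * ∑ (λ a → χ (A a) * χ (not (isolated a)) * ∣C∣)
                ≤⟨ *-monoʳ-≤ 2 (∑-mono λ a → ≤-trans (≤-reflexive (*-assoc (χ (A a)) (χ (not (isolated a))) ∣C∣))
                     (≤-trans (*-monoʳ-≤ (χ (A a)) (χ-≤* (not (isolated a)) λ conn →
                       uncovered-many (partner a) (proj₁ (partner-property a (not-true conn)))))
                       (≤-reflexive (lemma (χ (A a)) (χ (not (isolated a))) (∑ λ c → χ (C c) * χ (U a c)))))) ⟩
              2 * ∑ (λ a → 2 * (χ (A a) * χ (not (isolated a)) * ∑ λ c → χ (C c) * χ (U a c)))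
                ≡⟨ cong (2 *_) (∑-*ˡ 2 (λ a → χ (A a) * χ (not (isolated a)) * ∑ λ c → χ (C c) * χ (U a c))) ⟨
              2 * (2 * ∑ (λ a → χ (A a) * χ (not (isolated a)) * ∑ λ c → χ (C c) * χ (U a c)))
                ≡⟨ *-assoc 2 2 (∑ (λ a → χ (A a) * χ (not (isolated a)) * ∑ λ c → χ (C c) * χ (U a c))) ⟨
              4 * ∑ (λ a → χ (A a) * χ (not (isolated a)) * ∑ λ c → χ (C c) * χ (U a c))
                ≡⟨ cong (4 *_) (∑-cong λ a → trans (∑-*ˡ (χ (A a) * χ (not (isolated a))) λ c → χ (C c) * χ (U a c))
                     (∑-cong λ c → trans (lemma′ (χ (A a)) (χ (not (isolated a))) (χ (C c)) (χ (U a c)))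
                       (cong (χ (A a) * χ (C c) *_) (sym (χ-∧ (not (isolated a)) (U a c)))))) ⟩
              4 * ∑ (λ a → ∑ λ c → χ (A a) * χ (C c) * χ (not (isolated a) ∧ U a c))
                ≤⟨ *-monoˡ-≤ (∑ (λ a → ∑ λ c → χ (A a) * χ (C c) * χ (not (isolated a) ∧ U a c))) (m≤m+n 4 4) ⟩
              8 * ∑ (λ a → ∑ λ c → χ (A a) * χ (C c) * χ (not (isolated a) ∧ U a c)) ∎
              where
              lemma : ∀ a i k → a * (i * (2 * k)) ≡ 2 * (a * i * k)
              lemma = solve-∀
              lemma′ : ∀ a i b p → a * i * (b * p) ≡ a * b * (i * p)
              lemma′ = solve-∀
            few : β * ∑ (λ t → χ (A (x t)) * χ (C (z t)) * χ (not (isolated (x t)) ∧ U (x t) (z t))) ≤ ∣A∣ * ∣C∣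
            few = begin
              β * ∑ (λ t → χ (A (x t)) * χ (C (z t)) * χ (not (isolated (x t)) ∧ U (x t) (z t)))
                ≤⟨ *-monoʳ-≤ β (XZ.Simple.∑-edges xz-simple λ a c → χ (A a) * χ (C c) * χ (not (isolated a) ∧ U a c)) ⟩
              β * ∑ (λ a → ∑ λ c → χ (A a) * χ (C c) * χ (not (isolated a) ∧ U a c) * χ (XZ.adj a c))
                ≡⟨ cong (β *_) (∑-cong λ a → trans (∑-cong λ c → regroup (χ (A a)) (χ (C c)) (not (isolated a)) (U a c) (XZ.adj a c))
                     (sym (∑-*ˡ (χ (A a) * χ (not (isolated a))) λ c → χ (C c) * χ (XZ.adj a c ∧ U a c)))) ⟩
              β * ∑ (λ a → χ (A a) * χ (not (isolated a)) * uncoveredDegree a (partner a))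
                ≡⟨ ∑-*ˡ β (λ a → χ (A a) * χ (not (isolated a)) * uncoveredDegree a (partner a)) ⟩
              ∑ (λ a → β * (χ (A a) * χ (not (isolated a)) * uncoveredDegree a (partner a)))
                ≤⟨ ∑-mono (λ a → ≤-trans (≤-reflexive (lemma′ β (χ (A a)) (χ (not (isolated a))) (uncoveredDegree a (partner a))))
                     (*-monoʳ-≤ (χ (A a)) (≤-trans
                       (χ-≤* (not (isolated a)) λ conn → proj₂ (partner-property a (not-true conn)))
                       (χ-*≤ (not (isolated a)) ∣C∣)))) ⟩
              ∑ (λ a → χ (A a) * ∣C∣)
                ≡⟨ ∑-*ʳ ∣C∣ (χ ∘ A) ⟨
              ∣A∣ * ∣C∣ ∎
              where
              lemma : ∀ a b i u d → a * b * (i * u) * d ≡ a * i * (b * (d * u))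
              lemma = solve-∀
              regroup : ∀ a b i u d → a * b * χ (i ∧ u) * χ d ≡ a * χ i * (b * χ (d ∧ u))
              regroup a b i u d = trans (cong (λ k → a * b * k * χ d) (χ-∧ i u))
                (trans (lemma a b (χ i) (χ u) (χ d)) (cong (λ k → a * χ i * (b * k)) (sym (χ-∧ d u))))
              lemma′ : ∀ β a i d → β * (a * i * d) ≡ a * (i * (β * d))
              lemma′ = solve-∀

          exhausted-splits : Splits x y A B colour-x (λ b → false ∷ row L b) ⊎
                             Splits x z A C colour-x (λ c → false ∷ col L c)
          exhausted-splits with ∣A∣ ≤? 2 * ∣isolated∣
          ... | yes many = inj₁ (isolated-splits many)
          ... | no ¬many = inj₂ (connected-splits
            (majority {∣isolated∣} {∣connected∣} (∑-split (χ ∘ A) isolated) ¬many))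

      abstract
        local-step : Fin n →
                     ∣A∣ * ∣B∣ ≤ 2 ^ h * edgesBetween x y A B →
                     ∣A∣ * ∣C∣ ≤ 2 ^ h * edgesBetween x z A C →
                     32 * (steps * n) ≤ edgesBetween y z B C →
                     ∃ λ (p : Fin n → Colour) → ∃ λ (q : Fin n → Colour) → ∃ λ (r : Fin n → Colour) → Splits x y A B p q ⊎ Splits x z A C p r ⊎ Splits y z B C q r
        local-step a₀ dense-xy dense-xz many-yz with greedy a₀ steps
        ... | L , status with ∣B∣ * ∣C∣ ≤? 8 * cover L
        ...   | yes big = (λ _ → false ∷ row L a₀) , (λ b → false ∷ row L b) , (λ c → false ∷ col L c) ,
                inj₂ (inj₂ (cover-splits L dense-xy dense-xz many-yz big))
        ...   | no ¬big with status
        -- With `k = steps` the greedy bound says that all of `B × C` is covered.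
        ...     | inj₁ large = contradiction
                    (≤-trans (*-cancelˡ-≤ steps {{steps≢0}} large) (m≤n*m (cover L) 8)) ¬big
                    where
                    β≢0 : NonZero β
                    β≢0 = subst NonZero (sym β≡) (m*n≢0 32 (2 ^ h) {{_}} {{m^n≢0 2 h}})
                    steps≢0 : NonZero steps
                    steps≢0 = m*n≢0 β β {{β≢0}} {{β≢0}}
        ...     | inj₂ exhausted = colour-x L dense-xy dense-xz many-yz (≰⇒> ¬big) exhausted ,
                    (λ b → false ∷ row L b) , (λ c → false ∷ col L c) ,
                    [ inj₁ , inj₂ ∘ inj₁ ]′ (exhausted-splits L dense-xy dense-xz many-yz (≰⇒> ¬big) exhausted)

  ==-combine : ∀ {k l} (a i : Fin k) (b j : Fin l) →
               χ (combine a b == combine i j) ≡ χ (a == i) * χ (b == j)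
  ==-combine a i b j = trans (cong χ lemma) (χ-∧ (a == i) (b == j))
    where
    lemma : (combine a b == combine i j) ≡ (a == i) ∧ (b == j)
    lemma with a Fin.≟ i | b Fin.≟ j
    ... | yes refl | yes refl = ==-refl (combine a b)
    ... | yes _    | no b≢j   = ==-false λ eq → b≢j (Fin.combine-injectiveʳ a b i j eq)
    ... | no a≢i   | _        = ==-false λ eq → a≢i (Fin.combine-injectiveˡ a b i j eq)

  χ-¬dec≤ : ∀ {A : Set} (d : Dec A) {k l} → (¬ A → k ≤ l) → χ (not (does d)) * k ≤ l
  χ-¬dec≤ (yes _) _   = z≤n
  χ-¬dec≤ (no ¬a) k≤l = ≤-trans (≤-reflexive (+-identityʳ _)) (k≤l ¬a)

  -- Refinement of colourings

  module Recolouring (k l s : ℕ) where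

    -- A vertex keeps its old colour and stores one bit vector for each of `l` tasks. In a round the
    -- tasks are the `k * k * k` triples of cells, which is why the number of colours grows
    -- exponentially.
    k′ : ℕ
    k′ = k * (2 ^ s) ^ l

    recolour : ∀ {n} → (Fin n → Fin k) → (Fin l → Fin n → Vec Bool s) → Fin n → Fin k′
    recolour p c a = combine (p a) (funToFin λ τ → code (c τ a))

    base : Fin k′ → Fin k
    base i = proj₁ (remQuot {k} ((2 ^ s) ^ l) i)

    base-recolour : ∀ {n} p (c : Fin l → Fin n → Vec Bool s) a → base (recolour p c a) ≡ p a
    base-recolour p c a = cong proj₁ (Fin.remQuot-combine {k} (p a) (funToFin λ τ → code (c τ a)))

    layer : Fin l → Fin k′ → Vec Bool s
    layer τ i = Inverse.from (enum {{Vec-finite}}) (finToFun (proj₂ (remQuot {k} ((2 ^ s) ^ l) i)) τ)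

    layer-recolour : ∀ {n} p (c : Fin l → Fin n → Vec Bool s) τ a → layer τ (recolour p c a) ≡ c τ a
    layer-recolour p c τ a = trans
      (cong (Inverse.from (enum {{Vec-finite}})) (trans
        (cong (λ i → finToFun (proj₂ i) τ) (Fin.remQuot-combine {k} (p a) (funToFin λ τ → code (c τ a))))
        (Fin.finToFun-funToFin (λ τ → code (c τ a)) τ)))
      (Inverse.strictlyInverseʳ (enum {{Vec-finite}}) (c τ a))

  both : ∀ {n k l} → (Fin n → Fin k) → (Fin n → Fin l) → Fin n → Fin n → Fin (k * l)
  both p q a b = combine (p a) (q b)

  cell : ∀ {n k} → (Fin n → Fin k) → Fin k → Fin n → Bool
  cell r i a = r a == i

  module PairStep {n m : ℕ} (u v : Fin m → Fin n) (simple : ∀ s t → u s ≡ u t → v s ≡ v t → s ≡ t)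
                  {k : ℕ} (p q : Fin n → Fin k) where

    open Bipartite u v
    open Simple simple

    edgesBetweenCells : Fin k → Fin k → ℕ
    edgesBetweenCells i j = edgesBetween u v (cell p i) (cell q j)

    Dense : ℕ → Fin k → Fin k → Set
    Dense h i j = ∣ cell p i ∣ₚ * ∣ cell q j ∣ₚ ≤ 2 ^ h * edgesBetweenCells i j

    dense? : ∀ h i j → Dec (Dense h i j)
    dense? h i j = ∣ cell p i ∣ₚ * ∣ cell q j ∣ₚ ≤? 2 ^ h * edgesBetweenCells i j

    edges-cell : ∀ i j → edges (both p q) (combine i j) ≡ edgesBetweenCells i j
    edges-cell i j = ∑-cong λ t → ==-combine (p (u t)) i (q (v t)) j

    pairs-cell : ∀ i j → pairs (both p q) (combine i j) ≡ ∣ cell p i ∣ₚ * ∣ cell q j ∣ₚ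
    pairs-cell i j = trans (∑∑-cong λ a b → ==-combine (p a) i (q b) j)
      (sym (∑-product (χ ∘ cell p i) (χ ∘ cell q j)))

    -- In a sparse pair of cells `2 ^ h` times the edges stay below the area, and the areas of all
    -- pairs of cells add up to `n * n`.
    sparse-edges : ∀ h → 2 ^ h * ∑ (λ t → χ (not (does (dense? h (p (u t)) (q (v t)))))) ≤ n * n
    sparse-edges h = begin
      2 ^ h * ∑ (λ t → χ (not (does (dense? h (p (u t)) (q (v t))))))
        ≡⟨ cong (2 ^ h *_) (∑-cong λ t → cong (χ ∘ sparse′) (Fin.remQuot-combine (p (u t)) (q (v t)))) ⟨
      2 ^ h * ∑ (λ t → χ (sparse (both p q (u t) (v t))))
        ≡⟨ cong (2 ^ h *_) (∑-classes (χ ∘ sparse) (λ t → both p q (u t) (v t))) ⟨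
      2 ^ h * ∑ (λ c → χ (sparse c) * edges (both p q) c)
        ≡⟨ ∑-*ˡ (2 ^ h) (λ c → χ (sparse c) * edges (both p q) c) ⟩
      ∑ (λ c → 2 ^ h * (χ (sparse c) * edges (both p q) c))
        ≤⟨ ∑-mono termwise ⟩
      ∑ (λ c → 1 * pairs (both p q) c)
        ≡⟨ ∑∑-classes (λ _ → 1) (both p q) ⟩
      ∑ {n} (λ a → ∑ {n} λ b → 1)
        ≡⟨ trans (∑-cong {n} λ a → trans (∑-const n 1) (*-identityʳ n)) (∑-const n n) ⟩
      n * n ∎
      where
      open ≤-Reasoning
      sparse′ : Fin k × Fin k → Bool
      sparse′ (i , j) = not (does (dense? h i j))
      sparse : Fin (k * k) → Bool
      sparse c = sparse′ (remQuot {k} k c)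
      lemma : ∀ i j → 2 ^ h * (χ (sparse′ (i , j)) * edges (both p q) (combine i j)) ≤ 1 * pairs (both p q) (combine i j)
      lemma i j = ≤-trans (≤-reflexive (commute (2 ^ h) (χ (sparse′ (i , j))) (edges (both p q) (combine i j))))
        (χ-¬dec≤ (dense? h i j) λ ¬dense → ≤-trans (≤-reflexive (cong (2 ^ h *_) (edges-cell i j)))
          (≤-trans (≰⇒≥ ¬dense) (≤-reflexive (trans (sym (pairs-cell i j)) (sym (+-identityʳ _))))))
        where
        commute : ∀ x y z → x * (y * z) ≡ y * (x * z)
        commute = solve-∀
      termwise : ∀ c → 2 ^ h * (χ (sparse c) * edges (both p q) c) ≤ 1 * pairs (both p q) c
      termwise c = subst (λ c′ → 2 ^ h * (χ (sparse c) * edges (both p q) c′) ≤ 1 * pairs (both p q) c′)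
        (Fin.combine-remQuot {k} k c) (lemma (proj₁ (remQuot {k} k c)) (proj₂ (remQuot {k} k c)))

    module _ {s l : ℕ} (h : ℕ) (c d : Fin l → Fin n → Vec Bool s) where

      open Recolouring k l s

      private
        γ  = both p q
        γ′ = both (recolour p c) (recolour q d)

        π : Fin (k′ * k′) → Fin (k * k)
        π i = let i₁ , i₂ = remQuot {k′} k′ i in combine (base i₁) (base i₂)

        π∘γ′ : ∀ a b → π (γ′ a b) ≡ γ a b
        π∘γ′ a b = trans
          (cong (λ i → combine (base (proj₁ i)) (base (proj₂ i))) (Fin.remQuot-combine (recolour p c a) (recolour q d b)))
          (cong₂ combine (base-recolour p c a) (base-recolour q d b))

      open Refinement h γ γ′ π π∘γ′

      split⇒shattered : ∀ i j τ → Splits u v (cell p i) (cell q j) (c τ) (d τ) → Shattered (combine i j)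
      split⇒shattered i j τ (splits S big few) = U ,
        subst₂ (λ k l → k ≤ 8 * l) (sym (pairs-cell i j))
          (∑∑-cong λ a b → sym (cong₂ _*_ (==-combine (p a) i (q b) j) (cong χ (U-γ′ a b)))) big ,
        subst₂ (λ k l → 32 * k ≤ l)
          (∑-cong λ t → sym (cong₂ _*_ (==-combine (p (u t)) i (q (v t)) j) (cong χ (U-γ′ (u t) (v t)))))
          (sym (edges-cell i j)) few
        where
        U : Fin (k′ * k′) → Bool
        U i = let i₁ , i₂ = remQuot {k′} k′ i in S (layer τ i₁) (layer τ i₂)
        U-γ′ : ∀ a b → U (γ′ a b) ≡ S (c τ a) (d τ b)
        U-γ′ a b = trans
          (cong (λ i → S (layer τ (proj₁ i)) (layer τ (proj₂ i))) (Fin.remQuot-combine (recolour p c a) (recolour q d b)))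
          (cong₂ S (layer-recolour p c τ a) (layer-recolour q d τ b))

      pair-gain : (G : Fin k → Fin k → Bool) →
                  (∀ i j → G i j ≡ true → Dense h i j × ∃ λ τ → Splits u v (cell p i) (cell q j) (c τ) (d τ)) →
                  32 * Ψ h γ + 2 ^ h * ∑ (λ t → χ (G (p (u t)) (q (v t)))) ≤ 32 * Ψ h γ′
      pair-gain G gain = subst (λ e → 32 * Ψ h γ + 2 ^ h * e ≤ 32 * Ψ h γ′)
        (∑-cong λ t → cong (χ ∘ G′) (Fin.remQuot-combine (p (u t)) (q (v t))))
        (Ψ-gain (G′ ∘ remQuot {k} k) λ c g → subst (λ c → pairs γ c ≤ 2 ^ h * edges γ c × Shattered c)
          (Fin.combine-remQuot {k} k c) (gain′ (proj₁ (remQuot {k} k c)) (proj₂ (remQuot {k} k c)) g))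
        where
        G′ : Fin k × Fin k → Bool
        G′ (i , j) = G i j
        gain′ : ∀ i j → G i j ≡ true → pairs γ (combine i j) ≤ 2 ^ h * edges γ (combine i j) × Shattered (combine i j)
        gain′ i j g = let dense , τ , split = gain i j g in
          subst₂ (λ k l → k ≤ 2 ^ h * l) (sym (pairs-cell i j)) (sym (edges-cell i j)) dense ,
          split⇒shattered i j τ split

  -- The global step

  χ-dec≤ : ∀ {A : Set} (d : Dec A) {k} → (A → 1 ≤ k) → χ (does d) ≤ k
  χ-dec≤ (yes a) 1≤k = 1≤k a
  χ-dec≤ (no _)  _   = z≤n

  module _ {A B C D : Set} where

    is-xy is-xz is-yz : ¬ A ⊎ B ⊎ C ⊎ D → Bool
    is-xy (inj₂ (inj₁ _)) = true
    is-xy _               = false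
    is-xz (inj₂ (inj₂ (inj₁ _))) = true
    is-xz _                      = false
    is-yz (inj₂ (inj₂ (inj₂ _))) = true
    is-yz _                      = false

    is-xy-elim : ∀ s → is-xy s ≡ true → B
    is-xy-elim (inj₂ (inj₁ b)) _ = b

    is-xz-elim : ∀ s → is-xz s ≡ true → C
    is-xz-elim (inj₂ (inj₂ (inj₁ c))) _ = c

    is-yz-elim : ∀ s → is-yz s ≡ true → D
    is-yz-elim (inj₂ (inj₂ (inj₂ d))) _ = d

    some-case : ∀ s → A → 1 ≤ χ (is-xy s) + χ (is-xz s) + χ (is-yz s)
    some-case (inj₁ ¬a) a = contradiction a ¬a
    some-case (inj₂ (inj₁ _)) _ = ≤-refl
    some-case (inj₂ (inj₂ (inj₁ _))) _ = ≤-refl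
    some-case (inj₂ (inj₂ (inj₂ _))) _ = ≤-refl

  module GlobalStep {n m : ℕ} (T : TriangleSystem n m) (h β : ℕ) (β≡ : β ≡ 32 * 2 ^ h) (a₀ : Fin n)
                    (dense : 10 * (n * n) ≤ 2 ^ h * m) where
    open TriangleSystem T
    open LocalStep T h β β≡ using (steps; Colour; local-step)

    module XY = Bipartite x y
    module XZ = Bipartite x z
    module YZ = Bipartite y z

    module _ {k : ℕ} (p q r : Fin n → Fin k) where

      potential : ℕ
      potential = XY.Ψ h (both p q) + XZ.Ψ h (both p r) + YZ.Ψ h (both q r)

      potential-bound : potential ≤ 3 * (suc h * (2 ^ h * m))
      potential-bound = ≤-trans
        (+-mono-≤ (+-mono-≤ (XY.Ψ-bound h (both p q)) (XZ.Ψ-bound h (both p r))) (YZ.Ψ-bound h (both q r)))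
        (≤-reflexive (lemma (suc h * (2 ^ h * m))))
        where
        lemma : ∀ x → x + x + x ≡ 3 * x
        lemma = solve-∀

    module Step {k : ℕ} (p q r : Fin n → Fin k)
                (n-large : 32 * (steps * (k * k * (2 ^ h * 2 ^ h * 2 ^ h))) ≤ n) where

      module CXY = PairStep x y xy-simple p q
      module CXZ = PairStep x z xz-simple p r
      module CYZ = PairStep y z yz-simple q r

      instance
        k≢0 : NonZero k
        k≢0 = Fin.nonZeroIndex (p a₀)

      Large : (Fin n → Fin k) → Fin k → Set
      Large c i = n ≤ ∣ cell c i ∣ₚ * (k * 2 ^ h)

      large? : ∀ c i → Dec (Large c i)
      large? c i = n ≤? ∣ cell c i ∣ₚ * (k * 2 ^ h)

      Good : Fin k → Fin k → Fin k → Set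
      Good i j l = CXY.Dense h i j × CXZ.Dense h i l × CYZ.Dense h j l × Large q j × Large r l

      good? : ∀ i j l → Dec (Good i j l)
      good? i j l = CXY.dense? h i j ×-dec CXZ.dense? h i l ×-dec CYZ.dense? h j l ×-dec large? q j ×-dec large? r l

      -- The product of two large cells is at least `n * n / (k * 2 ^ h) ^ 2`, and density costs
      -- another `2 ^ h`. The bound `n-large` is chosen so that `32 * (steps * n)` edges remain,
      -- enough for the covered ones to be negligible.
      good⇒many : ∀ {i j l} → Good i j l → 32 * (steps * n) ≤ edgesBetween y z (cell q j) (cell r l)
      good⇒many {i} {j} {l} (_ , _ , dense-yz , large-j , large-l) =
        *-cancelˡ-≤ D {{m*n≢0 (k * k) _ {{m*n≢0 k k}} {{m*n≢0 _ _ {{m*n≢0 _ _ {{m^n≢0 2 h}} {{m^n≢0 2 h}}}} {{m^n≢0 2 h}}}}}} (begin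
          D * (32 * (steps * n))
            ≡⟨ lemma₁ D steps n ⟩
          32 * (steps * D) * n
            ≤⟨ *-monoˡ-≤ n n-large ⟩
          n * n
            ≤⟨ *-mono-≤ large-j large-l ⟩
          ∣ cell q j ∣ₚ * (k * M) * (∣ cell r l ∣ₚ * (k * M))
            ≡⟨ lemma₂ (∣ cell q j ∣ₚ) (∣ cell r l ∣ₚ) k M ⟩
          k * k * (M * M) * (∣ cell q j ∣ₚ * ∣ cell r l ∣ₚ)
            ≤⟨ *-monoʳ-≤ (k * k * (M * M)) dense-yz ⟩
          k * k * (M * M) * (M * edgesBetween y z (cell q j) (cell r l))
            ≡⟨ lemma₃ k M (edgesBetween y z (cell q j) (cell r l)) ⟩
          D * edgesBetween y z (cell q j) (cell r l) ∎)
        where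
        open ≤-Reasoning
        M = 2 ^ h
        D = k * k * (M * M * M)
        lemma₁ : ∀ d s n → d * (32 * (s * n)) ≡ 32 * (s * d) * n
        lemma₁ = solve-∀
        lemma₂ : ∀ b c k m → b * (k * m) * (c * (k * m)) ≡ k * k * (m * m) * (b * c)
        lemma₂ = solve-∀
        lemma₃ : ∀ k m e → k * k * (m * m) * (m * e) ≡ k * k * (m * m * m) * e
        lemma₃ = solve-∀

      Triple = Fin k × Fin k × Fin k

      -- A split is stored with the density of its pair of cells, because `Φ-gain` uses both; the
      -- density of the whole triple is no longer visible once the pair is looked at alone.
      Status : Triple → (c d e : Fin n → Colour) → Set
      Status (i , j , l) c d e = ¬ Good i j l
        ⊎ (CXY.Dense h i j × Splits x y (cell p i) (cell q j) c d)
        ⊎ (CXZ.Dense h i l × Splits x z (cell p i) (cell r l) c e)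
        ⊎ (CYZ.Dense h j l × Splits y z (cell q j) (cell r l) d e)

      outcome : ∀ τ → ∃ λ c → ∃ λ d → ∃ λ e → Status τ c d e
      outcome (i , j , l) = decide (good? i j l)
        where
        decide : Dec (Good i j l) → ∃ λ c → ∃ λ d → ∃ λ e → Status (i , j , l) c d e
        -- Constant colours: a triple that is not good contributes nothing to the refinement.
        decide (no ¬good) = (λ _ → replicate _ false) , (λ _ → replicate _ false) , (λ _ → replicate _ false) , inj₁ ¬good
        decide (yes good@(dense-xy , dense-xz , dense-yz , _)) =
          package (local-step (cell p i) (cell q j) (cell r l) a₀ dense-xy dense-xz (good⇒many good))
          where
          package : (∃ λ (c : Fin n → Colour) → ∃ λ (d : Fin n → Colour) → ∃ λ (e : Fin n → Colour) → Splits x y (cell p i) (cell q j) c d ⊎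
                      Splits x z (cell p i) (cell r l) c e ⊎ Splits y z (cell q j) (cell r l) d e) →
                    ∃ λ c → ∃ λ d → ∃ λ e → Status (i , j , l) c d e
          package (c , d , e , cases) = c , d , e ,
            inj₂ (Sum.map (dense-xy ,_) (Sum.map (dense-xz ,_) (dense-yz ,_)) cases)

      decode : Fin (k * k * k) → Triple
      decode τ = let ij , l = remQuot {k * k} k τ ; i , j = remQuot {k} k ij in i , j , l

      encode : Triple → Fin (k * k * k)
      encode (i , j , l) = combine (combine i j) l

      decode-encode : ∀ t → decode (encode t) ≡ t
      decode-encode (i , j , l) = trans
        (cong (λ ijl → let i , j = remQuot {k} k (proj₁ ijl) in i , j , proj₂ ijl) (Fin.remQuot-combine (combine i j) l))
        (cong (λ ij → proj₁ ij , proj₂ ij , l) (Fin.remQuot-combine i j))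

      colour-x colour-y colour-z : Fin (k * k * k) → Fin n → Colour
      colour-x τ = proj₁ (outcome (decode τ))
      colour-y τ = proj₁ (proj₂ (outcome (decode τ)))
      colour-z τ = proj₁ (proj₂ (proj₂ (outcome (decode τ))))

      status : ∀ τ → Status (decode τ) (colour-x τ) (colour-y τ) (colour-z τ)
      status τ = proj₂ (proj₂ (proj₂ (outcome (decode τ))))

      open Recolouring k (k * k * k) (suc steps)

      p′ q′ r′ : Fin n → Fin k′
      p′ = recolour p colour-x
      q′ = recolour q colour-y
      r′ = recolour r colour-z

      private
        splits-xy splits-xz splits-yz : Fin k → Fin k → Fin (k * k * k) → Bool
        splits-xy i j τ = let i′ , j′ , l′ = decode τ in ((i′ == i) ∧ (j′ == j)) ∧ is-xy (status τ)
        splits-xz i l τ = let i′ , j′ , l′ = decode τ in ((i′ == i) ∧ (l′ == l)) ∧ is-xz (status τ)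
        splits-yz j l τ = let i′ , j′ , l′ = decode τ in ((j′ == j) ∧ (l′ == l)) ∧ is-yz (status τ)

        G-xy G-xz G-yz : Fin k → Fin k → Bool
        G-xy i j = exists (splits-xy i j)
        G-xz i l = exists (splits-xz i l)
        G-yz j l = exists (splits-yz j l)

        gain-xy : ∀ i j → G-xy i j ≡ true → CXY.Dense h i j ×
                  ∃ λ τ → Splits x y (cell p i) (cell q j) (colour-x τ) (colour-y τ)
        gain-xy i j g =
          let τ , e = exists-elim {p = splits-xy i j} g
              i′ , j′ , l′ = decode τ
              dense-xy , split = is-xy-elim (status τ) (∧-trueʳ {(i′ == i) ∧ (j′ == j)} e)
          in subst₂ (λ i j → CXY.Dense h i j × ∃ λ τ → Splits x y (cell p i) (cell q j) (colour-x τ) (colour-y τ))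
               (==-sound (∧-trueˡ (∧-trueˡ e))) (==-sound (∧-trueʳ {i′ == i} (∧-trueˡ e))) (dense-xy , τ , split)

        gain-xz : ∀ i l → G-xz i l ≡ true → CXZ.Dense h i l ×
                  ∃ λ τ → Splits x z (cell p i) (cell r l) (colour-x τ) (colour-z τ)
        gain-xz i l g =
          let τ , e = exists-elim {p = splits-xz i l} g
              i′ , j′ , l′ = decode τ
              dense-xz , split = is-xz-elim (status τ) (∧-trueʳ {(i′ == i) ∧ (l′ == l)} e)
          in subst₂ (λ i l → CXZ.Dense h i l × ∃ λ τ → Splits x z (cell p i) (cell r l) (colour-x τ) (colour-z τ))
               (==-sound (∧-trueˡ (∧-trueˡ e))) (==-sound (∧-trueʳ {i′ == i} (∧-trueˡ e))) (dense-xz , τ , split)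

        gain-yz : ∀ j l → G-yz j l ≡ true → CYZ.Dense h j l ×
                  ∃ λ τ → Splits y z (cell q j) (cell r l) (colour-y τ) (colour-z τ)
        gain-yz j l g =
          let τ , e = exists-elim {p = splits-yz j l} g
              i′ , j′ , l′ = decode τ
              dense-yz , split = is-yz-elim (status τ) (∧-trueʳ {(j′ == j) ∧ (l′ == l)} e)
          in subst₂ (λ j l → CYZ.Dense h j l × ∃ λ τ → Splits y z (cell q j) (cell r l) (colour-y τ) (colour-z τ))
               (==-sound (∧-trueˡ (∧-trueˡ e))) (==-sound (∧-trueʳ {j′ == j} (∧-trueˡ e))) (dense-yz , τ , split)

        gains : Triple → ℕ
        gains (i , j , l) = χ (G-xy i j) + χ (G-xz i l) + χ (G-yz j l)

        IsGood : Triple → Set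
        IsGood (i , j , l) = Good i j l

        -- Several triples may split the same pair of cells, which gains only once. So the gain is
        -- counted by marked pairs instead of triples, and it is enough that a good triple marks at
        -- least one of its three pairs.
        covered-good′ : ∀ τ → IsGood (decode τ) → 1 ≤ gains (decode τ)
        covered-good′ τ good = ≤-trans (some-case (status τ) good) (+-mono-≤ (+-mono-≤
          (χ-mono λ e → exists-intro {p = splits-xy i j} τ (∧-true (∧-true (==-refl i) (==-refl j)) e))
          (χ-mono λ e → exists-intro {p = splits-xz i l} τ (∧-true (∧-true (==-refl i) (==-refl l)) e)))
          (χ-mono λ e → exists-intro {p = splits-yz j l} τ (∧-true (∧-true (==-refl j) (==-refl l)) e)))
          where
          i = proj₁ (decode τ)
          j = proj₁ (proj₂ (decode τ))
          l = proj₂ (proj₂ (decode τ))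

        covered-good : ∀ t → IsGood t → 1 ≤ gains t
        covered-good t good = subst (λ t → 1 ≤ gains t) (decode-encode t)
          (covered-good′ (encode t) (subst IsGood (sym (decode-encode t)) good))

        -- The `k` cells that are not large have at most `n / (k * 2 ^ h)` vertices each, so at most
        -- `n / 2 ^ h` together, and every vertex lies in at most `n` triangles.
        small-parts : ∀ (v : Fin m → Fin n) (c : Fin n → Fin k) → (∀ b → ∑ (λ t → χ (v t == b)) ≤ n) →
                      2 ^ h * ∑ (λ t → χ (not (does (large? c (c (v t)))))) ≤ n * n
        small-parts v c deg = *-cancelˡ-≤ k (begin
          k * (2 ^ h * ∑ (λ t → w (v t)))
            ≡⟨ cong (λ e → k * (2 ^ h * e)) (∑-classes w v) ⟨
          k * (2 ^ h * ∑ (λ b → w b * ∑ (λ t → χ (v t == b))))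
            ≤⟨ *-monoʳ-≤ k (*-monoʳ-≤ (2 ^ h) (∑-mono λ b → *-monoʳ-≤ (w b) (deg b))) ⟩
          k * (2 ^ h * ∑ (λ b → w b * n))
            ≡⟨ cong (λ e → k * (2 ^ h * e)) (∑-*ʳ n w) ⟨
          k * (2 ^ h * (∑ w * n))
            ≡⟨ lemma k (2 ^ h) (∑ w) n ⟩
          k * 2 ^ h * ∑ w * n
            ≤⟨ *-monoˡ-≤ n ∑w ⟩
          k * n * n
            ≡⟨ *-assoc k n n ⟩
          k * (n * n) ∎)
          where
          open ≤-Reasoning
          w′ : Fin k → ℕ
          w′ i = χ (not (does (large? c i)))
          w : Fin n → ℕ
          w b = w′ (c b)
          lemma : ∀ k h w n → k * (h * (w * n)) ≡ k * h * w * n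
          lemma = solve-∀
          commute : ∀ x y z → x * (y * z) ≡ y * (z * x)
          commute = solve-∀
          ∑w : k * 2 ^ h * ∑ w ≤ k * n
          ∑w = begin
            k * 2 ^ h * ∑ w
              ≡⟨ cong (k * 2 ^ h *_) (∑-classes w′ c) ⟨
            k * 2 ^ h * ∑ (λ i → w′ i * ∣ cell c i ∣ₚ)
              ≡⟨ ∑-*ˡ (k * 2 ^ h) (λ i → w′ i * ∣ cell c i ∣ₚ) ⟩
            ∑ (λ i → k * 2 ^ h * (w′ i * ∣ cell c i ∣ₚ))
              ≤⟨ ∑-bound (λ i → ≤-trans (≤-reflexive (commute (k * 2 ^ h) (w′ i) ∣ cell c i ∣ₚ))
                   (χ-¬dec≤ (large? c i) ≰⇒≥)) ⟩
            k * n ∎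

        good-triangle : Fin m → Bool
        good-triangle t = does (good? (p (x t)) (q (y t)) (r (z t)))

        -- A triangle is bad for one of five reasons, three sparse pairs and two small cells, at a
        -- cost of `n * n / 2 ^ h` each. The 10 in `dense` is twice this 5, so that half of the
        -- triangles stay good.
        bad : 2 ^ h * ∑ (λ t → χ (not (good-triangle t))) ≤ 5 * (n * n)
        bad = begin
          2 ^ h * ∑ (λ t → χ (not (good-triangle t)))
            ≤⟨ *-monoʳ-≤ (2 ^ h) (∑-mono λ t → union (does (CXY.dense? h (p (x t)) (q (y t)))) (does (CXZ.dense? h (p (x t)) (r (z t))))
                 (does (CYZ.dense? h (q (y t)) (r (z t)))) (does (large? q (q (y t)))) (does (large? r (r (z t))))) ⟩
          2 ^ h * ∑ (λ t → b₁ t + (b₂ t + (b₃ t + (b₄ t + b₅ t))))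
            ≡⟨ cong (2 ^ h *_) (trans (∑-+ b₁ (λ t → b₂ t + (b₃ t + (b₄ t + b₅ t))))
                 (cong (∑ b₁ +_) (trans (∑-+ b₂ (λ t → b₃ t + (b₄ t + b₅ t)))
                 (cong (∑ b₂ +_) (trans (∑-+ b₃ (λ t → b₄ t + b₅ t))
                 (cong (∑ b₃ +_) (∑-+ b₄ b₅))))))) ⟩
          2 ^ h * (∑ b₁ + (∑ b₂ + (∑ b₃ + (∑ b₄ + ∑ b₅))))
            ≡⟨ distribute (2 ^ h) (∑ b₁) (∑ b₂) (∑ b₃) (∑ b₄) (∑ b₅) ⟩
          2 ^ h * ∑ b₁ + (2 ^ h * ∑ b₂ + (2 ^ h * ∑ b₃ + (2 ^ h * ∑ b₄ + 2 ^ h * ∑ b₅)))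
            ≤⟨ +-mono-≤ (CXY.sparse-edges h) (+-mono-≤ (CXZ.sparse-edges h) (+-mono-≤ (CYZ.sparse-edges h)
                 (+-mono-≤ (small-parts y q deg-y) (small-parts z r deg-z)))) ⟩
          n * n + (n * n + (n * n + (n * n + n * n)))
            ≡⟨ five (n * n) ⟩
          5 * (n * n) ∎
          where
          open ≤-Reasoning
          b₁ b₂ b₃ b₄ b₅ : Fin m → ℕ
          b₁ t = χ (not (does (CXY.dense? h (p (x t)) (q (y t)))))
          b₂ t = χ (not (does (CXZ.dense? h (p (x t)) (r (z t)))))
          b₃ t = χ (not (does (CYZ.dense? h (q (y t)) (r (z t)))))
          b₄ t = χ (not (does (large? q (q (y t)))))
          b₅ t = χ (not (does (large? r (r (z t)))))
          union : ∀ a b c d e → χ (not (a ∧ (b ∧ (c ∧ (d ∧ e))))) ≤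
                  χ (not a) + (χ (not b) + (χ (not c) + (χ (not d) + χ (not e))))
          union false _     _     _     _ = s≤s z≤n
          union true  false _     _     _ = s≤s z≤n
          union true  true  false _     _ = s≤s z≤n
          union true  true  true  false _ = s≤s z≤n
          union true  true  true  true  e = ≤-refl
          distribute : ∀ h a b c d e → h * (a + (b + (c + (d + e)))) ≡ h * a + (h * b + (h * c + (h * d + h * e)))
          distribute = solve-∀
          five : ∀ x → x + (x + (x + (x + x))) ≡ 5 * x
          five = solve-∀
          deg-y : ∀ b → ∑ (λ t → χ (y t == b)) ≤ n
          deg-y b = ∑-injective (λ t → y t == b) x λ s t ps pt eq →
            xy-simple s t eq (trans (==-sound ps) (sym (==-sound pt)))
          deg-z : ∀ b → ∑ (λ t → χ (z t == b)) ≤ n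
          deg-z b = ∑-injective (λ t → z t == b) x λ s t ps pt eq →
            xz-simple s t eq (trans (==-sound ps) (sym (==-sound pt)))

        good-many : m ≤ 2 * ∑ (λ t → χ (good-triangle t))
        good-many = +-cancelʳ-≤ m _ _ (begin
          m + m  ≡⟨ cong (m +_) (+-identityʳ m) ⟨
          2 * m  ≡⟨ cong (2 *_) (sym total) ⟩
          2 * (∑ (λ t → χ (good-triangle t)) + ∑ (λ t → χ (not (good-triangle t))))
                                                   ≡⟨ *-distribˡ-+ 2 (∑ (λ t → χ (good-triangle t))) _ ⟩
          2 * ∑ (λ t → χ (good-triangle t)) + 2 * ∑ (λ t → χ (not (good-triangle t)))
                                                   ≤⟨ +-monoʳ-≤ (2 * ∑ (λ t → χ (good-triangle t))) bad′ ⟩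
          2 * ∑ (λ t → χ (good-triangle t)) + m  ∎)
          where
          open ≤-Reasoning
          total : ∑ (λ t → χ (good-triangle t)) + ∑ (λ t → χ (not (good-triangle t))) ≡ m
          total = trans (sym (∑-+ (λ t → χ (good-triangle t)) (λ t → χ (not (good-triangle t)))))
            (trans (∑-cong λ t → χ-not (good-triangle t)) (trans (∑-const m 1) (*-identityʳ m)))
          bad′ : 2 * ∑ (λ t → χ (not (good-triangle t))) ≤ m
          bad′ = *-cancelˡ-≤ (2 ^ h) {{m^n≢0 2 h}} (begin
            2 ^ h * (2 * ∑ (λ t → χ (not (good-triangle t))))
              ≡⟨ lemma (2 ^ h) (∑ (λ t → χ (not (good-triangle t)))) ⟩
            2 * (2 ^ h * ∑ (λ t → χ (not (good-triangle t))))
              ≤⟨ *-monoʳ-≤ 2 bad ⟩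
            2 * (5 * (n * n))
              ≡⟨ *-assoc 2 5 (n * n) ⟨
            10 * (n * n)
              ≤⟨ dense ⟩
            2 ^ h * m ∎)
            where
            lemma : ∀ x y → x * (2 * y) ≡ 2 * (x * y)
            lemma = solve-∀

      -- The 64 is the 32 of `Φ-gain` times the 2 lost by keeping only good triangles.
      step-gain : 64 * potential p q r + 2 ^ h * m ≤ 64 * potential p′ q′ r′
      step-gain = begin
        64 * potential p q r + 2 ^ h * m
          ≤⟨ +-monoʳ-≤ (64 * potential p q r) (*-monoʳ-≤ (2 ^ h) (≤-trans good-many (*-monoʳ-≤ 2 good≤gains))) ⟩
        64 * potential p q r + 2 ^ h * (2 * (g₁ + g₂ + g₃))
          ≡⟨ lemma (XY.Ψ h (both p q)) (XZ.Ψ h (both p r)) (YZ.Ψ h (both q r)) (2 ^ h) g₁ g₂ g₃ ⟩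
        2 * ((32 * XY.Ψ h (both p q) + 2 ^ h * g₁) + (32 * XZ.Ψ h (both p r) + 2 ^ h * g₂) + (32 * YZ.Ψ h (both q r) + 2 ^ h * g₃))
          ≤⟨ *-monoʳ-≤ 2 (+-mono-≤ (+-mono-≤
               (CXY.pair-gain h colour-x colour-y G-xy gain-xy)
               (CXZ.pair-gain h colour-x colour-z G-xz gain-xz))
               (CYZ.pair-gain h colour-y colour-z G-yz gain-yz)) ⟩
        2 * (32 * XY.Ψ h (both p′ q′) + 32 * XZ.Ψ h (both p′ r′) + 32 * YZ.Ψ h (both q′ r′))
          ≡⟨ lemma′ (XY.Ψ h (both p′ q′)) (XZ.Ψ h (both p′ r′)) (YZ.Ψ h (both q′ r′)) ⟩
        64 * potential p′ q′ r′ ∎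
        where
        open ≤-Reasoning
        f₁ f₂ f₃ : Fin m → ℕ
        f₁ t = χ (G-xy (p (x t)) (q (y t)))
        f₂ t = χ (G-xz (p (x t)) (r (z t)))
        f₃ t = χ (G-yz (q (y t)) (r (z t)))
        g₁ = ∑ f₁
        g₂ = ∑ f₂
        g₃ = ∑ f₃
        good≤gains : ∑ (λ t → χ (good-triangle t)) ≤ g₁ + g₂ + g₃
        good≤gains = ≤-trans (∑-mono λ t → pointwise t)
          (≤-reflexive (trans (∑-+ (λ t → f₁ t + f₂ t) f₃) (cong (_+ g₃) (∑-+ f₁ f₂))))
          where
          pointwise : ∀ t → χ (good-triangle t) ≤ f₁ t + f₂ t + f₃ t
          pointwise t = χ-dec≤ (good? (p (x t)) (q (y t)) (r (z t))) (covered-good (p (x t) , q (y t) , r (z t)))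
        lemma : ∀ a b c h x y z → 64 * (a + b + c) + h * (2 * (x + y + z)) ≡
                2 * ((32 * a + h * x) + (32 * b + h * y) + (32 * c + h * z))
        lemma = solve-∀
        lemma′ : ∀ a b c → 2 * (32 * a + 32 * b + 32 * c) ≡ 64 * (a + b + c)
        lemma′ = solve-∀

  -- Towers and the iterated logarithm

  tower : ℕ → ℕ
  tower zero    = 1
  tower (suc i) = 2 ^ tower i

  n<2^n : ∀ n → n < 2 ^ n
  n<2^n zero    = s≤s z≤n
  n<2^n (suc n) = ≤-trans (+-mono-≤ (m^n>0 2 n) (n<2^n n)) (≤-reflexive (cong (2 ^ n +_) (sym (+-identityʳ (2 ^ n)))))

  2n≤2^n : ∀ n → 1 ≤ n → n + n ≤ 2 ^ n
  2n≤2^n (suc n) _ = ≤-trans (+-mono-≤ (n<2^n n) (n<2^n n)) (≤-reflexive (cong (2 ^ n +_) (sym (+-identityʳ (2 ^ n)))))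

  n<tower : ∀ n → n < tower n
  n<tower zero    = s≤s z≤n
  n<tower (suc n) = ≤-<-trans (n<tower n) (n<2^n (tower n))

  1≤tower : ∀ n → 1 ≤ tower n
  1≤tower n = ≤-trans (s≤s z≤n) (n<tower n)

  tower-suc : ∀ n → tower n ≤ tower (suc n)
  tower-suc n = <⇒≤ (n<2^n (tower n))

  tower-mono : ∀ i j → i ≤ j → tower i ≤ tower j
  tower-mono zero    j       _         = 1≤tower j
  tower-mono (suc i) (suc j) (s≤s i≤j) = ^-monoʳ-≤ 2 (tower-mono i j i≤j)

  raise : ∀ d j {x} → x ≤ tower j → x ≤ tower (d + j)
  raise d j x≤ = ≤-trans x≤ (tower-mono j (d + j) (m≤n+m j d))

  +-tower : ∀ {x y} i → x ≤ tower i → y ≤ tower i → x + y ≤ tower (1 + i)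
  +-tower i x≤ y≤ = ≤-trans (+-mono-≤ x≤ y≤) (2n≤2^n (tower i) (1≤tower i))

  *-tower : ∀ {x y} i → x ≤ tower i → y ≤ tower i → x * y ≤ tower (2 + i)
  *-tower {x} {y} i x≤ y≤ = begin
    x * y  ≤⟨ *-mono-≤ (≤-trans x≤ (tower-suc i)) (≤-trans y≤ (tower-suc i)) ⟩
    2 ^ tower i * 2 ^ tower i  ≡⟨ ^-distribˡ-+-* 2 (tower i) (tower i) ⟨
    2 ^ (tower i + tower i)  ≤⟨ ^-monoʳ-≤ 2 (2n≤2^n (tower i) (1≤tower i)) ⟩
    tower (2 + i)  ∎
    where open ≤-Reasoning

  n≤2^⌈log₂n⌉ : ∀ n → n ≤ 2 ^ ⌈log₂ n ⌉
  n≤2^⌈log₂n⌉ = <-rec _ step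
    where
    step : ∀ n → (∀ {k} → k < n → k ≤ 2 ^ ⌈log₂ k ⌉) → n ≤ 2 ^ ⌈log₂ n ⌉
    step zero    _ = z≤n
    step (suc zero) _ = m^n>0 2 ⌈log₂ 1 ⌉
    step n@(suc (suc n′)) rec = begin
      n  ≡⟨ ⌊n/2⌋+⌈n/2⌉≡n n ⟨
      ⌊ n /2⌋ + ⌈ n /2⌉  ≤⟨ +-monoˡ-≤ ⌈ n /2⌉ (⌊n/2⌋≤⌈n/2⌉ n) ⟩
      ⌈ n /2⌉ + ⌈ n /2⌉  ≤⟨ +-mono-≤ half half ⟩
      2 ^ (⌈log₂ n ⌉ ∸ 1) + 2 ^ (⌈log₂ n ⌉ ∸ 1) ≡⟨ cong (2 ^ (⌈log₂ n ⌉ ∸ 1) +_) (+-identityʳ _) ⟨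
      2 ^ suc (⌈log₂ n ⌉ ∸ 1)  ≡⟨ cong (2 ^_) (m+[n∸m]≡n log≥1) ⟩
      2 ^ ⌈log₂ n ⌉  ∎
      where
      open ≤-Reasoning
      half : ⌈ n /2⌉ ≤ 2 ^ (⌈log₂ n ⌉ ∸ 1)
      half = subst (λ e → ⌈ n /2⌉ ≤ 2 ^ e) (⌈log₂⌈n/2⌉⌉≡⌈log₂n⌉∸1 n) (rec (⌈n/2⌉<n n′))
      log≥1 : 1 ≤ ⌈log₂ n ⌉
      log≥1 = ≤-trans (≤-reflexive (sym (⌈log₂2^n⌉≡n 1))) (⌈log₂⌉-mono-≤ {2} {n} (s≤s (s≤s z≤n)))

  n≤tower-log* : ∀ n → n ≤ tower (log* n)
  n≤tower-log* = <-rec _ step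
    where
    step : ∀ n → (∀ {k} → k < n → k ≤ tower (log* k)) → n ≤ tower (log* n)
    step zero       _ = z≤n
    step (suc zero) _ = ≤-refl
    step (suc (suc n)) rec = subst (λ l → suc (suc n) ≤ tower l) (sym (log*-step n))
      (≤-trans (n≤2^⌈log₂n⌉ (suc (suc n))) (^-monoʳ-≤ 2 (rec (⌈log₂n⌉<n n))))

  n≤tower⇒log*≤ : ∀ h {n} → n ≤ tower h → log* n ≤ h
  n≤tower⇒log*≤ h       {zero}  _ = z≤n
  n≤tower⇒log*≤ h       {suc zero} _ = z≤n
  n≤tower⇒log*≤ zero    {suc (suc n)} (s≤s ())
  n≤tower⇒log*≤ (suc h) {suc (suc n)} n≤ = subst (_≤ suc h) (sym (log*-step n))
    (s≤s (n≤tower⇒log*≤ h (≤-trans (⌈log₂⌉-mono-≤ n≤) (≤-reflexive (⌈log₂2^n⌉≡n (tower h))))))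

  tower<⇒<log* : ∀ h {n} → tower h < n → h < log* n
  tower<⇒<log* h {n} h<n = ≰⇒> λ log*≤h → <⇒≱ h<n (≤-trans (n≤tower-log* n) (tower-mono (log* n) h log*≤h))

  <log*⇒tower< : ∀ h {n} → h < log* n → tower h < n
  <log*⇒tower< h h<log* = ≰⇒> λ n≤ → <⇒≱ h<log* (n≤tower⇒log*≤ h n≤)

  -- The number of colours and of rounds.

  module ColourCount (s : ℕ) where

    colours : ℕ → ℕ
    colours zero    = 1
    colours (suc i) = Recolouring.k′ (colours i) (colours i * colours i * colours i) s

    colours-suc : ∀ i → colours i ≤ colours (suc i)
    colours-suc i = m≤m*n (colours i) ((2 ^ s) ^ (colours i * colours i * colours i))
      {{m^n≢0 (2 ^ s) (colours i * colours i * colours i) {{m^n≢0 2 s}}}}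

    -- A round costs eight levels: four for the cube of `k`, two for the factor `s`, one for adding
    -- `k`, which absorbs the outer factor `k ≤ 2 ^ k`, and one for the exponential.
    colours-tower : ∀ {a} → s ≤ tower a → ∀ i → colours i ≤ tower (i * 8 + a)
    colours-tower {a} s≤ zero    = 1≤tower a
    colours-tower {a} s≤ (suc i) = begin
      k * (2 ^ s) ^ (k * k * k)  ≡⟨ cong (k *_) (^-*-assoc 2 s (k * k * k)) ⟩
      k * 2 ^ (s * (k * k * k))  ≤⟨ *-monoˡ-≤ (2 ^ (s * (k * k * k))) (<⇒≤ (n<2^n k)) ⟩
      2 ^ k * 2 ^ (s * (k * k * k)) ≡⟨ ^-distribˡ-+-* 2 k (s * (k * k * k)) ⟨
      2 ^ (k + s * (k * k * k))  ≤⟨ ^-monoʳ-≤ 2 (+-tower (6 + b) (raise 6 b k≤) sk³) ⟩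
      tower (8 + b)  ∎
      where
      open ≤-Reasoning
      k = colours i
      b = i * 8 + a
      k≤ : k ≤ tower b
      k≤ = colours-tower s≤ i
      s≤b : s ≤ tower b
      s≤b = raise (i * 8) a s≤
      sk³ : s * (k * k * k) ≤ tower (6 + b)
      sk³ = *-tower (4 + b) (raise 4 b s≤b) (*-tower (2 + b) (*-tower b k≤ k≤) (raise 2 b k≤))

  module Threshold (h : ℕ) where

    β steps rounds : ℕ
    β      = 32 * 2 ^ h
    steps  = β * β
    -- The potential is at most `3 * suc h * (2 ^ h * m)` and grows by a 64th of `2 ^ h * m` per
    -- round, so `64 * 3 * suc h` rounds can exhaust it and one more is impossible.
    rounds = suc (192 * suc h)

    open ColourCount (suc steps) public

    demand : ℕ → ℕ
    demand k = 32 * (steps * (k * k * (2 ^ h * 2 ^ h * 2 ^ h)))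

    demand-mono : ∀ {k l} → k ≤ l → demand k ≤ demand l
    demand-mono k≤l = *-monoʳ-≤ 32 (*-monoʳ-≤ steps (*-monoˡ-≤ (2 ^ h * 2 ^ h * 2 ^ h) (*-mono-≤ k≤l k≤l)))

    module _ {n m : ℕ} (T : TriangleSystem n m) (a₀ : Fin n) (dense : 10 * (n * n) ≤ 2 ^ h * m) where

      open GlobalStep T h β refl a₀ dense

      iterate : ∀ i → demand (colours i) ≤ n →
                ∃ λ p → ∃ λ q → ∃ λ r → i * (2 ^ h * m) ≤ 64 * potential {colours i} p q r
      iterate zero    _     = (λ _ → zero) , (λ _ → zero) , (λ _ → zero) , z≤n
      iterate (suc i) large =
        let large′ = ≤-trans (demand-mono (colours-suc i)) large
            p , q , r , bound = iterate i large′
            open Step p q r large′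
        in p′ , q′ , r′ , ≤-trans (≤-reflexive (+-comm (2 ^ h * m) _))
             (≤-trans (+-monoˡ-≤ (2 ^ h * m) bound) step-gain)

      contradictory : 1 ≤ m → ¬ demand (colours rounds) ≤ n
      contradictory 1≤m large =
        let p , q , r , bound = iterate rounds large
        in <⇒≱ (*-monoˡ-< (2 ^ h * m) {{>-nonZero (*-mono-≤ (m^n>0 2 h) 1≤m)}} (n<1+n (192 * suc h)))
          (≤-trans bound (≤-trans (*-monoʳ-≤ 64 (potential-bound p q r))
            (≤-reflexive (lemma (suc h) (2 ^ h * m)))))
        where
        lemma : ∀ x y → 64 * (3 * (x * y)) ≡ 192 * x * y
        lemma = solve-∀

    few-triangles : ∀ {n m} → TriangleSystem n m → demand (colours rounds) ≤ n → 1 ≤ n → 2 ^ h * m < 10 * (n * n)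
    few-triangles {suc n} {zero}  T large 1≤n = ≤-<-trans (≤-reflexive (*-zeroʳ (2 ^ h))) (s≤s z≤n)
    few-triangles {suc n} {suc m} T large 1≤n = ≰⇒> λ dense → contradictory T zero dense (s≤s z≤n) large

    -- The height is linear in `h`, which is all that matters later. The inner `10 + h` bounds
    -- `suc steps`, the term `rounds * 8` comes from `colours-tower`, and the outer 10 pays for the
    -- products in `demand`.
    demand-tower : demand (colours rounds) ≤ tower (10 + (rounds * 8 + (10 + h)))
    demand-tower = bound (rounds * 8 + (10 + h))
      (raise (rounds * 8) (10 + h) (tower-mono 4 (10 + h) (m≤m+n 4 (6 + h))))
      (raise (rounds * 8) (10 + h) (≤-trans (n≤1+n steps) s≤))
      (colours-tower s≤ rounds)
      (raise (rounds * 8) (10 + h) (raise 9 (1 + h) 2^h≤))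
      where
      32≤tower4 : 32 ≤ tower 4
      32≤tower4 = m≤m+n 32 (tower 4 ∸ 32)
      2^h≤ : 2 ^ h ≤ tower (1 + h)
      2^h≤ = ^-monoʳ-≤ 2 (<⇒≤ (n<tower h))
      s≤ : suc steps ≤ tower (10 + h)
      s≤ = +-tower (9 + h) (1≤tower (9 + h)) (*-tower (7 + h) β≤ β≤)
        where
        β≤ : β ≤ tower (7 + h)
        β≤ = *-tower (5 + h) (≤-trans 32≤tower4 (tower-mono 4 (5 + h) (m≤m+n 4 (1 + h)))) (raise 4 (1 + h) 2^h≤)
      bound : ∀ e {s k l} → tower 4 ≤ tower e → s ≤ tower e → k ≤ tower e → l ≤ tower e →
              32 * (s * (k * k * (l * l * l))) ≤ tower (10 + e)
      bound e 4≤ s≤ k≤ l≤ = *-tower (8 + e) (raise 8 e (≤-trans 32≤tower4 4≤)) (*-tower (6 + e) (raise 6 e s≤) (*-tower (4 + e)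
        (raise 2 (2 + e) (*-tower e k≤ k≤)) (*-tower (2 + e) (*-tower e l≤ l≤) (raise 2 e l≤))))

  -- Selection of indices and small vertex sets.

  select : ∀ {n} (p : Fin n → Bool) → ∃ λ (ι : Fin (∑ (χ ∘ p)) → Fin n) →
           (∀ s t → ι s ≡ ι t → s ≡ t) × (∀ t → p (ι t) ≡ true)
  select {zero}  p = (λ ()) , (λ ()) , (λ ())
  select {suc n} p with p zero in p₀ | select (p ∘ suc)
  ... | false | ι , ι-inj , p∘ι = suc ∘ ι , (λ s t eq → ι-inj s t (Fin.suc-injective eq)) , p∘ι
  ... | true  | ι , ι-inj , p∘ι = ι′ , ι′-inj , p∘ι′
    where
    ι′ : Fin (suc (∑ (χ ∘ p ∘ suc))) → Fin (suc n)
    ι′ zero    = zero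
    ι′ (suc t) = suc (ι t)
    ι′-inj : ∀ s t → ι′ s ≡ ι′ t → s ≡ t
    ι′-inj zero    zero    _  = refl
    ι′-inj (suc s) (suc t) eq = cong suc (ι-inj s t (Fin.suc-injective eq))
    p∘ι′ : ∀ t → p (ι′ t) ≡ true
    p∘ι′ zero    = p₀
    p∘ι′ (suc t) = p∘ι t

  ∑-injection : ∀ {m n} (p : Fin m → Bool) (q : Fin n → Bool) (g : Fin m → Fin n) →
                (∀ i → p i ≡ true → q (g i) ≡ true) →
                (∀ i j → p i ≡ true → p j ≡ true → g i ≡ g j → i ≡ j) → ∑ (χ ∘ p) ≤ ∑ (χ ∘ q)
  ∑-injection p q g p⇒q inj = begin
    ∑ (χ ∘ p)  ≡⟨ ∑-fibres g (χ ∘ p) ⟩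
    ∑ (λ c → ∑ (λ i → χ (g i == c) * χ (p i)))  ≡⟨ ∑-cong (λ c → ∑-cong λ i → sym (χ-∧ (g i == c) (p i))) ⟩
    ∑ (λ c → ∑ (λ i → χ ((g i == c) ∧ p i)))  ≤⟨ ∑-mono (λ c → ≤-trans
      (∑-atMostOne λ i j ti tj → inj i j (∧-trueʳ {g i == c} ti) (∧-trueʳ {g j == c} tj)
        (trans (==-sound (∧-trueˡ ti)) (sym (==-sound (∧-trueˡ tj)))))
      (χ-mono λ e → let i , t = exists-elim {p = λ i → (g i == c) ∧ p i} e in
        subst (λ c → q c ≡ true) (==-sound (∧-trueˡ t)) (p⇒q i (∧-trueʳ {g i == c} t)))) ⟩
    ∑ (χ ∘ q)  ∎
    where open ≤-Reasoning

  ∑-three : ∀ {n} (p : Fin n → Bool) i j k → i ≢ j → i ≢ k → j ≢ k →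
            p i ≡ true → p j ≡ true → p k ≡ true → 3 ≤ ∑ (χ ∘ p)
  ∑-three {n} p i j k i≢j i≢k j≢k pi pj pk = begin
    3  ≡⟨ cong₂ _+_ (one i) (cong₂ _+_ (one j) (one k)) ⟨
    ∑ (δ i) + (∑ (δ j) + ∑ (δ k))  ≡⟨ cong (∑ (δ i) +_) (∑-+ (δ j) (δ k)) ⟨
    ∑ (δ i) + ∑ (λ t → δ j t + δ k t)  ≡⟨ ∑-+ (δ i) (λ t → δ j t + δ k t) ⟨
    ∑ (λ t → δ i t + (δ j t + δ k t))  ≤⟨ ∑-mono pointwise ⟩
    ∑ (χ ∘ p)  ∎
    where
    open ≤-Reasoning
    δ : Fin n → Fin n → ℕ
    δ i t = χ (i == t)
    one : ∀ i → ∑ (δ i) ≡ 1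
    one i = trans (∑-cong λ t → sym (*-identityʳ (δ i t))) (∑-pick i (λ _ → 1))
    pointwise : ∀ t → δ i t + (δ j t + δ k t) ≤ χ (p t)
    pointwise t with i Fin.≟ t | j Fin.≟ t | k Fin.≟ t
    ... | yes refl | yes refl | _        = contradiction refl i≢j
    ... | yes refl | _        | yes refl = contradiction refl i≢k
    ... | _        | yes refl | yes refl = contradiction refl j≢k
    ... | yes refl | no _     | no _     = ≤-reflexive (cong χ (sym pi))
    ... | no _     | yes refl | no _     = ≤-reflexive (cong χ (sym pj))
    ... | no _     | no _     | yes refl = ≤-reflexive (cong χ (sym pk))
    ... | no _     | no _     | no _     = z≤n

  element : ∀ {n k} (e : Subset n) → ∣ e ∣ ≡ suc k → ∃ (_∈ e)
  element (inside  ∷ e) _  = zero , here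
  element (outside ∷ e) eq = let x , x∈e = element e eq in suc x , there x∈e

  empty : ∀ {n} (e : Subset n) → ∣ e ∣ ≡ 0 → ∀ {w} → w ∉ e
  empty (outside ∷ e) eq (there w∈e) = empty e eq w∈e

  remove : ∀ {n k} (e : Subset n) {x} → x ∈ e → ∣ e ∣ ≡ suc k →
           ∃ λ e′ → ∣ e′ ∣ ≡ k × x ∉ e′ × e′ ⊆ e × (∀ {w} → w ∈ e → w ≡ x ⊎ w ∈ e′)
  remove (inside ∷ e) here eq = outside ∷ e , suc-injective eq , (λ ()) , Subset.out⊆ id , split
    where
    split : ∀ {w} → w ∈ inside ∷ e → w ≡ zero ⊎ w ∈ outside ∷ e
    split here      = inj₁ refl
    split (there w) = inj₂ (there w)
  remove {k = zero} (inside ∷ e) (there x∈e) eq = contradiction x∈e (empty e (suc-injective eq))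
  remove {k = suc k} (inside ∷ e) (there x∈e) eq =
    let e′ , size , x∉e′ , e′⊆e , split = remove e x∈e (suc-injective eq) in
    inside ∷ e′ , cong suc size , x∉e′ ∘ Subset.drop-there , Subset.s⊆s e′⊆e ,
    λ { here → inj₂ here ; (there w) → Sum.map (cong suc) there (split w) }
  remove (outside ∷ e) (there x∈e) eq =
    let e′ , size , x∉e′ , e′⊆e , split = remove e x∈e eq in
    outside ∷ e′ , size , x∉e′ ∘ Subset.drop-there , Subset.s⊆s e′⊆e ,
    λ { (there w) → Sum.map (cong suc) there (split w) }

  third : ∀ {n} (e : Subset n) {a b} → ∣ e ∣ ≡ 3 → a ∈ e → b ∈ e → a ≢ b →
          ∃ λ c → c ∈ e × a ≢ c × b ≢ c × (∀ {w} → w ∈ e → w ≡ a ⊎ w ≡ b ⊎ w ≡ c)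
  third e {a} {b} size a∈e b∈e a≢b with remove e a∈e size
  ... | e₂ , size₂ , a∉e₂ , e₂⊆e , split₂ with split₂ b∈e
  ...   | inj₁ b≡a = contradiction (sym b≡a) a≢b
  ...   | inj₂ b∈e₂ with remove e₂ b∈e₂ size₂
  ...     | e₁ , size₁ , b∉e₁ , e₁⊆e₂ , split₁ with element e₁ size₁
  ...       | c , c∈e₁ with remove e₁ c∈e₁ size₁
  ...         | e₀ , size₀ , _ , _ , split₀ =
    c , e₂⊆e (e₁⊆e₂ c∈e₁) , (λ { refl → a∉e₂ (e₁⊆e₂ c∈e₁) }) , (λ { refl → b∉e₁ c∈e₁ }) , λ w∈e →
      Sum.map₂ (λ w∈e₂ → Sum.map₂ (λ w∈e₁ →
        [ id , (λ w∈e₀ → contradiction w∈e₀ (empty e₀ size₀)) ]′ (split₀ w∈e₁)) (split₁ w∈e₂)) (split₂ w∈e)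

  record Points {n} (e : Subset n) : Set where
    field
      x y z : Fin n
      x∈ : x ∈ e
      y∈ : y ∈ e
      z∈ : z ∈ e
      x≢y : x ≢ y
      x≢z : x ≢ z
      y≢z : y ≢ z
      only : ∀ {w} → w ∈ e → w ≡ x ⊎ w ≡ y ⊎ w ≡ z

  points : ∀ {n} (e : Subset n) → ∣ e ∣ ≡ 3 → Points e
  points e size with element e size
  ... | a , a∈e with remove e a∈e size
  ...   | e₂ , size₂ , a∉e₂ , e₂⊆e , _ with element e₂ size₂
  ...     | b , b∈e₂ = record
    { x = a ; y = b ; z = proj₁ rest ; x∈ = a∈e ; y∈ = e₂⊆e b∈e₂ ; z∈ = proj₁ (proj₂ rest)
    ; x≢y = a≢b ; x≢z = proj₁ (proj₂ (proj₂ rest)) ; y≢z = proj₁ (proj₂ (proj₂ (proj₂ rest)))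
    ; only = proj₂ (proj₂ (proj₂ (proj₂ rest))) }
    where
    a≢b : a ≢ b
    a≢b refl = a∉e₂ b∈e₂
    rest = third e size a∈e (e₂⊆e b∈e₂) a≢b

  ⟪_⟫ : ∀ {n} → List (Fin n) → Subset n
  ⟪ xs ⟫ = List.foldr (λ x W → ⁅ x ⁆ ∪ W) ∅ xs

  ∈⟪⟫ : ∀ {n} {w : Fin n} {xs} → w List.∈ xs → w ∈ ⟪ xs ⟫
  ∈⟪⟫ (hereᴸ refl) = Subset.p⊆p∪q _ (Subset.x∈⁅x⁆ _)
  ∈⟪⟫ (thereᴸ {x = x} w∈xs) = Subset.q⊆p∪q ⁅ x ⁆ _ (∈⟪⟫ w∈xs)

  ∣⁅x⁆∪p∣≤ : ∀ {n} (x : Fin n) p → ∣ ⁅ x ⁆ ∪ p ∣ ≤ suc ∣ p ∣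
  ∣⁅x⁆∪p∣≤ zero    (s ∷ p) rewrite Subset.∪-identityˡ p = s≤s (Subset.∣p∣≤∣x∷p∣ s p)
  ∣⁅x⁆∪p∣≤ (suc x) (inside  ∷ p) = s≤s (∣⁅x⁆∪p∣≤ x p)
  ∣⁅x⁆∪p∣≤ (suc x) (outside ∷ p) = ∣⁅x⁆∪p∣≤ x p

  ∣⟪⟫∣≤ : ∀ {n} (xs : List (Fin n)) → ∣ ⟪ xs ⟫ ∣ ≤ length xs
  ∣⟪⟫∣≤ {n} List.[]       = ≤-reflexive (Subset.∣⊥∣≡0 n)
  ∣⟪⟫∣≤ (x List.∷ xs) = ≤-trans (∣⁅x⁆∪p∣≤ x ⟪ xs ⟫) (s≤s (∣⟪⟫∣≤ xs))

  -- Sparsity speaks of sets with exactly six vertices, so the vertex set of three overlapping edges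
  -- has to be padded; this is where `6 ≤ n` enters.
  enlarge : ∀ {n} v (p : Subset n) → ∣ p ∣ ≤ v → v ≤ n → ∃ λ q → ∣ q ∣ ≡ v × p ⊆ q
  enlarge zero    []             _   _   = [] , refl , id
  enlarge (suc v) []             _   ()
  enlarge (suc v) (inside ∷ p)  (s≤s ≤v) (s≤s v≤) =
    let q , size , p⊆q = enlarge v p ≤v v≤ in inside ∷ q , cong suc size , Subset.s⊆s p⊆q
  enlarge {suc n} v (outside ∷ p) ≤v v≤ with v ≤? n
  ... | yes v≤n = let q , size , p⊆q = enlarge v p ≤v v≤n in outside ∷ q , size , Subset.s⊆s p⊆q
  ... | no v≰n with ≤-antisym v≤ (≰⇒> v≰n)
  ...   | refl = let q , size , p⊆q = enlarge n p (Subset.∣p∣≤n p) ≤-refl in inside ∷ q , cong suc size , Subset.out⊆ p⊆q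

  count-∑ : ∀ {A : Set} {P : A → Set} (P? : ∀ a → Dec (P a)) {n} (xs : Vec A n) →
            count P? xs ≡ ∑ (λ i → χ (does (P? (lookup xs i))))
  count-∑ P? []       = refl
  count-∑ P? (x ∷ xs) with does (P? x)
  ... | true  = cong suc (count-∑ P? xs)
  ... | false = count-∑ P? xs

  -- Sparse hypergraphs and triangle systems

  module SparseHypergraph {n M : ℕ} (6≤n : 6 ≤ n) (E : Vec (Subset n) M)
                          (uniform : IsUniform 3 E) (sparse : IsSparse 6 3 E) where

    private
      edge : Fin M → Subset n
      edge = lookup E

      size : ∀ i → ∣ edge i ∣ ≡ 3
      size i = All.lookup (proj₂ uniform) (∈-lookup i E)

    no-three : ∀ {i j k} → i ≢ j → i ≢ k → j ≢ k → (xs : List (Fin n)) → length xs ≤ 6 →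
               (∀ {w} → w ∈ edge i → w List.∈ xs) → (∀ {w} → w ∈ edge j → w List.∈ xs) →
               ¬ (∀ {w} → w ∈ edge k → w List.∈ xs)
    no-three {i} {j} {k} i≢j i≢k j≢k xs ≤6 i⊆ j⊆ k⊆ with enlarge 6 ⟪ xs ⟫ (≤-trans (∣⟪⟫∣≤ xs) ≤6) 6≤n
    ... | W , size , xs⊆W = <⇒≱ (sparse W size) (≤-trans
      (∑-three (λ i → does (edge i ⊆? W)) i j k i≢j i≢k j≢k
        (dec-true (_ ⊆? W) λ w → xs⊆W (∈⟪⟫ (i⊆ w)))
        (dec-true (_ ⊆? W) λ w → xs⊆W (∈⟪⟫ (j⊆ w)))
        (dec-true (_ ⊆? W) λ w → xs⊆W (∈⟪⟫ (k⊆ w))))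
      (≤-reflexive (sym (count-∑ (_⊆? W) E))))

    Conflict : Fin M → Fin M → Set
    Conflict i j = ∃ λ a → ∃ λ b → a ≢ b × (a ∈ edge i × b ∈ edge i) × (a ∈ edge j × b ∈ edge j)

    conflict? : ∀ i j → Dec (Conflict i j)
    conflict? i j = Fin.any? λ a → Fin.any? λ b →
      ¬? (a Fin.≟ b) ×-dec ((a ∈? edge i) ×-dec (b ∈? edge i)) ×-dec ((a ∈? edge j) ×-dec (b ∈? edge j))

    conflict-sym : ∀ {i j} → Conflict i j → Conflict j i
    conflict-sym (a , b , a≢b , in-i , in-j) = a , b , a≢b , in-j , in-i

    -- Edges meeting a third one in two vertices each span at most five vertices with it.
    conflict-unique : ∀ {i j k} → i ≢ j → i ≢ k → Conflict i j → Conflict i k → j ≡ k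
    conflict-unique {i} {j} {k} i≢j i≢k (a , b , a≢b , (a∈i , b∈i) , (a∈j , b∈j)) (a′ , b′ , a′≢b′ , (a′∈i , b′∈i) , (a′∈k , b′∈k))
      with j Fin.≟ k
    ... | yes j≡k = j≡k
    ... | no  j≢k = contradiction
      (λ {w} w∈ → [ (λ { refl → in-i a′∈i }) , [ (λ { refl → in-i b′∈i }) , (λ { refl → thereᴸ (hereᴸ refl) }) ]′ ]′ (k-only {w} w∈))
      (no-three i≢j i≢k j≢k xs (m≤m+n 5 1) in-i
        λ {w} w∈ → [ (λ { refl → in-i a∈i }) , [ (λ { refl → in-i b∈i }) , (λ { refl → hereᴸ refl }) ]′ ]′ (j-only {w} w∈))
      where
      third-j = third (edge j) (size j) a∈j b∈j a≢b
      third-k = third (edge k) (size k) a′∈k b′∈k a′≢b′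
      c  = proj₁ third-j
      c′ = proj₁ third-k
      j-only : ∀ {w} → w ∈ edge j → w ≡ a ⊎ w ≡ b ⊎ w ≡ c
      j-only = proj₂ (proj₂ (proj₂ (proj₂ third-j)))
      k-only : ∀ {w} → w ∈ edge k → w ≡ a′ ⊎ w ≡ b′ ⊎ w ≡ c′
      k-only = proj₂ (proj₂ (proj₂ (proj₂ third-k)))
      module I = Points (points (edge i) (size i))
      xs = c List.∷ c′ List.∷ I.x List.∷ I.y List.∷ I.z List.∷ List.[]
      in-i : ∀ {w} → w ∈ edge i → w List.∈ xs
      in-i w∈ = thereᴸ (thereᴸ ([ hereᴸ , [ thereᴸ ∘ hereᴸ , thereᴸ ∘ thereᴸ ∘ hereᴸ ]′ ]′ (I.only w∈)))

    Earlier : Fin M → Set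
    Earlier i = ∃ λ j → j Fin.< i × Conflict i j

    earlier? : ∀ i → Dec (Earlier i)
    earlier? i = Fin.any? λ j → (j Fin.<? i) ×-dec conflict? i j

    kept : Fin M → Bool
    kept i = not (does (earlier? i))

    private
      first : Fin M → Fin M
      first i = pick (earlier? i)
        where
        pick : Dec (Earlier i) → Fin M
        pick (yes (j , _)) = j
        pick (no _)        = i

      first-earlier : ∀ i → Earlier i → first i Fin.< i × Conflict i (first i)
      first-earlier i e with earlier? i
      ... | yes (j , j<i , conflict) = j<i , conflict
      ... | no ¬e                    = contradiction e ¬e

      first-kept : ∀ i → Earlier i → kept (first i) ≡ true
      first-kept i e with first-earlier i e
      ... | j<i , conflict = cong not (dec-false (earlier? (first i)) λ (k , k<j , conflict′) →
        Fin.<⇒≢ (Fin.<-trans k<j j<i)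
          (sym (conflict-unique (Fin.<⇒≢ j<i) (≢-sym (Fin.<⇒≢ k<j)) (conflict-sym conflict) conflict′)))

      first-injective : ∀ i j → Earlier i → Earlier j → first i ≡ first j → i ≡ j
      first-injective i j ei ej eq with first-earlier i ei | first-earlier j ej
      ... | i′<i , conflict | j′<j , conflict′ = conflict-unique (Fin.<⇒≢ i′<i)
        (λ i′≡j → Fin.<⇒≢ j′<j (trans (sym eq) i′≡j)) (conflict-sym conflict)
        (subst (λ k → Conflict k j) (sym eq) (conflict-sym conflict′))

    -- By `conflict-unique` the conflicts between distinct edges form a matching. Dropping the later
    -- edge of each matched pair loses at most half, since `first` maps the dropped edges
    -- injectively to kept ones.
    kept-many : M ≤ 2 * ∑ (χ ∘ kept)
    kept-many = begin
      M  ≡⟨ trans (∑-const M 1) (*-identityʳ M) ⟨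
      ∑ {M} (λ _ → 1)  ≡⟨ ∑-cong (λ i → χ-not (does (earlier? i))) ⟨
      ∑ (λ i → χ (does (earlier? i)) + χ (kept i))  ≡⟨ ∑-+ (λ i → χ (does (earlier? i))) (χ ∘ kept) ⟩
      ∑ (λ i → χ (does (earlier? i))) + ∑ (χ ∘ kept)  ≤⟨ +-monoˡ-≤ (∑ (χ ∘ kept)) (∑-injection (does ∘ earlier?) kept first
        (λ i e → first-kept i (does-sound (earlier? i) e))
        (λ i j ei ej → first-injective i j (does-sound (earlier? i) ei) (does-sound (earlier? j) ej))) ⟩
      ∑ (χ ∘ kept) + ∑ (χ ∘ kept)  ≡⟨ cong (∑ (χ ∘ kept) +_) (+-identityʳ _) ⟨
      2 * ∑ (χ ∘ kept)  ∎
      where open ≤-Reasoning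

    kept-independent : ∀ i j → kept i ≡ true → kept j ≡ true → Conflict i j → i ≡ j
    kept-independent i j ki kj conflict with Fin.<-cmp i j
    ... | tri≈ _ i≡j _ = i≡j
    ... | tri< i<j _ _ = contradiction (i , i<j , conflict-sym conflict) (does-complete (earlier? j) (not-true kj))
    ... | tri> _ _ j<i = contradiction (j , j<i , conflict) (does-complete (earlier? i) (not-true ki))

    module _ {k : ℕ} (ι : Fin k → Fin M) (ι-injective : ∀ s t → ι s ≡ ι t → s ≡ t)
             (independent : ∀ s t → Conflict (ι s) (ι t) → s ≡ t) (pt : ∀ t → Points (edge (ι t))) where

      private
        module Pt t = Points (pt t)
        x y z : Fin k → Fin n
        x t = Pt.x t
        y t = Pt.y t
        z t = Pt.z t

      xy-simple : ∀ s t → x s ≡ x t → y s ≡ y t → s ≡ t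
      xy-simple s t xs≡xt ys≡yt = independent s t (x s , y s , Pt.x≢y s , (Pt.x∈ s , Pt.y∈ s) ,
        (subst (_∈ _) (sym xs≡xt) (Pt.x∈ t) , subst (_∈ _) (sym ys≡yt) (Pt.y∈ t)))
      xz-simple : ∀ s t → x s ≡ x t → z s ≡ z t → s ≡ t
      xz-simple s t xs≡xt zs≡zt = independent s t (x s , z s , Pt.x≢z s , (Pt.x∈ s , Pt.z∈ s) ,
        (subst (_∈ _) (sym xs≡xt) (Pt.x∈ t) , subst (_∈ _) (sym zs≡zt) (Pt.z∈ t)))
      yz-simple : ∀ s t → y s ≡ y t → z s ≡ z t → s ≡ t
      yz-simple s t ys≡yt zs≡zt = independent s t (y s , z s , Pt.y≢z s , (Pt.y∈ s , Pt.z∈ s) ,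
        (subst (_∈ _) (sym ys≡yt) (Pt.y∈ t) , subst (_∈ _) (sym zs≡zt) (Pt.z∈ t)))
      -- Three distinct edges in this position share a vertex for each pair, so the six entries of
      -- `vertices` contain them all. If `r` equals `s` or `s` equals `t`, simplicity finishes.
      induced : ∀ r s t → x r ≡ x s → y r ≡ y t → z s ≡ z t → r ≡ t
      induced r s t xr≡xs yr≡yt zs≡zt with r Fin.≟ t | r Fin.≟ s | s Fin.≟ t
      ... | yes r≡t | _        | _        = r≡t
      ... | no _    | yes refl | _        = yz-simple r t yr≡yt zs≡zt
      ... | no _    | no _     | yes refl = xy-simple r t xr≡xs yr≡yt
      ... | no r≢t  | no r≢s   | no s≢t   = contradiction
        (λ {w} w∈ → [ (λ e → at₅ e) , [ (λ e → at₁ (trans e (sym yr≡yt))) , (λ e → at₄ (trans e (sym zs≡zt))) ]′ ]′ (Pt.only t {w} w∈))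
        (no-three (r≢s ∘ ι-injective r s) (r≢t ∘ ι-injective r t) (s≢t ∘ ι-injective s t) vertices ≤-refl
          (λ {w} w∈ → [ at₀ , [ at₁ , at₂ ]′ ]′ (Pt.only r {w} w∈))
          (λ {w} w∈ → [ (λ e → at₀ (trans e (sym xr≡xs))) , [ at₃ , at₄ ]′ ]′ (Pt.only s {w} w∈)))
        where
        vertices = x r List.∷ y r List.∷ z r List.∷ y s List.∷ z s List.∷ x t List.∷ List.[]
        at₀ : ∀ {w} → w ≡ x r → w List.∈ vertices
        at₀ = hereᴸ
        at₁ : ∀ {w} → w ≡ y r → w List.∈ vertices
        at₁ = thereᴸ ∘ hereᴸ
        at₂ : ∀ {w} → w ≡ z r → w List.∈ vertices
        at₂ = thereᴸ ∘ thereᴸ ∘ hereᴸ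
        at₃ : ∀ {w} → w ≡ y s → w List.∈ vertices
        at₃ = thereᴸ ∘ thereᴸ ∘ thereᴸ ∘ hereᴸ
        at₄ : ∀ {w} → w ≡ z s → w List.∈ vertices
        at₄ = thereᴸ ∘ thereᴸ ∘ thereᴸ ∘ thereᴸ ∘ hereᴸ
        at₅ : ∀ {w} → w ≡ x t → w List.∈ vertices
        at₅ = thereᴸ ∘ thereᴸ ∘ thereᴸ ∘ thereᴸ ∘ thereᴸ ∘ hereᴸ

      -- The points of an edge are named in an arbitrary order. As the parts of a `TriangleSystem`
      -- are separate copies of `Fin n`, different edges need not agree on the part of a common
      -- vertex, and no edge is lost here.
      triangleSystem : TriangleSystem n k
      triangleSystem = record
        { x = x ; y = y ; z = z
        ; xy-simple = xy-simple ; xz-simple = xz-simple ; yz-simple = yz-simple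
        ; induced = induced
        }

    kept-triangleSystem : TriangleSystem n (∑ (χ ∘ kept))
    kept-triangleSystem = let ι , ι-injective , ι-kept = select kept in
      triangleSystem ι ι-injective
        (λ s t conflict → ι-injective s t (kept-independent _ _ (ι-kept s) (ι-kept t) conflict))
        (λ t → points (edge (ι t)) (size (ι t)))

  f-triangleSystem : ∀ n → 6 ≤ n → ∃ λ m → f 3 n 6 3 ≤ 2 * m × TriangleSystem n m
  f-triangleSystem n 6≤n =
    let (E , uniform , sparse) , _ = proj₂ (f-maximum 3 n 6 3)
        open SparseHypergraph 6≤n E uniform sparse
    in ∑ (χ ∘ kept) , kept-many , kept-triangleSystem

  -- Forests and separated families.

  forest : ∀ {A : Set} {k n} (u v : Fin k → Fin n) (φ : Fin k → Fin n → A) →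
           (∀ i → φ i (u i) ≢ φ i (v i)) → (∀ i j → j ≢ i → φ i (u j) ≡ φ i (v j)) → k ≤ n
  forest {k = zero}          u v φ cut keep = z≤n
  forest {k = suc k} {zero}  u v φ cut keep with u zero
  ... | ()
  -- Every `φ i` is constant along the edges other than `i` but changes along `i`, so no cycle
  -- passes through `i`. In particular each later `φ i` is constant on the first edge and survives
  -- its contraction, which removes one edge and one vertex.
  forest {k = suc k} {suc n} u v φ cut keep = s≤s (forest (σ ∘ u ∘ suc) (σ ∘ v ∘ suc)
    (λ i → φ (suc i) ∘ punchIn v₀)
    (λ i eq → cut (suc i) (trans (φ∘σ i (u (suc i))) (trans eq (sym (φ∘σ i (v (suc i)))))))
    (λ i j j≢i → trans (sym (φ∘σ i (u (suc j)))) (trans (keep (suc i) (suc j) (j≢i ∘ Fin.suc-injective)) (φ∘σ i (v (suc j))))))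
    where
    -- σ contracts the first edge.
    u₀ = u zero
    v₀ = v zero
    v₀≢u₀ : v₀ ≢ u₀
    v₀≢u₀ eq = cut zero (cong (φ zero) (sym eq))
    σ : Fin (suc n) → Fin n
    σ w with v₀ Fin.≟ w
    ... | yes _   = punchOut v₀≢u₀
    ... | no v₀≢w = punchOut v₀≢w
    φ∘σ : ∀ i w → φ (suc i) w ≡ φ (suc i) (punchIn v₀ (σ w))
    φ∘σ i w with v₀ Fin.≟ w
    ... | yes refl = trans (sym (keep (suc i) zero λ ())) (cong (φ (suc i)) (sym (Fin.punchIn-punchOut v₀≢u₀)))
    ... | no v₀≢w  = cong (φ (suc i)) (sym (Fin.punchIn-punchOut v₀≢w))

  ∑-separated : ∀ {m n} (p : Fin m → Bool) (g : Fin m → Fin n) →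
                (∀ i j → p i ≡ true → g i ≡ g j → ¬ j ≢ i) → ∑ (χ ∘ p) ≤ n
  ∑-separated p g sep = ∑-injective p g λ i j pi _ eq → decide (j Fin.≟ i) (sep i j pi eq)
    where
    decide : ∀ {i j} → Dec (j ≡ i) → ¬ j ≢ i → i ≡ j
    decide (yes refl) _   = refl
    decide (no j≢i)   ¬≢  = contradiction j≢i ¬≢

  ∑-fibrewise : ∀ {m n b} (p : Fin m → Bool) (g : Fin m → Fin n) →
                (∀ c → ∑ (λ i → χ ((g i == c) ∧ p i)) ≤ b) → ∑ (χ ∘ p) ≤ n * b
  ∑-fibrewise p g bound = ≤-trans
    (≤-reflexive (trans (∑-fibres g (χ ∘ p)) (∑-cong λ c → ∑-cong λ i → sym (χ-∧ (g i == c) (p i)))))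
    (∑-bound bound)

  -- Averaging over vertex subsets.

  extend : ∀ {n} → Bool → (Fin n → Bool) → Fin (suc n) → Bool
  extend b A zero    = b
  extend b A (suc v) = A v

  -- The sum over all subsets of `Fin n`, that is `2 ^ n` times the expectation for a uniformly
  -- random subset.
  total : ∀ n → ((Fin n → Bool) → ℕ) → ℕ
  total zero    g = g λ ()
  total (suc n) g = total n (g ∘ extend true) + total n (g ∘ extend false)

  total≤max : ∀ n g → ∃ λ A → total n g ≤ 2 ^ n * g A
  total≤max zero    g = (λ ()) , ≤-reflexive (sym (+-identityʳ _))
  total≤max (suc n) g with total≤max n (g ∘ extend true) | total≤max n (g ∘ extend false)
  ... | A , A-max | B , B-max = choose (≤-total (g (extend true A)) (g (extend false B)))
    where
    open ≤-Reasoning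
    lemma : ∀ x y → x * y + x * y ≡ 2 * x * y
    lemma = solve-∀
    choose : _ → ∃ λ C → total (suc n) g ≤ 2 ^ suc n * g C
    choose (inj₁ A≤B) = extend false B , (begin
      total (suc n) g  ≤⟨ +-mono-≤ A-max B-max ⟩
      2 ^ n * g (extend true A) + 2 ^ n * g (extend false B)  ≤⟨ +-monoˡ-≤ _ (*-monoʳ-≤ (2 ^ n) A≤B) ⟩
      2 ^ n * g (extend false B) + 2 ^ n * g (extend false B)  ≡⟨ lemma (2 ^ n) (g (extend false B)) ⟩
      2 ^ suc n * g (extend false B)  ∎)
    choose (inj₂ B≤A) = extend true A , (begin
      total (suc n) g  ≤⟨ +-mono-≤ A-max B-max ⟩
      2 ^ n * g (extend true A) + 2 ^ n * g (extend false B)  ≤⟨ +-monoʳ-≤ (2 ^ n * g (extend true A)) (*-monoʳ-≤ (2 ^ n) B≤A) ⟩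
      2 ^ n * g (extend true A) + 2 ^ n * g (extend true A)  ≡⟨ lemma (2 ^ n) (g (extend true A)) ⟩
      2 ^ suc n * g (extend true A)  ∎)

  total-∑ : ∀ n {m} (g : Fin m → (Fin n → Bool) → ℕ) → total n (λ A → ∑ (λ t → g t A)) ≡ ∑ (λ t → total n (g t))
  total-∑ zero    g = refl
  total-∑ (suc n) g = trans
    (cong₂ _+_ (total-∑ n (λ t → g t ∘ extend true)) (total-∑ n (λ t → g t ∘ extend false)))
    (sym (∑-+ (λ t → total n (g t ∘ extend true)) (λ t → total n (g t ∘ extend false))))

  total-* : ∀ n c (g : (Fin n → Bool) → ℕ) → total n (λ A → c * g A) ≡ c * total n g
  total-* zero    c g = refl
  total-* (suc n) c g = trans (cong₂ _+_ (total-* n c (g ∘ extend true)) (total-* n c (g ∘ extend false)))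
    (sym (*-distribˡ-+ c (total n (g ∘ extend true)) (total n (g ∘ extend false))))

  total-const : ∀ n c → total n (λ _ → c) ≡ 2 ^ n * c
  total-const zero    c = sym (+-identityʳ c)
  total-const (suc n) c = trans (cong₂ _+_ (total-const n c) (total-const n c)) (lemma (2 ^ n) c)
    where
    lemma : ∀ x y → x * y + x * y ≡ 2 * x * y
    lemma = solve-∀

  total-inside : ∀ {n} (a : Fin n) → 2 * total n (λ A → χ (A a)) ≡ 2 ^ n
  total-inside {suc n} zero    = cong (2 *_) (trans
    (cong₂ _+_ (trans (total-const n 1) (*-identityʳ (2 ^ n))) (trans (total-const n 0) (*-zeroʳ (2 ^ n)))) (+-identityʳ (2 ^ n)))
  total-inside {suc n} (suc a) = trans (lemma (total n λ A → χ (A a))) (cong (2 *_) (total-inside a))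
    where
    lemma : ∀ x → 2 * (x + x) ≡ 2 * (2 * x)
    lemma = solve-∀

  total-outside : ∀ {n} (a : Fin n) → 2 * total n (λ A → χ (not (A a))) ≡ 2 ^ n
  total-outside {suc n} zero    = cong (2 *_)
    (cong₂ _+_ (trans (total-const n 0) (*-zeroʳ (2 ^ n))) (trans (total-const n 1) (*-identityʳ (2 ^ n))))
  total-outside {suc n} (suc a) = trans (lemma (total n λ A → χ (not (A a)))) (cong (2 *_) (total-outside a))
    where
    lemma : ∀ x → 2 * (x + x) ≡ 2 * (2 * x)
    lemma = solve-∀

  total-cut : ∀ {n} (a b : Fin n) → a ≢ b → 4 * total n (λ A → χ (A a ∧ not (A b))) ≡ 2 ^ n
  total-cut {suc n} zero    zero    a≢b = contradiction refl a≢b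
  total-cut {suc n} zero    (suc b) _   = trans
    (cong (λ k → 4 * (total n (λ A → χ (not (A b))) + k)) (trans (total-const n 0) (*-zeroʳ (2 ^ n))))
    (trans (lemma (total n λ A → χ (not (A b)))) (cong (2 *_) (total-outside b)))
    where
    lemma : ∀ x → 4 * (x + 0) ≡ 2 * (2 * x)
    lemma = solve-∀
  total-cut {suc n} (suc a) zero    _   = trans
    (cong₂ (λ k l → 4 * (k + l)) (trans (total-cong n λ A → cong χ (Bool.∧-zeroʳ (A a))) (trans (total-const n 0) (*-zeroʳ (2 ^ n))))
      (total-cong n λ A → cong χ (Bool.∧-identityʳ (A a))))
    (trans (*-assoc 2 2 (total n λ A → χ (A a))) (cong (2 *_) (total-inside a)))
    where
    total-cong : ∀ n {g g′ : (Fin n → Bool) → ℕ} → (∀ A → g A ≡ g′ A) → total n g ≡ total n g′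
    total-cong zero    g≡g′ = g≡g′ λ ()
    total-cong (suc n) g≡g′ = cong₂ _+_ (total-cong n (g≡g′ ∘ extend true)) (total-cong n (g≡g′ ∘ extend false))
  total-cut {suc n} (suc a) (suc b) a≢b = trans (lemma (total n λ A → χ (A a ∧ not (A b))))
    (cong (2 *_) (total-cut a b (a≢b ∘ cong suc)))
    where
    lemma : ∀ x → 4 * (x + x) ≡ 2 * (4 * x)
    lemma = solve-∀

  -- A random `A` contains `a t` and misses `b t` with probability 1/4, and a maximiser does at
  -- least as well as the average. The filter `p` allows further cuts on what earlier ones left.
  directed-cut : ∀ {m n} (p : Fin m → Bool) (a b : Fin m → Fin n) → (∀ t → a t ≢ b t) →
                 ∃ λ (A : Fin n → Bool) → ∑ (χ ∘ p) ≤ 4 * ∑ (λ t → χ (p t ∧ (A (a t) ∧ not (A (b t)))))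
  directed-cut {m} {n} p a b a≢b = A , *-cancelˡ-≤ (2 ^ n) {{m^n≢0 2 n}} (begin
    2 ^ n * ∑ (χ ∘ p)
      ≡⟨ ∑-*ˡ (2 ^ n) (χ ∘ p) ⟩
    ∑ (λ t → 2 ^ n * χ (p t))
      ≡⟨ ∑-cong (λ t → trans (cong (_* χ (p t)) (sym (total-cut (a t) (b t) (a≢b t))))
           (trans (commute 4 (total n (c t)) (χ (p t))) (cong (4 *_) (sym (total-* n (χ (p t)) (c t)))))) ⟩
    ∑ (λ t → 4 * total n (λ A → χ (p t) * c t A))
      ≡⟨ ∑-*ˡ 4 (λ t → total n (λ A → χ (p t) * c t A)) ⟨
    4 * ∑ (λ t → total n (λ A → χ (p t) * c t A))
      ≡⟨ cong (4 *_) (total-∑ n (λ t A → χ (p t) * c t A)) ⟨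
    4 * total n g
      ≤⟨ *-monoʳ-≤ 4 (proj₂ (total≤max n g)) ⟩
    4 * (2 ^ n * g A)
      ≡⟨ commute′ 4 (2 ^ n) (g A) ⟩
    2 ^ n * (4 * g A)
      ≡⟨ cong (λ k → 2 ^ n * (4 * k)) (∑-cong λ t → sym (χ-∧ (p t) (A (a t) ∧ not (A (b t))))) ⟩
    2 ^ n * (4 * ∑ (λ t → χ (p t ∧ (A (a t) ∧ not (A (b t)))))) ∎)
    where
    open ≤-Reasoning
    c : Fin m → (Fin n → Bool) → ℕ
    c t A = χ (A (a t) ∧ not (A (b t)))
    g : (Fin n → Bool) → ℕ
    g A = ∑ λ t → χ (p t) * c t A
    A = proj₁ (total≤max n g)
    commute : ∀ x y z → x * y * z ≡ x * (z * y)
    commute = solve-∀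
    commute′ : ∀ x y z → x * (y * z) ≡ y * (x * z)
    commute′ = solve-∀

  -- Linear triangle-free systems as sparse hypergraphs.

  ∣p∣≡∑ : ∀ {n} (p : Subset n) → ∣ p ∣ ≡ ∑ (χ ∘ lookup p)
  ∣p∣≡∑ []            = refl
  ∣p∣≡∑ (inside  ∷ p) = cong suc (∣p∣≡∑ p)
  ∣p∣≡∑ (outside ∷ p) = ∣p∣≡∑ p

  ∈⇒lookup : ∀ {n} {v : Fin n} {p} → v ∈ p → lookup p v ≡ true
  ∈⇒lookup here      = refl
  ∈⇒lookup (there v) = ∈⇒lookup v

  ∣⁅x⁆∪p∣≡ : ∀ {n} (x : Fin n) p → x ∉ p → ∣ ⁅ x ⁆ ∪ p ∣ ≡ suc ∣ p ∣
  ∣⁅x⁆∪p∣≡ zero    (inside  ∷ p) x∉p = contradiction here x∉p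
  ∣⁅x⁆∪p∣≡ zero    (outside ∷ p) x∉p = cong (suc ∘ ∣_∣) (Subset.∪-identityˡ p)
  ∣⁅x⁆∪p∣≡ (suc x) (inside  ∷ p) x∉p = cong suc (∣⁅x⁆∪p∣≡ x p (x∉p ∘ there))
  ∣⁅x⁆∪p∣≡ (suc x) (outside ∷ p) x∉p = ∣⁅x⁆∪p∣≡ x p (x∉p ∘ there)

  ∈⟪⟫⇒ : ∀ {n} {w : Fin n} x y z → w ∈ ⟪ x List.∷ y List.∷ z List.∷ List.[] ⟫ → w ≡ x ⊎ w ≡ y ⊎ w ≡ z
  ∈⟪⟫⇒ x y z w∈ = Sum.map (Subset.x∈⁅y⁆⇒x≡y x) (λ w∈ → Sum.map (Subset.x∈⁅y⁆⇒x≡y y)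
    (λ w∈ → [ Subset.x∈⁅y⁆⇒x≡y z , (λ w∈ → contradiction w∈ Subset.∉⊥) ]′ (Subset.x∈p∪q⁻ ⁅ z ⁆ _ w∈))
    (Subset.x∈p∪q⁻ ⁅ y ⁆ _ w∈)) (Subset.x∈p∪q⁻ ⁅ x ⁆ _ w∈)

  three-indices : ∀ {n} (p : Fin n → Bool) → 3 ≤ ∑ (χ ∘ p) →
                  ∃ λ i → ∃ λ j → ∃ λ k → (i ≢ j × i ≢ k × j ≢ k) × (p i ≡ true × p j ≡ true × p k ≡ true)
  three-indices p 3≤ with ∑ (χ ∘ p) | select p
  three-indices p (s≤s (s≤s (s≤s z≤n))) | suc (suc (suc _)) | ι , ι-inj , p∘ι =
    ι zero , ι (suc zero) , ι (suc (suc zero)) ,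
    ((λ eq → contradiction (ι-inj _ _ eq) λ ()) , (λ eq → contradiction (ι-inj _ _ eq) λ ()) , (λ eq → contradiction (ι-inj _ _ eq) λ ())) ,
    (p∘ι _ , p∘ι _ , p∘ι _)

  coincidence : ∀ {n} (p : Fin n → Bool) a b c → p a ≡ true → p b ≡ true → p c ≡ true →
                (a ≡ b ⊎ a ≡ c ⊎ b ≡ c) ⊎ 3 ≤ ∑ (χ ∘ p)
  coincidence p a b c pa pb pc with a Fin.≟ b | a Fin.≟ c | b Fin.≟ c
  ... | yes a≡b | _       | _       = inj₁ (inj₁ a≡b)
  ... | no _    | yes a≡c | _       = inj₁ (inj₂ (inj₁ a≡c))
  ... | no _    | no _    | yes b≡c = inj₁ (inj₂ (inj₂ b≡c))
  ... | no a≢b  | no a≢c  | no b≢c  = inj₂ (∑-three p a b c a≢b a≢c b≢c pa pb pc)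

  ∑-two : ∀ {n} (p : Fin n → Bool) i j → i ≢ j → p i ≡ true → p j ≡ true → 2 ≤ ∑ (χ ∘ p)
  ∑-two {suc n} p i j i≢j pi pj = s≤s⁻¹ (∑-three (extend true p) zero (suc i) (suc j) (λ ()) (λ ()) (i≢j ∘ Fin.suc-injective) refl pi pj)

  ∑-one : ∀ {n} (p : Fin n → Bool) i → p i ≡ true → 1 ≤ ∑ (χ ∘ p)
  ∑-one p i pi = ≤-trans (≤-reflexive (cong χ (sym pi))) (term≤∑ (χ ∘ p) i)

  two-values : ∀ {n} (p : Fin n → Bool) a b c → p a ≡ true → p b ≡ true → p c ≡ true →
               (a ≡ b × a ≡ c) ⊎ 2 ≤ ∑ (χ ∘ p)
  two-values p a b c pa pb pc with a Fin.≟ b | a Fin.≟ c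
  ... | yes a≡b | yes a≡c = inj₁ (a≡b , a≡c)
  ... | no a≢b  | _       = inj₂ (∑-two p a b a≢b pa pb)
  ... | yes _   | no a≢c  = inj₂ (∑-two p a c a≢c pa pc)

  -- Unlike the parts of a `TriangleSystem`, the three roles may overlap as sets of vertices. Only
  -- after they have been cut apart do the triples form a hypergraph on `Fin n` with the required
  -- sparsity.
  record Linear {k n} (X Y Z : Fin k → Fin n) : Set where
    field
      xy : ∀ s t → X s ≡ X t → Y s ≡ Y t → s ≡ t
      xz : ∀ s t → X s ≡ X t → Z s ≡ Z t → s ≡ t
      yz : ∀ s t → Y s ≡ Y t → Z s ≡ Z t → s ≡ t
      no-triangle : ∀ r s t → r ≢ s → r ≢ t → s ≢ t → X r ≡ X s → Y r ≡ Y t → ¬ Z s ≡ Z t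

  module Partite {k n : ℕ} {X Y Z : Fin k → Fin n} (linear : Linear X Y Z)
                 (PX PY PZ : Fin n → Bool) (disjoint : ∀ v → χ (PX v) + (χ (PY v) + χ (PZ v)) ≤ 1)
                 (X∈ : ∀ t → PX (X t) ≡ true) (Y∈ : ∀ t → PY (Y t) ≡ true) (Z∈ : ∀ t → PZ (Z t) ≡ true) where
    open Linear linear

    private
      X≢Y : ∀ s t → X s ≢ Y t
      X≢Y s t eq with PX (X s) | X∈ s | PY (X s) | trans (cong PY eq) (Y∈ t) | disjoint (X s)
      ... | true | _ | true | _ | s≤s ()

      X≢Z : ∀ s t → X s ≢ Z t
      X≢Z s t eq with PX (X s) | X∈ s | PY (X s) | PZ (X s) | trans (cong PZ eq) (Z∈ t) | disjoint (X s)
      ... | true | _ | true  | true | _ | s≤s ()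
      ... | true | _ | false | true | _ | s≤s ()

      Y≢Z : ∀ s t → Y s ≢ Z t
      Y≢Z s t eq with PX (Y s) | PY (Y s) | Y∈ s | PZ (Y s) | trans (cong PZ eq) (Z∈ t) | disjoint (Y s)
      ... | true  | true | _ | true | _ | s≤s ()
      ... | false | true | _ | true | _ | s≤s ()

    edge : Fin k → Subset n
    edge t = ⟪ X t List.∷ Y t List.∷ Z t List.∷ List.[] ⟫

    X∈edge : ∀ t → X t ∈ edge t
    X∈edge t = ∈⟪⟫ {xs = X t List.∷ Y t List.∷ Z t List.∷ List.[]} (hereᴸ refl)

    Y∈edge : ∀ t → Y t ∈ edge t
    Y∈edge t = ∈⟪⟫ {xs = X t List.∷ Y t List.∷ Z t List.∷ List.[]} (thereᴸ (hereᴸ refl))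

    Z∈edge : ∀ t → Z t ∈ edge t
    Z∈edge t = ∈⟪⟫ {xs = X t List.∷ Y t List.∷ Z t List.∷ List.[]} (thereᴸ (thereᴸ (hereᴸ refl)))

    edge-size : ∀ t → ∣ edge t ∣ ≡ 3
    edge-size t = trans (∣⁅x⁆∪p∣≡ (X t) _ X∉) (cong suc (trans (∣⁅x⁆∪p∣≡ (Y t) _ Y∉)
      (cong suc (trans (∣⁅x⁆∪p∣≡ (Z t) _ Subset.∉⊥) (cong suc (Subset.∣⊥∣≡0 n))))))
      where
      Y∉ : Y t ∉ ⟪ Z t List.∷ List.[] ⟫
      Y∉ Y∈ = [ (λ e → Y≢Z t t (Subset.x∈⁅y⁆⇒x≡y (Z t) e)) , Subset.∉⊥ ]′ (Subset.x∈p∪q⁻ ⁅ Z t ⁆ _ Y∈)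
      X∉ : X t ∉ ⟪ Y t List.∷ Z t List.∷ List.[] ⟫
      X∉ X∈ = [ (λ e → X≢Y t t (Subset.x∈⁅y⁆⇒x≡y (Y t) e)) , (λ X∈ →
        [ (λ e → X≢Z t t (Subset.x∈⁅y⁆⇒x≡y (Z t) e)) , Subset.∉⊥ ]′ (Subset.x∈p∪q⁻ ⁅ Z t ⁆ _ X∈)) ]′ (Subset.x∈p∪q⁻ ⁅ Y t ⁆ _ X∈)

    edge-injective : ∀ {s t} → edge s ≡ edge t → s ≡ t
    edge-injective {s} {t} eq = xy s t
      ([ id , [ (λ e → contradiction e (X≢Y s t)) , (λ e → contradiction e (X≢Z s t)) ]′ ]′
        (∈⟪⟫⇒ (X t) (Y t) (Z t) (subst (X s ∈_) eq (X∈edge s))))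
      ([ (λ e → contradiction (sym e) (X≢Y t s)) , [ id , (λ e → contradiction e (Y≢Z s t)) ]′ ]′
        (∈⟪⟫⇒ (X t) (Y t) (Z t) (subst (Y s ∈_) eq (Y∈edge s))))

    module _ (W : Subset n) (∣W∣≡6 : ∣ W ∣ ≡ 6) where

      private
        part : (Fin n → Bool) → ℕ
        part Q = ∑ λ v → χ (lookup W v ∧ Q v)

        parts≤6 : part PX + (part PY + part PZ) ≤ 6
        parts≤6 = begin
          part PX + (part PY + part PZ)
            ≡⟨ cong (part PX +_) (∑-+ (λ v → χ (lookup W v ∧ PY v)) (λ v → χ (lookup W v ∧ PZ v))) ⟨
          part PX + ∑ (λ v → χ (lookup W v ∧ PY v) + χ (lookup W v ∧ PZ v))
            ≡⟨ ∑-+ (λ v → χ (lookup W v ∧ PX v)) (λ v → χ (lookup W v ∧ PY v) + χ (lookup W v ∧ PZ v)) ⟨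
          ∑ (λ v → χ (lookup W v ∧ PX v) + (χ (lookup W v ∧ PY v) + χ (lookup W v ∧ PZ v)))
            ≤⟨ ∑-mono (λ v → pointwise (lookup W v) (disjoint v)) ⟩
          ∑ (χ ∘ lookup W)
            ≡⟨ ∣p∣≡∑ W ⟨
          ∣ W ∣
            ≡⟨ ∣W∣≡6 ⟩
          6 ∎
          where
          open ≤-Reasoning
          pointwise : ∀ w {a b c} → χ a + (χ b + χ c) ≤ 1 → χ (w ∧ a) + (χ (w ∧ b) + χ (w ∧ c)) ≤ χ w
          pointwise true  ≤1 = ≤1
          pointwise false _  = z≤n

      -- If the three edges agreed in one part, linearity would make them differ pairwise in the
      -- other two, giving 1 + 3 + 3 vertices. So each part contributes at least two vertices of
      -- `W`, hence exactly two, and in each part two of the edges meet.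
      no-three-edges : ∀ i j l → i ≢ j → i ≢ l → j ≢ l → edge i ⊆ W → edge j ⊆ W → ¬ edge l ⊆ W
      no-three-edges i j l i≢j i≢l j≢l i⊆ j⊆ l⊆ =
        triangle
          (pair PX X (in-X i⊆) (in-X j⊆) (in-X l⊆) λ 3≤ → too-many 3≤ two-y two-z)
          (pair PY Y (in-Y i⊆) (in-Y j⊆) (in-Y l⊆) λ 3≤ → too-many′ two-x 3≤ two-z)
          (pair PZ Z (in-Z i⊆) (in-Z j⊆) (in-Z l⊆) λ 3≤ → too-many″ two-x two-y 3≤)
        where
        too-many : 3 ≤ part PX → 2 ≤ part PY → ¬ 2 ≤ part PZ
        too-many a b c = <⇒≱ (s≤s parts≤6) (+-mono-≤ a (+-mono-≤ b c))
        too-many′ : 2 ≤ part PX → 3 ≤ part PY → ¬ 2 ≤ part PZ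
        too-many′ a b c = <⇒≱ (s≤s parts≤6) (+-mono-≤ a (+-mono-≤ b c))
        too-many″ : 2 ≤ part PX → 2 ≤ part PY → ¬ 3 ≤ part PZ
        too-many″ a b c = <⇒≱ (s≤s parts≤6) (+-mono-≤ a (+-mono-≤ b c))
        in-X : ∀ {t} → edge t ⊆ W → (lookup W (X t) ∧ PX (X t)) ≡ true
        in-X {t} t⊆ = ∧-true (∈⇒lookup (t⊆ (X∈edge t))) (X∈ t)
        in-Y : ∀ {t} → edge t ⊆ W → (lookup W (Y t) ∧ PY (Y t)) ≡ true
        in-Y {t} t⊆ = ∧-true (∈⇒lookup (t⊆ (Y∈edge t))) (Y∈ t)
        in-Z : ∀ {t} → edge t ⊆ W → (lookup W (Z t) ∧ PZ (Z t)) ≡ true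
        in-Z {t} t⊆ = ∧-true (∈⇒lookup (t⊆ (Z∈edge t))) (Z∈ t)
        in-W : (Fin n → Bool) → Fin n → Bool
        in-W Q v = lookup W v ∧ Q v
        distinct : ∀ Q (V : Fin k → Fin n) → in-W Q (V i) ≡ true → in-W Q (V j) ≡ true → in-W Q (V l) ≡ true →
                   V i ≢ V j → V i ≢ V l → V j ≢ V l → 3 ≤ part Q
        distinct Q V i∈ j∈ l∈ a b c = ∑-three (in-W Q) (V i) (V j) (V l) a b c i∈ j∈ l∈
        two-x : 2 ≤ part PX
        two-x = [ (λ (ij , il) → contradiction (+-mono-≤ (∑-one (in-W PX) (X i) (in-X i⊆)) (+-mono-≤
          (distinct PY Y (in-Y i⊆) (in-Y j⊆) (in-Y l⊆) (i≢j ∘ xy i j ij) (i≢l ∘ xy i l il) (j≢l ∘ xy j l (trans (sym ij) il)))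
          (distinct PZ Z (in-Z i⊆) (in-Z j⊆) (in-Z l⊆) (i≢j ∘ xz i j ij) (i≢l ∘ xz i l il) (j≢l ∘ xz j l (trans (sym ij) il)))))
          (<⇒≱ (s≤s parts≤6))) , id ]′ (two-values (in-W PX) (X i) (X j) (X l) (in-X i⊆) (in-X j⊆) (in-X l⊆))
        two-y : 2 ≤ part PY
        two-y = [ (λ (ij , il) → contradiction (+-mono-≤
          (distinct PX X (in-X i⊆) (in-X j⊆) (in-X l⊆) (λ e → i≢j (xy i j e ij)) (λ e → i≢l (xy i l e il)) (λ e → j≢l (xy j l e (trans (sym ij) il))))
          (+-mono-≤ (∑-one (in-W PY) (Y i) (in-Y i⊆))
          (distinct PZ Z (in-Z i⊆) (in-Z j⊆) (in-Z l⊆) (i≢j ∘ yz i j ij) (i≢l ∘ yz i l il) (j≢l ∘ yz j l (trans (sym ij) il)))))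
          (<⇒≱ (s≤s parts≤6))) , id ]′ (two-values (in-W PY) (Y i) (Y j) (Y l) (in-Y i⊆) (in-Y j⊆) (in-Y l⊆))
        two-z : 2 ≤ part PZ
        two-z = [ (λ (ij , il) → contradiction (+-mono-≤
          (distinct PX X (in-X i⊆) (in-X j⊆) (in-X l⊆) (λ e → i≢j (xz i j e ij)) (λ e → i≢l (xz i l e il)) (λ e → j≢l (xz j l e (trans (sym ij) il))))
          (+-mono-≤
          (distinct PY Y (in-Y i⊆) (in-Y j⊆) (in-Y l⊆) (λ e → i≢j (yz i j e ij)) (λ e → i≢l (yz i l e il)) (λ e → j≢l (yz j l e (trans (sym ij) il))))
          (∑-one (in-W PZ) (Z i) (in-Z i⊆))))
          (<⇒≱ (s≤s parts≤6))) , id ]′ (two-values (in-W PZ) (Z i) (Z j) (Z l) (in-Z i⊆) (in-Z j⊆) (in-Z l⊆))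
        Pair : (Fin k → Fin n) → Set
        Pair V = V i ≡ V j ⊎ V i ≡ V l ⊎ V j ≡ V l
        pair : ∀ Q (V : Fin k → Fin n) → in-W Q (V i) ≡ true → in-W Q (V j) ≡ true → in-W Q (V l) ≡ true →
               ¬ 3 ≤ part Q → Pair V
        pair Q V i∈ j∈ l∈ ¬3≤ = [ id , (λ 3≤ → contradiction 3≤ ¬3≤) ]′ (coincidence (in-W Q) (V i) (V j) (V l) i∈ j∈ l∈)
        -- Each pair of the three edges meets in one part only, so the parts pick different pairs.
        triangle : Pair X → Pair Y → ¬ Pair Z
        triangle (inj₁ x)        (inj₁ y)        _               = i≢j (xy i j x y)
        triangle (inj₂ (inj₁ x)) (inj₂ (inj₁ y)) _               = i≢l (xy i l x y)
        triangle (inj₂ (inj₂ x)) (inj₂ (inj₂ y)) _               = j≢l (xy j l x y)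
        triangle (inj₁ x)        _               (inj₁ z)        = i≢j (xz i j x z)
        triangle (inj₂ (inj₁ x)) _               (inj₂ (inj₁ z)) = i≢l (xz i l x z)
        triangle (inj₂ (inj₂ x)) _               (inj₂ (inj₂ z)) = j≢l (xz j l x z)
        triangle _               (inj₁ y)        (inj₁ z)        = i≢j (yz i j y z)
        triangle _               (inj₂ (inj₁ y)) (inj₂ (inj₁ z)) = i≢l (yz i l y z)
        triangle _               (inj₂ (inj₂ y)) (inj₂ (inj₂ z)) = j≢l (yz j l y z)
        triangle (inj₁ x)        (inj₂ (inj₁ y)) (inj₂ (inj₂ z)) = no-triangle i j l i≢j i≢l j≢l x y z
        triangle (inj₁ x)        (inj₂ (inj₂ y)) (inj₂ (inj₁ z)) = no-triangle j i l (≢-sym i≢j) j≢l i≢l (sym x) y z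
        triangle (inj₂ (inj₁ x)) (inj₁ y)        (inj₂ (inj₂ z)) = no-triangle i l j i≢l i≢j (≢-sym j≢l) x y (sym z)
        triangle (inj₂ (inj₁ x)) (inj₂ (inj₂ y)) (inj₁ z)        = no-triangle l i j (≢-sym i≢l) (≢-sym j≢l) i≢j (sym x) (sym y) z
        triangle (inj₂ (inj₂ x)) (inj₁ y)        (inj₂ (inj₁ z)) = no-triangle j l i j≢l (≢-sym i≢j) (≢-sym i≢l) x (sym y) (sym z)
        triangle (inj₂ (inj₂ x)) (inj₂ (inj₁ y)) (inj₁ z)        = no-triangle l j i (≢-sym j≢l) (≢-sym i≢l) (≢-sym i≢j) (sym x) (sym y) (sym z)

    hypergraph : Vec (Subset n) k
    hypergraph = tabulate edge

    uniform : IsUniform 3 hypergraph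
    uniform = Unique.tabulate⁺ edge-injective , All.tabulate⁺ edge-size

    sparse : IsSparse 6 3 hypergraph
    sparse W ∣W∣≡6 = ≰⇒> λ 3≤ →
      let i , j , l , (i≢j , i≢l , j≢l) , (i⊆ , j⊆ , l⊆) =
            three-indices (λ t → does (edge t ⊆? W)) (≤-trans 3≤ (≤-reflexive (trans (count-∑ (_⊆? W) hypergraph)
              (∑-cong λ t → cong (λ e → χ (does (e ⊆? W))) (lookup∘tabulate edge t)))))
      in no-three-edges W ∣W∣≡6 i j l i≢j i≢l j≢l
           (does-sound (edge i ⊆? W) i⊆) (does-sound (edge j ⊆? W) j⊆) (does-sound (edge l ⊆? W) l⊆)

    k≤f : k ≤ f 3 n 6 3
    k≤f = proj₂ (proj₂ (f-maximum 3 n 6 3)) (hypergraph , uniform , sparse)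

  module _ {k n} {X Y Z : Fin k → Fin n} (linear : Linear X Y Z) where

    private
      cut₁ : (Fin n → Bool) → Fin k → Bool
      cut₁ A t = A (X t) ∧ not (A (Y t))

      cut₂ : (Fin n → Bool) → (Fin n → Bool) → Fin k → Bool
      cut₂ A B t = cut₁ A t ∧ (B (X t) ∧ not (B (Z t)))

      cut₃ : (Fin n → Bool) → (Fin n → Bool) → (Fin n → Bool) → Fin k → Bool
      cut₃ A B C t = cut₂ A B t ∧ (C (Y t) ∧ not (C (Z t)))

    module _ (A B C : Fin n → Bool) where

      private
        ι = proj₁ (select (cut₃ A B C))
        ι-injective = proj₁ (proj₂ (select (cut₃ A B C)))
        open Linear linear

        is-cut₃ : ∀ t → cut₃ A B C (ι t) ≡ true
        is-cut₃ = proj₂ (proj₂ (select (cut₃ A B C)))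

        is-cut₂ : ∀ t → cut₂ A B (ι t) ≡ true
        is-cut₂ t = ∧-trueˡ (is-cut₃ t)

        is-cut₁ : ∀ t → cut₁ A (ι t) ≡ true
        is-cut₁ t = ∧-trueˡ (is-cut₂ t)

        sub : Linear (X ∘ ι) (Y ∘ ι) (Z ∘ ι)
        sub = record
          { xy = λ s t e e′ → ι-injective s t (xy _ _ e e′)
          ; xz = λ s t e e′ → ι-injective s t (xz _ _ e e′)
          ; yz = λ s t e e′ → ι-injective s t (yz _ _ e e′)
          ; no-triangle = λ r s t r≢s r≢t s≢t →
              no-triangle _ _ _ (r≢s ∘ ι-injective r s) (r≢t ∘ ι-injective r t) (s≢t ∘ ι-injective s t)
          }

        disjoint : ∀ a b c → χ (a ∧ b) + (χ (not a ∧ c) + χ (not b ∧ not c)) ≤ 1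
        disjoint true  true  c     = ≤-refl
        disjoint true  false true  = z≤n
        disjoint true  false false = ≤-refl
        disjoint false true  true  = ≤-refl
        disjoint false true  false = z≤n
        disjoint false false true  = ≤-refl
        disjoint false false false = ≤-refl

      -- The cut `A` separates first from second vertices, `B` first from third and `C` second from
      -- third. Each vertex role is put on its side of the two cuts that concern it, which makes the
      -- three parts disjoint.
      parts≤f : ∑ (χ ∘ cut₃ A B C) ≤ f 3 n 6 3
      parts≤f = Partite.k≤f sub (λ v → A v ∧ B v) (λ v → not (A v) ∧ C v) (λ v → not (B v) ∧ not (C v))
        (λ v → disjoint (A v) (B v) (C v))
        (λ t → ∧-true (∧-trueˡ {A (X (ι t))} (is-cut₁ t)) (∧-trueˡ {B (X (ι t))} (∧-trueʳ {cut₁ A (ι t)} (is-cut₂ t))))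
        (λ t → ∧-true (∧-trueʳ {A (X (ι t))} (is-cut₁ t)) (∧-trueˡ {C (Y (ι t))} (∧-trueʳ {cut₂ A B (ι t)} (is-cut₃ t))))
        (λ t → ∧-true (∧-trueʳ {B (X (ι t))} (∧-trueʳ {cut₁ A (ι t)} (is-cut₂ t)))
                      (∧-trueʳ {C (Y (ι t))} (∧-trueʳ {cut₂ A B (ι t)} (is-cut₃ t))))

    linear≤64f : (∀ t → X t ≢ Y t) → (∀ t → X t ≢ Z t) → (∀ t → Y t ≢ Z t) → k ≤ 64 * f 3 n 6 3
    linear≤64f X≢Y X≢Z Y≢Z =
      cut-A (directed-cut (λ _ → true) X Y X≢Y)
      where
      open ≤-Reasoning
      lemma : ∀ x → 4 * (4 * (4 * x)) ≡ 64 * x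
      lemma = solve-∀
      module _ (A : Fin n → Bool) (A-large : ∑ {k} (λ _ → 1) ≤ 4 * ∑ (χ ∘ cut₁ A)) where
        module _ (B : Fin n → Bool)
                 (B-large : ∑ (χ ∘ cut₁ A) ≤ 4 * ∑ (χ ∘ cut₂ A B)) where
          cut-C : (∃ λ C → ∑ (χ ∘ cut₂ A B) ≤ 4 * ∑ (χ ∘ cut₃ A B C)) → k ≤ 64 * f 3 n 6 3
          cut-C (C , C-large) = begin
            k  ≡⟨ trans (∑-const k 1) (*-identityʳ k) ⟨
            ∑ {k} (λ _ → 1)  ≤⟨ A-large ⟩
            4 * ∑ (χ ∘ cut₁ A)  ≤⟨ *-monoʳ-≤ 4 B-large ⟩
            4 * (4 * ∑ (χ ∘ cut₂ A B)) ≤⟨ *-monoʳ-≤ 4 (*-monoʳ-≤ 4 C-large) ⟩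
            4 * (4 * (4 * ∑ (χ ∘ cut₃ A B C)))  ≤⟨ *-monoʳ-≤ 4 (*-monoʳ-≤ 4 (*-monoʳ-≤ 4 (parts≤f A B C))) ⟩
            4 * (4 * (4 * f 3 n 6 3))  ≡⟨ lemma (f 3 n 6 3) ⟩
            64 * f 3 n 6 3  ∎
        cut-B : (∃ λ B → ∑ (χ ∘ cut₁ A) ≤ 4 * ∑ (χ ∘ cut₂ A B)) → k ≤ 64 * f 3 n 6 3
        cut-B (B , B-large) = cut-C B B-large (directed-cut (cut₂ A B) Y Z Y≢Z)
      cut-A : (∃ λ A → ∑ {k} (λ _ → 1) ≤ 4 * ∑ (χ ∘ cut₁ A)) → k ≤ 64 * f 3 n 6 3
      cut-A (A , A-large) = cut-B A A-large (directed-cut (cut₁ A) X Z X≢Z)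

  -- A linear lower bound for the extremal function.

  triples : ∀ k r → Vec (Subset (k * 3 + r)) k
  triples zero    r = []
  triples (suc k) r = (inside ∷ inside ∷ inside ∷ ∅) ∷ map (λ e → outside ∷ outside ∷ outside ∷ e) (triples k r)

  triples-uniform : ∀ k r → IsUniform 3 (triples k r)
  triples-uniform k r = unique k , size k
    where
    unique : ∀ k → Unique (triples k r)
    unique zero    = []
    unique (suc k) = All.map⁺ (All.universal (λ _ ()) (triples k r)) ∷
      Unique.map⁺ (∷-injectiveʳ ∘ ∷-injectiveʳ ∘ ∷-injectiveʳ) (unique k)
    size : ∀ k → All (λ e → ∣ e ∣ ≡ 3) (triples k r)
    size zero    = []
    size (suc k) = cong (3 +_) (Subset.∣⊥∣≡0 (k * 3 + r)) ∷ All.map⁺ (size k)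

  count-map : ∀ {A B : Set} {P : B → Set} {Q : A → Set} (P? : ∀ b → Dec (P b)) (Q? : ∀ a → Dec (Q a)) (g : A → B) →
              (∀ {a} → P (g a) → Q a) → ∀ {n} (xs : Vec A n) → count P? (map g xs) ≤ count Q? xs
  count-map P? Q? g P⇒Q []       = z≤n
  count-map P? Q? g P⇒Q (x ∷ xs) with P? (g x) | Q? x
  ... | yes p | yes _ = s≤s (count-map P? Q? g P⇒Q xs)
  ... | yes p | no ¬q = contradiction (P⇒Q p) ¬q
  ... | no _  | yes _ = m≤n⇒m≤1+n (count-map P? Q? g P⇒Q xs)
  ... | no _  | no _  = count-map P? Q? g P⇒Q xs

  triples-count : ∀ k r W → count (_⊆? W) (triples k r) * 3 ≤ ∣ W ∣
  triples-count zero    r W = z≤n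
  triples-count (suc k) r W@(a ∷ b ∷ c ∷ W′) with (inside ∷ inside ∷ inside ∷ ∅) ⊆? W
  ... | no _ = begin
    count (_⊆? W) (map (λ e → outside ∷ outside ∷ outside ∷ e) (triples k r)) * 3
      ≤⟨ *-monoˡ-≤ 3 (count-map (_⊆? W) (_⊆? W′) _ (Subset.drop-∷-⊆ ∘ Subset.drop-∷-⊆ ∘ Subset.drop-∷-⊆) (triples k r)) ⟩
    count (_⊆? W′) (triples k r) * 3  ≤⟨ triples-count k r W′ ⟩
    ∣ W′ ∣  ≤⟨ Subset.∣p∣≤∣x∷p∣ c W′ ⟩
    ∣ c ∷ W′ ∣  ≤⟨ Subset.∣p∣≤∣x∷p∣ b (c ∷ W′) ⟩
    ∣ b ∷ c ∷ W′ ∣  ≤⟨ Subset.∣p∣≤∣x∷p∣ a (b ∷ c ∷ W′) ⟩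
    ∣ W ∣  ∎
    where open ≤-Reasoning
  ... | yes ⊆W with refl ← ∈⇒lookup (⊆W here) | refl ← ∈⇒lookup (⊆W (there here)) | refl ← ∈⇒lookup (⊆W (there (there here))) =
    +-monoʳ-≤ 3 (≤-trans
      (*-monoˡ-≤ 3 (count-map (_⊆? W) (_⊆? W′) _ (Subset.drop-∷-⊆ ∘ Subset.drop-∷-⊆ ∘ Subset.drop-∷-⊆) (triples k r)))
      (triples-count k r W′))

  k≤f[k*3+r] : ∀ k r → k ≤ f 3 (k * 3 + r) 6 3
  k≤f[k*3+r] k r = proj₂ (proj₂ (f-maximum 3 (k * 3 + r) 6 3)) (triples k r , triples-uniform k r ,
    λ W ∣W∣≡6 → s≤s (*-cancelʳ-≤ (count (_⊆? W) (triples k r)) 2 3 (≤-trans (triples-count k r W) (≤-reflexive ∣W∣≡6))))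

  -- Disjoint triples are sparse, since six vertices contain at most two of them. The bound serves
  -- to absorb the quadratic terms of the NRD count into `n * f 3 n 6 3`; the remainder `r ≤ 2` is
  -- covered by `k ≥ 2`.
  n≤4f : ∀ n → 6 ≤ n → n ≤ 4 * f 3 n 6 3
  n≤4f n 6≤n = begin
    n  ≡⟨ n≡ ⟩
    k * 3 + r  ≤⟨ +-monoʳ-≤ (k * 3) (≤-trans (s≤s⁻¹ (m%n<n n 3)) 2≤k) ⟩
    k * 3 + k  ≡⟨ lemma k ⟩
    4 * k  ≤⟨ *-monoʳ-≤ 4 (subst (λ n → k ≤ f 3 n 6 3) (sym n≡) (k≤f[k*3+r] k r)) ⟩
    4 * f 3 n 6 3  ∎
    where
    open ≤-Reasoning
    k = n / 3
    r = n % 3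
    n≡ : n ≡ k * 3 + r
    n≡ = trans (m≡m%n+[m/n]*n n 3) (+-comm r (k * 3))
    2≤k : 2 ≤ k
    2≤k = *-cancelʳ-< 3 1 k (+-cancelʳ-< 2 3 (k * 3) (≤-trans 6≤n (≤-trans (≤-reflexive n≡) (+-monoʳ-≤ (k * 3) (s≤s⁻¹ (m%n<n n 3))))))
    lemma : ∀ k → k * 3 + k ≡ 4 * k
    lemma = solve-∀

  -- Non-redundant instances of R

  inR : Sign → Sign → Sign → Sign → Bool
  inR a b c d = does (DecMembership._∈?_ Defs._≟_ (a ∷ b ∷ c ∷ d ∷ []) R)

  every : (Sign → Bool) → Bool
  every p = p ⊖ ∧ (p 𝟎 ∧ p ⊕)

  every-sound : ∀ p → every p ≡ true → ∀ a → p a ≡ true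
  every-sound p e ⊖ = ∧-trueˡ e
  every-sound p e 𝟎 = ∧-trueˡ (∧-trueʳ {p ⊖} e)
  every-sound p e ⊕ = ∧-trueʳ {p 𝟎} (∧-trueʳ {p ⊖} e)

  -- Turns a claim about all 81 sign tuples into one Boolean equation, so that the facts about `R`
  -- below hold by evaluation.
  every⁴ : (p : Sign → Sign → Sign → Sign → Bool) →
           every (λ a → every λ b → every λ c → every λ d → p a b c d) ≡ true → ∀ a b c d → p a b c d ≡ true
  every⁴ p e a b c d = every-sound (p a b c) (every-sound (λ c → every (p a b c))
    (every-sound (λ b → every λ c → every (p a b c)) (every-sound (λ a → every λ b → every λ c → every (p a b c)) e a) b) c) d

  infixr 4 _⇒_
  _⇒_ : Bool → Bool → Bool
  true  ⇒ b = b
  false ⇒ b = true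

  ⇒-elim : ∀ {a b} → (a ⇒ b) ≡ true → a ≡ true → b ≡ true
  ⇒-elim e refl = e

  is⊖ is𝟎 is⊕ : Sign → Bool
  is⊖ ⊖ = true
  is⊖ _ = false
  is𝟎 𝟎 = true
  is𝟎 _ = false
  is⊕ ⊕ = true
  is⊕ _ = false

  same : Sign → Sign → Bool
  same ⊖ b = is⊖ b
  same 𝟎 b = is𝟎 b
  same ⊕ b = is⊕ b

  same-sound : ∀ a b → same a b ≡ true → a ≡ b
  same-sound ⊖ ⊖ _ = refl
  same-sound 𝟎 𝟎 _ = refl
  same-sound ⊕ ⊕ _ = refl

  same-refl : ∀ a → same a a ≡ true
  same-refl ⊖ = refl
  same-refl 𝟎 = refl
  same-refl ⊕ = refl

  -- the projections of R to pairs of its first three coordinates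
  R-xy R-xz R-yz : Sign → Sign → Bool
  R-xy a b = is⊖ a ∨ (is𝟎 a ∧ not (is⊕ b))
  R-xz a c = is⊖ a ∨ (is𝟎 a ∧ not (is⊕ c))
  R-yz b c = is⊖ c ∨ (is⊕ b ∨ (is𝟎 b ∧ is𝟎 c))

  all-𝟎 : Sign → Sign → Sign → Sign → Bool
  all-𝟎 a b c d = is𝟎 d ∧ (is𝟎 a ∧ (is𝟎 b ∧ is𝟎 c))

  unequal : Sign → Sign → Sign → Bool
  unequal a b c = is𝟎 b ∧ not (same a c)

  -- For 𝟎 in the middle the pairs allowed by the three binary projections are
  -- cut down to equality of the outer entries.
  R-or-violation : ∀ a b c d → inR a b c d ∨ (is⊖ d ∨ (not (R-xy a b) ∨ (not (R-xz a c) ∨ (not (R-yz b c) ∨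
                   (unequal a b c ∨ all-𝟎 a b c d))))) ≡ true
  R-or-violation = every⁴ (λ a b c d → inR a b c d ∨ (is⊖ d ∨ (not (R-xy a b) ∨ (not (R-xz a c) ∨ (not (R-yz b c) ∨
                   (unequal a b c ∨ all-𝟎 a b c d)))))) refl

  R⇒ : ∀ (p : Sign → Sign → Sign → Sign → Bool) →
       every (λ a → every λ b → every λ c → every λ d → inR a b c d ⇒ p a b c d) ≡ true →
       ∀ {a b c d} → inR a b c d ≡ true → p a b c d ≡ true
  R⇒ p e {a} {b} {c} {d} = ⇒-elim (every⁴ (λ a b c d → inR a b c d ⇒ p a b c d) e a b c d)

  record Witnesses {m n} (X Y Z W : Fin m → Fin n) : Set where
    field
      ψ     : Fin m → Fin n → Sign
      unsat : ∀ i → inR (ψ i (X i)) (ψ i (Y i)) (ψ i (Z i)) (ψ i (W i)) ≡ false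
      sat   : ∀ i j → j ≢ i → inR (ψ i (X j)) (ψ i (Y j)) (ψ i (Z j)) (ψ i (W j)) ≡ true

  nonredundant-witnesses : ∀ {n m} (I : Instance n 4 m) → NonRedundant R I →
    let at : Fin 4 → Fin m → Fin n
        at c i = lookup (lookup I i) c
    in Witnesses (at 0F) (at 1F) (at 2F) (at 3F)
  nonredundant-witnesses {n} {m} I nr = record
    { ψ = λ i v → lookup (proj₁ (nr i)) v
    ; unsat = λ i → trans (evaluate (proj₁ (nr i)) (lookup I i)) (dec-false (satisfies? R (proj₁ (nr i)) (lookup I i)) (proj₁ (proj₂ (nr i))))
    ; sat = λ i j j≢i → trans (evaluate (proj₁ (nr i)) (lookup I j)) (dec-true (satisfies? R (proj₁ (nr i)) (lookup I j)) (proj₂ (proj₂ (nr i)) j j≢i))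
    }
    where
    evaluate : ∀ (φ : Vec Sign n) (S : Vec (Fin n) 4) →
      inR (lookup φ (lookup S 0F)) (lookup φ (lookup S 1F)) (lookup φ (lookup S 2F)) (lookup φ (lookup S 3F)) ≡
      does (satisfies? R φ S)
    evaluate φ (a ∷ b ∷ c ∷ d ∷ []) = refl

  module Classification {m n : ℕ} {X Y Z W : Fin m → Fin n} (witnesses : Witnesses X Y Z W) where
    open Witnesses witnesses

    private
      a b c d : Fin m → Fin m → Sign
      a i j = ψ i (X j)
      b i j = ψ i (Y j)
      c i j = ψ i (Z j)
      d i j = ψ i (W j)

      sat⇒ : (p : Sign → Sign → Sign → Sign → Bool) →
             every (λ a → every λ b → every λ c → every λ d → inR a b c d ⇒ p a b c d) ≡ true →
             ∀ i j → j ≢ i → p (a i j) (b i j) (c i j) (d i j) ≡ true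
      sat⇒ p e i j j≢i = R⇒ p e (sat i j j≢i)

      v₁ v₂ v₃ v₄ v₅ v₆ : Fin m → Bool
      v₁ i = is⊖ (d i i)
      v₂ i = not (R-xy (a i i) (b i i))
      v₃ i = not (R-xz (a i i) (c i i))
      v₄ i = not (R-yz (b i i) (c i i))
      v₅ i = unequal (a i i) (b i i) (c i i)
      v₆ i = all-𝟎 (a i i) (b i i) (c i i) (d i i)

      true≢false : ∀ {b} → b ≡ true → b ≢ false
      true≢false refl ()

    count₁ : ∑ (χ ∘ v₁) ≤ n
    count₁ = ∑-separated v₁ W λ i j vi Wi≡Wj j≢i →
      true≢false (sat⇒ (λ a b c d → not (is⊖ d)) refl i j j≢i)
        (cong not (subst (λ w → is⊖ (ψ i w) ≡ true) Wi≡Wj vi))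

    private
      -- If two constraints agreed in both coordinates, the witness that violates the projection at
      -- one would violate it at the other, which it has to satisfy.
      count-pair : ∀ (V V′ : Fin m → Fin n) (r : Sign → Sign → Bool) →
                   (∀ i j → j ≢ i → r (ψ i (V j)) (ψ i (V′ j)) ≡ true) →
                   ∑ (λ i → χ (not (r (ψ i (V i)) (ψ i (V′ i))))) ≤ n * n
      count-pair V V′ r ok = ∑-separated (λ i → not (r (ψ i (V i)) (ψ i (V′ i)))) (λ i → combine (V i) (V′ i)) λ i j vi eq j≢i →
        true≢false (ok i j j≢i) (subst₂ (λ v v′ → r (ψ i v) (ψ i v′) ≡ false)
          (Fin.combine-injectiveˡ (V i) (V′ i) (V j) (V′ j) eq) (Fin.combine-injectiveʳ (V i) (V′ i) (V j) (V′ j) eq) (not-true vi))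

    count₂ : ∑ (χ ∘ v₂) ≤ n * n
    count₂ = count-pair X Y R-xy (sat⇒ (λ a b c d → R-xy a b) refl)

    count₃ : ∑ (χ ∘ v₃) ≤ n * n
    count₃ = count-pair X Z R-xz (sat⇒ (λ a b c d → R-xz a c) refl)

    count₄ : ∑ (χ ∘ v₄) ≤ n * n
    count₄ = count-pair Y Z R-yz (sat⇒ (λ a b c d → R-yz b c) refl)

    -- The only tuples of `R` with 𝟎 in the middle begin with `(⊖,𝟎,⊖)` or `(𝟎,𝟎,𝟎)`. Among
    -- constraints with a fixed second variable, a witness therefore gives equal signs to the outer
    -- variables of every constraint but its own, as `forest` requires.
    count₅ : ∑ (χ ∘ v₅) ≤ n * n
    count₅ = ∑-fibrewise v₅ Y λ v →
      let p = λ i → (Y i == v) ∧ v₅ i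
          ι , ι-injective , p∘ι = select p
          at-v : ∀ s → Y (ι s) ≡ v
          at-v s = ==-sound (∧-trueˡ (p∘ι s))
          violated : ∀ s → v₅ (ι s) ≡ true
          violated s = ∧-trueʳ {Y (ι s) == v} (p∘ι s)
      in forest (X ∘ ι) (Z ∘ ι) (λ s → ψ (ι s))
        (λ s eq → true≢false (trans (cong (same (a (ι s) (ι s))) (sym eq)) (same-refl (a (ι s) (ι s))))
          (not-true (∧-trueʳ {is𝟎 (b (ι s) (ι s))} (violated s))))
        (λ s t t≢s → same-sound _ _ (⇒-elim
          (sat⇒ (λ a b c d → is𝟎 b ⇒ same a c) refl (ι s) (ι t) (t≢s ∘ ι-injective t s))
          (subst (λ w → is𝟎 (ψ (ι s) w) ≡ true) (trans (at-v s) (sym (at-v t))) (∧-trueˡ (violated s)))))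

    module Fibre {k : ℕ} (w : Fin n) (ι : Fin k → Fin m) (ι-injective : ∀ s t → ι s ≡ ι t → s ≡ t)
                 (at-w : ∀ s → W (ι s) ≡ w) (all-zero : ∀ s → v₆ (ι s) ≡ true) where

      private
        x y z : Fin k → Fin n
        x = X ∘ ι
        y = Y ∘ ι
        z = Z ∘ ι

        x-𝟎 : ∀ s {v} → x s ≡ v → is𝟎 (ψ (ι s) v) ≡ true
        x-𝟎 s refl = ∧-trueˡ (∧-trueʳ {is𝟎 (d (ι s) (ι s))} (all-zero s))

        y-𝟎 : ∀ s {v} → y s ≡ v → is𝟎 (ψ (ι s) v) ≡ true
        y-𝟎 s refl = ∧-trueˡ (∧-trueʳ {is𝟎 (a (ι s) (ι s))} (∧-trueʳ {is𝟎 (d (ι s) (ι s))} (all-zero s)))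

        z-𝟎 : ∀ s {v} → z s ≡ v → is𝟎 (ψ (ι s) v) ≡ true
        z-𝟎 s refl = ∧-trueʳ {is𝟎 (b (ι s) (ι s))} (∧-trueʳ {is𝟎 (a (ι s) (ι s))} (∧-trueʳ {is𝟎 (d (ι s) (ι s))} (all-zero s)))

        fibre⇒ : (p : Sign → Sign → Sign → Bool) →
                 every (λ a → every λ b → every λ c → every λ d → inR a b c d ⇒ (is𝟎 d ⇒ p a b c)) ≡ true →
                 ∀ s t → t ≢ s → p (ψ (ι s) (x t)) (ψ (ι s) (y t)) (ψ (ι s) (z t)) ≡ true
        fibre⇒ p e s t t≢s = ⇒-elim (sat⇒ (λ a b c d → is𝟎 d ⇒ p a b c) e (ι s) (ι t) (t≢s ∘ ι-injective t s))
          (subst (λ v → is𝟎 (ψ (ι s) v) ≡ true) (trans (at-w s) (sym (at-w t))) (∧-trueˡ (all-zero s)))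

        equal : ∀ (s t : Fin k) → ¬ t ≢ s → s ≡ t
        equal s t ¬t≢s = decide (t Fin.≟ s)
          where
          decide : Dec (t ≡ s) → s ≡ t
          decide (yes eq) = sym eq
          decide (no ¬eq) = contradiction ¬eq ¬t≢s

      -- No triple of `P` has two entries 𝟎, so no other constraint shares two of the first three
      -- variables. In a triangle the witness of `s` would force ⊖ on the second variable of `r`,
      -- which shares its first variable, and ⊕ on that of `t`, which shares its third.
      linear : Linear x y z
      linear = record
        { xy = λ s t xs≡xt ys≡yt → equal s t λ t≢s →
            true≢false (fibre⇒ (λ a b c → not (is𝟎 a ∧ is𝟎 b)) refl s t t≢s) (cong not (∧-true (x-𝟎 s xs≡xt) (y-𝟎 s ys≡yt)))
        ; xz = λ s t xs≡xt zs≡zt → equal s t λ t≢s →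
            true≢false (fibre⇒ (λ a b c → not (is𝟎 a ∧ is𝟎 c)) refl s t t≢s) (cong not (∧-true (x-𝟎 s xs≡xt) (z-𝟎 s zs≡zt)))
        ; yz = λ s t ys≡yt zs≡zt → equal s t λ t≢s →
            true≢false (fibre⇒ (λ a b c → not (is𝟎 b ∧ is𝟎 c)) refl s t t≢s) (cong not (∧-true (y-𝟎 s ys≡yt) (z-𝟎 s zs≡zt)))
        ; no-triangle = λ r s t r≢s r≢t s≢t xr≡xs yr≡yt zs≡zt →
            let yr-⊖ = ⇒-elim (fibre⇒ (λ a b c → is𝟎 a ⇒ is⊖ b) refl s r r≢s) (x-𝟎 s (sym xr≡xs))
                yt-⊕ = ⇒-elim (fibre⇒ (λ a b c → is𝟎 c ⇒ is⊕ b) refl s t (≢-sym s≢t)) (z-𝟎 s zs≡zt)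
            in clash (ψ (ι s) (y r)) yr-⊖ (subst (λ v → is⊕ (ψ (ι s) v) ≡ true) (sym yr≡yt) yt-⊕)
        }
        where
        clash : ∀ e → is⊖ e ≡ true → ¬ is⊕ e ≡ true
        clash ⊖ _ ()

      open Linear linear

      degenerate : Fin k → Bool
      degenerate t = (x t == y t) ∨ ((x t == z t) ∨ (y t == z t))

      -- When two of the three variables coincide, that variable alone determines the constraint by
      -- linearity, so each of the three coincidences occurs at most `n` times. Such triples are set
      -- aside because they are no edges of a 3-uniform hypergraph.
      degenerate-few : ∑ (χ ∘ degenerate) ≤ n + (n + n)
      degenerate-few = begin
        ∑ (χ ∘ degenerate)
          ≤⟨ ∑-mono {k} (λ t → χ-∨³ (x t == y t) (x t == z t) (y t == z t)) ⟩
        ∑ (λ t → χ (x t == y t) + (χ (x t == z t) + χ (y t == z t)))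
          ≡⟨ ∑-+ (λ t → χ (x t == y t)) (λ t → χ (x t == z t) + χ (y t == z t)) ⟩
        ∑ (λ t → χ (x t == y t)) + ∑ (λ t → χ (x t == z t) + χ (y t == z t))
          ≡⟨ cong (∑ (λ t → χ (x t == y t)) +_) (∑-+ (λ t → χ (x t == z t)) (λ t → χ (y t == z t))) ⟩
        ∑ (λ t → χ (x t == y t)) + (∑ (λ t → χ (x t == z t)) + ∑ (λ t → χ (y t == z t)))
          ≤⟨ +-mono-≤
               (∑-injective {k} (λ t → x t == y t) x λ s t es et xs≡xt → xy s t xs≡xt (trans (sym (==-sound es)) (trans xs≡xt (==-sound et))))
               (+-mono-≤
               (∑-injective {k} (λ t → x t == z t) x λ s t es et xs≡xt → xz s t xs≡xt (trans (sym (==-sound es)) (trans xs≡xt (==-sound et))))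
               (∑-injective {k} (λ t → y t == z t) y λ s t es et ys≡yt → yz s t ys≡yt (trans (sym (==-sound es)) (trans ys≡yt (==-sound et))))) ⟩
        n + (n + n) ∎
        where
        open ≤-Reasoning
        χ-∨³ : ∀ a b c → χ (a ∨ (b ∨ c)) ≤ χ a + (χ b + χ c)
        χ-∨³ true  b     c = s≤s z≤n
        χ-∨³ false true  c = s≤s z≤n
        χ-∨³ false false c = ≤-refl

      proper-few : ∑ (λ t → χ (not (degenerate t))) ≤ 64 * f 3 n 6 3
      proper-few = linear≤64f sub
        (λ t eq → true≢false (∨-introˡ (==-complete eq)) (not-true (proper t)))
        (λ t eq → true≢false (∨-introʳ {x (κ t) == y (κ t)} (∨-introˡ (==-complete eq))) (not-true (proper t)))
        (λ t eq → true≢false (∨-introʳ {x (κ t) == y (κ t)} (∨-introʳ {x (κ t) == z (κ t)} (==-complete eq))) (not-true (proper t)))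
        where
        κ = proj₁ (select (not ∘ degenerate))
        κ-injective = proj₁ (proj₂ (select (not ∘ degenerate)))
        proper : ∀ t → not (degenerate (κ t)) ≡ true
        proper = proj₂ (proj₂ (select (not ∘ degenerate)))
        ∨-introˡ : ∀ {a b} → a ≡ true → a ∨ b ≡ true
        ∨-introˡ refl = refl
        ∨-introʳ : ∀ {a b} → b ≡ true → a ∨ b ≡ true
        ∨-introʳ {true}  _ = refl
        ∨-introʳ {false} e = e
        sub : Linear (x ∘ κ) (y ∘ κ) (z ∘ κ)
        sub = record
          { xy = λ s t e e′ → κ-injective s t (xy _ _ e e′)
          ; xz = λ s t e e′ → κ-injective s t (xz _ _ e e′)
          ; yz = λ s t e e′ → κ-injective s t (yz _ _ e e′)
          ; no-triangle = λ r s t r≢s r≢t s≢t →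
              no-triangle _ _ _ (r≢s ∘ κ-injective r s) (r≢t ∘ κ-injective r t) (s≢t ∘ κ-injective s t)
          }

      fibre-few : k ≤ n + (n + n) + 64 * f 3 n 6 3
      fibre-few = ≤-trans (≤-reflexive (trans (sym (trans (∑-const k 1) (*-identityʳ k)))
        (trans (∑-cong {k} λ t → sym (χ-not (degenerate t))) (∑-+ (χ ∘ degenerate) (λ t → χ (not (degenerate t)))))))
        (+-mono-≤ degenerate-few proper-few)

    count₆ : ∑ (χ ∘ v₆) ≤ n * (n + (n + n) + 64 * f 3 n 6 3)
    count₆ = ∑-fibrewise v₆ W λ w →
      let ι , ι-injective , p∘ι = select (λ i → (W i == w) ∧ v₆ i) in
      Fibre.fibre-few w ι ι-injective (λ s → ==-sound (∧-trueˡ (p∘ι s))) (λ s → ∧-trueʳ {W (ι s) == w} (p∘ι s))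

    -- Five counts of `n * n` and three degenerate ones make `8 * n * n`. With `n≤4f` the constant
    -- is `8 * 4 + 64 = 96`, the 64 being the loss of the three cuts.
    constraints-few : 6 ≤ n → m ≤ 96 * (n * f 3 n 6 3)
    constraints-few 6≤n = begin
      m
        ≡⟨ trans (∑-const m 1) (*-identityʳ m) ⟨
      ∑ {m} (λ _ → 1)
        ≤⟨ ∑-mono (λ i → union (v₁ i) (v₂ i) (v₃ i) (v₄ i) (v₅ i) (v₆ i)
             (trans (sym (cong (_∨ (v₁ i ∨ (v₂ i ∨ (v₃ i ∨ (v₄ i ∨ (v₅ i ∨ v₆ i)))))) (unsat i)))
               (R-or-violation (a i i) (b i i) (c i i) (d i i)))) ⟩
      ∑ (λ i → χ (v₁ i) + (χ (v₂ i) + (χ (v₃ i) + (χ (v₄ i) + (χ (v₅ i) + χ (v₆ i))))))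
        ≡⟨ trans (∑-+ (χ ∘ v₁) (λ i → χ (v₂ i) + (χ (v₃ i) + (χ (v₄ i) + (χ (v₅ i) + χ (v₆ i))))))
             (cong (∑ (χ ∘ v₁) +_) (trans (∑-+ (χ ∘ v₂) (λ i → χ (v₃ i) + (χ (v₄ i) + (χ (v₅ i) + χ (v₆ i)))))
             (cong (∑ (χ ∘ v₂) +_) (trans (∑-+ (χ ∘ v₃) (λ i → χ (v₄ i) + (χ (v₅ i) + χ (v₆ i))))
             (cong (∑ (χ ∘ v₃) +_) (trans (∑-+ (χ ∘ v₄) (λ i → χ (v₅ i) + χ (v₆ i)))
             (cong (∑ (χ ∘ v₄) +_) (∑-+ (χ ∘ v₅) (χ ∘ v₆))))))))) ⟩
      ∑ (χ ∘ v₁) + (∑ (χ ∘ v₂) + (∑ (χ ∘ v₃) + (∑ (χ ∘ v₄) + (∑ (χ ∘ v₅) + ∑ (χ ∘ v₆)))))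
        ≤⟨ +-mono-≤ (≤-trans count₁ n≤n²) (+-mono-≤ count₂ (+-mono-≤ count₃ (+-mono-≤ count₄ (+-mono-≤ count₅ count₆)))) ⟩
      n * n + (n * n + (n * n + (n * n + (n * n + n * (n + (n + n) + 64 * F)))))
        ≡⟨ lemma n F ⟩
      n * (8 * n + 64 * F)
        ≤⟨ *-monoʳ-≤ n (+-monoˡ-≤ (64 * F) (*-monoʳ-≤ 8 (n≤4f n 6≤n))) ⟩
      n * (8 * (4 * F) + 64 * F)
        ≡⟨ lemma′ n F ⟩
      96 * (n * F) ∎
      where
      open ≤-Reasoning
      F = f 3 n 6 3
      n≤n² : n ≤ n * n
      n≤n² = m≤m*n n n {{>-nonZero (≤-trans (s≤s z≤n) 6≤n)}}
      lemma : ∀ n F → n * n + (n * n + (n * n + (n * n + (n * n + n * (n + (n + n) + 64 * F))))) ≡ n * (8 * n + 64 * F)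
      lemma = solve-∀
      lemma′ : ∀ n F → n * (8 * (4 * F) + 64 * F) ≡ 96 * (n * F)
      lemma′ = solve-∀
      union : ∀ a b c d e g → a ∨ (b ∨ (c ∨ (d ∨ (e ∨ g)))) ≡ true → 1 ≤ χ a + (χ b + (χ c + (χ d + (χ e + χ g))))
      union true  _     _     _     _     _    _ = s≤s z≤n
      union false true  _     _     _     _    _ = s≤s z≤n
      union false false true  _     _     _    _ = s≤s z≤n
      union false false false true  _     _    _ = s≤s z≤n
      union false false false false true  _    _ = s≤s z≤n
      union false false false false false true _ = s≤s z≤n

  NRD≤96nf : ∀ n → 6 ≤ n → NRD R n ≤ 96 * (n * f 3 n 6 3)
  NRD≤96nf n 6≤n =
    let (I , nr) , _ = proj₂ (NRD-maximum R n)
    in Classification.constraints-few (nonredundant-witnesses I nr) 6≤n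

  -- Long chains

  satisfies : ∀ {n} (φ : Vec Sign n) {x y z w a b c d} →
              lookup φ x ≡ a → lookup φ y ≡ b → lookup φ z ≡ c → lookup φ w ≡ d →
              inR a b c d ≡ true → Satisfies R φ (x ∷ y ∷ z ∷ w ∷ [])
  satisfies φ {x} {y} {z} {w} refl refl refl refl e = does-sound (satisfies? R φ (x ∷ y ∷ z ∷ w ∷ [])) e

  falsifies : ∀ {n} (φ : Vec Sign n) {x y z w a b c d} →
              lookup φ x ≡ a → lookup φ y ≡ b → lookup φ z ≡ c → lookup φ w ≡ d →
              inR a b c d ≡ false → ¬ Satisfies R φ (x ∷ y ∷ z ∷ w ∷ [])
  falsifies φ {x} {y} {z} {w} refl refl refl refl e = does-complete (satisfies? R φ (x ∷ y ∷ z ∷ w ∷ [])) e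

  chain≤CL : ∀ {D : Set} {{_ : Finite D}} {r} (S : Relation D r) {n m} (I : Instance n r m) → ChainWitness S I → m ≤ CL S n
  chain≤CL S {n} I chain with CL-maximum S n
  ... | _ , _ , upper = upper (I , chain)

  lex-split : ∀ {k l} (i i′ : Fin k) (j j′ : Fin l) → combine i j Fin.< combine i′ j′ →
              i Fin.< i′ ⊎ (i ≡ i′ × j Fin.< j′)
  lex-split {k} {l} i i′ j j′ lt with Fin.<-cmp i i′
  ... | tri< i<i′ _ _ = inj₁ i<i′
  ... | tri> _ _ i′<i = contradiction (Fin.combine-monoˡ-< j′ j i′<i) (Fin.<-asym lt)
  ... | tri≈ _ refl _ = inj₂ (refl , +-cancelˡ-< (l * toℕ i) (toℕ j) (toℕ j′)
    (subst₂ _<_ (Fin.toℕ-combine i j) (Fin.toℕ-combine i j′) lt))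

  -- The chain runs through the constraints (x a , y b , z (a + b) , w d) in
  -- lexicographic order of (a , b , d).
  module Chain (k r : ℕ) where

    n : ℕ
    -- Disjoint blocks of variables for the first, second, third and last coordinate; the third has
    -- `2k` places for the sums. The `r` spare variables make every `n` attainable.
    n = k + (k + ((k + k) + (k + r)))

    vx vy vw : Fin k → Fin n
    vx a = a ↑ˡ (k + ((k + k) + (k + r)))
    vy b = k ↑ʳ (b ↑ˡ ((k + k) + (k + r)))
    vw d = k ↑ʳ (k ↑ʳ ((k + k) ↑ʳ (d ↑ˡ r)))

    vz : Fin (k + k) → Fin n
    vz c = k ↑ʳ (k ↑ʳ (c ↑ˡ (k + r)))

    plus : Fin k → Fin k → Fin (k + k)
    plus a b = fromℕ< (+-mono-< (Fin.toℕ<n a) (Fin.toℕ<n b))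

    constraint : Fin k → Fin k → Fin k → Vec (Fin n) 4
    constraint a b d = vx a ∷ vy b ∷ vz (plus a b) ∷ vw d ∷ []

    module Assignment (a b d : Fin k) where

      -- The order enters through `sy`. The sign ⊖ below `b` suits earlier constraints with the same
      -- `a`, the sign ⊕ above `b` those with the same sum and a smaller `a`.
      sx sy sw : Fin k → Sign
      sx a′ with a′ Fin.≟ a
      ... | yes _ = 𝟎
      ... | no _  = ⊖
      sy b′ with Fin.<-cmp b′ b
      ... | tri< _ _ _ = ⊖
      ... | tri≈ _ _ _ = 𝟎
      ... | tri> _ _ _ = ⊕
      sw d′ with d′ Fin.≟ d
      ... | yes _ = 𝟎
      ... | no _  = ⊕

      sz : Fin (k + k) → Sign
      sz c with c Fin.≟ plus a b
      ... | yes _ = 𝟎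
      ... | no _  = ⊖

      sign : Fin n → Sign
      sign v = [ sx , (λ v → [ sy , (λ v → [ sz , (λ v → [ sw , (λ _ → ⊖) ]′ (splitAt k v)) ]′ (splitAt (k + k) v)) ]′ (splitAt k v)) ]′ (splitAt k v)

      φ : Vec Sign n
      φ = tabulate sign

      φ-x : ∀ a′ → lookup φ (vx a′) ≡ sx a′
      φ-x a′ rewrite lookup∘tabulate sign (vx a′) | Fin.splitAt-↑ˡ k a′ (k + ((k + k) + (k + r))) = refl

      φ-y : ∀ b′ → lookup φ (vy b′) ≡ sy b′
      φ-y b′ rewrite lookup∘tabulate sign (vy b′) | Fin.splitAt-↑ʳ k (k + ((k + k) + (k + r))) (b′ ↑ˡ ((k + k) + (k + r)))
        | Fin.splitAt-↑ˡ k b′ ((k + k) + (k + r)) = refl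

      φ-z : ∀ c → lookup φ (vz c) ≡ sz c
      φ-z c rewrite lookup∘tabulate sign (vz c) | Fin.splitAt-↑ʳ k (k + ((k + k) + (k + r))) (k ↑ʳ (c ↑ˡ (k + r)))
        | Fin.splitAt-↑ʳ k ((k + k) + (k + r)) (c ↑ˡ (k + r)) | Fin.splitAt-↑ˡ (k + k) c (k + r) = refl

      φ-w : ∀ d′ → lookup φ (vw d′) ≡ sw d′
      φ-w d′ rewrite lookup∘tabulate sign (vw d′) | Fin.splitAt-↑ʳ k (k + ((k + k) + (k + r))) (k ↑ʳ ((k + k) ↑ʳ (d′ ↑ˡ r)))
        | Fin.splitAt-↑ʳ k ((k + k) + (k + r)) ((k + k) ↑ʳ (d′ ↑ˡ r)) | Fin.splitAt-↑ʳ (k + k) (k + r) (d′ ↑ˡ r)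
        | Fin.splitAt-↑ˡ k d′ r = refl

      plus-sum : ∀ a′ b′ → plus a′ b′ ≡ plus a b → toℕ a′ + toℕ b′ ≡ toℕ a + toℕ b
      plus-sum a′ b′ eq = trans (sym (Fin.toℕ-fromℕ< (+-mono-< (Fin.toℕ<n a′) (Fin.toℕ<n b′))))
        (trans (cong toℕ eq) (Fin.toℕ-fromℕ< (+-mono-< (Fin.toℕ<n a) (Fin.toℕ<n b))))

      sx-𝟎 : sx a ≡ 𝟎
      sx-𝟎 with a Fin.≟ a
      ... | yes _  = refl
      ... | no a≢a = contradiction refl a≢a

      sx-⊖ : ∀ {a′} → a′ ≢ a → sx a′ ≡ ⊖
      sx-⊖ {a′} a′≢a with a′ Fin.≟ a
      ... | yes a′≡a = contradiction a′≡a a′≢a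
      ... | no _     = refl

      sy-⊖ : ∀ {b′} → b′ Fin.< b → sy b′ ≡ ⊖
      sy-⊖ {b′} b′<b with Fin.<-cmp b′ b
      ... | tri< _ _ _     = refl
      ... | tri≈ ¬b′<b _ _ = contradiction b′<b ¬b′<b
      ... | tri> ¬b′<b _ _ = contradiction b′<b ¬b′<b

      sy-𝟎 : sy b ≡ 𝟎
      sy-𝟎 with Fin.<-cmp b b
      ... | tri≈ _ _ _   = refl
      ... | tri< _ b≢b _ = contradiction refl b≢b
      ... | tri> _ b≢b _ = contradiction refl b≢b

      sy-⊕ : ∀ {b′} → b Fin.< b′ → sy b′ ≡ ⊕
      sy-⊕ {b′} b<b′ with Fin.<-cmp b′ b
      ... | tri> _ _ _     = refl
      ... | tri< _ _ ¬b<b′ = contradiction b<b′ ¬b<b′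
      ... | tri≈ _ _ ¬b<b′ = contradiction b<b′ ¬b<b′

      sz-𝟎 : ∀ {c} → c ≡ plus a b → sz c ≡ 𝟎
      sz-𝟎 {c} eq with c Fin.≟ plus a b
      ... | yes _ = refl
      ... | no ≢  = contradiction eq ≢

      sz-⊖ : ∀ {c} → c ≢ plus a b → sz c ≡ ⊖
      sz-⊖ {c} ≢ with c Fin.≟ plus a b
      ... | yes eq = contradiction eq ≢
      ... | no _   = refl

      sw-𝟎 : sw d ≡ 𝟎
      sw-𝟎 with d Fin.≟ d
      ... | yes _  = refl
      ... | no d≢d = contradiction refl d≢d

      sw-⊕ : ∀ {d′} → d′ ≢ d → sw d′ ≡ ⊕
      sw-⊕ {d′} d′≢d with d′ Fin.≟ d
      ... | yes d′≡d = contradiction d′≡d d′≢d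
      ... | no _     = refl

      sw-≢⊖ : ∀ d′ → is⊖ (sw d′) ≡ false
      sw-≢⊖ d′ with d′ Fin.≟ d
      ... | yes _ = refl
      ... | no _  = refl

      violated : ¬ Satisfies R φ (constraint a b d)
      violated = falsifies φ (trans (φ-x a) sx-𝟎) (trans (φ-y b) sy-𝟎) (trans (φ-z (plus a b)) (sz-𝟎 refl)) (trans (φ-w d) sw-𝟎) refl

      -- With equal sums, `a′ < a` forces `b < b′` and the triple is `(⊖,⊕,𝟎)`. Otherwise the outer
      -- signs are ⊖, and `P` then allows any sign in the middle.
      earlier-a : ∀ a′ b′ d′ → a′ Fin.< a → Satisfies R φ (constraint a′ b′ d′)
      earlier-a a′ b′ d′ a′<a = decide (plus a′ b′ Fin.≟ plus a b)
        where
        b<b′ : plus a′ b′ ≡ plus a b → b Fin.< b′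
        b<b′ eq = ≰⇒> λ b′≤b → <⇒≢ (+-mono-<-≤ a′<a b′≤b) (plus-sum a′ b′ eq)
        R-⊖⊖ : ∀ y w → is⊖ w ≡ false → inR ⊖ y ⊖ w ≡ true
        R-⊖⊖ ⊖ 𝟎 _ = refl
        R-⊖⊖ ⊖ ⊕ _ = refl
        R-⊖⊖ 𝟎 𝟎 _ = refl
        R-⊖⊖ 𝟎 ⊕ _ = refl
        R-⊖⊖ ⊕ 𝟎 _ = refl
        R-⊖⊖ ⊕ ⊕ _ = refl
        R-⊖⊕𝟎 : ∀ w → is⊖ w ≡ false → inR ⊖ ⊕ 𝟎 w ≡ true
        R-⊖⊕𝟎 𝟎 _ = refl
        R-⊖⊕𝟎 ⊕ _ = refl
        decide : Dec (plus a′ b′ ≡ plus a b) → Satisfies R φ (constraint a′ b′ d′)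
        decide (no ≢)   = satisfies φ (trans (φ-x a′) (sx-⊖ (Fin.<⇒≢ a′<a))) (φ-y b′) (trans (φ-z (plus a′ b′)) (sz-⊖ ≢)) (φ-w d′)
          (R-⊖⊖ (sy b′) (sw d′) (sw-≢⊖ d′))
        decide (yes eq) = satisfies φ (trans (φ-x a′) (sx-⊖ (Fin.<⇒≢ a′<a))) (trans (φ-y b′) (sy-⊕ (b<b′ eq)))
          (trans (φ-z (plus a′ b′)) (sz-𝟎 eq)) (φ-w d′) (R-⊖⊕𝟎 (sw d′) (sw-≢⊖ d′))

      earlier-b : ∀ b′ d′ → b′ Fin.< b → Satisfies R φ (constraint a b′ d′)
      earlier-b b′ d′ b′<b = satisfies φ (trans (φ-x a) sx-𝟎) (trans (φ-y b′) (sy-⊖ b′<b))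
        (trans (φ-z (plus a b′)) (sz-⊖ λ eq → <⇒≢ (+-monoʳ-< (toℕ a) b′<b) (plus-sum a b′ eq))) (φ-w d′)
        (R-𝟎⊖⊖ (sw d′) (sw-≢⊖ d′))
        where
        R-𝟎⊖⊖ : ∀ w → is⊖ w ≡ false → inR 𝟎 ⊖ ⊖ w ≡ true
        R-𝟎⊖⊖ 𝟎 _ = refl
        R-𝟎⊖⊖ ⊕ _ = refl

      -- Here the extra triple of `Q` is used: the same `(𝟎,𝟎,𝟎)` that is violated with last sign 𝟎
      -- is satisfied with ⊕. It gains the third factor `k` in the length.
      earlier-d : ∀ d′ → d′ Fin.< d → Satisfies R φ (constraint a b d′)
      earlier-d d′ d′<d = satisfies φ (trans (φ-x a) sx-𝟎) (trans (φ-y b) sy-𝟎) (trans (φ-z (plus a b)) (sz-𝟎 refl))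
        (trans (φ-w d′) (sw-⊕ (Fin.<⇒≢ d′<d))) refl

      earlier : ∀ a′ b′ d′ → combine (combine a′ b′) d′ Fin.< combine (combine a b) d → Satisfies R φ (constraint a′ b′ d′)
      earlier a′ b′ d′ lt = by-ab (lex-split (combine a′ b′) (combine a b) d′ d lt)
        where
        by-a : a′ Fin.< a ⊎ (a′ ≡ a × b′ Fin.< b) → Satisfies R φ (constraint a′ b′ d′)
        by-a (inj₁ a′<a)          = earlier-a a′ b′ d′ a′<a
        by-a (inj₂ (refl , b′<b)) = earlier-b b′ d′ b′<b
        by-ab : combine a′ b′ Fin.< combine a b ⊎ (combine a′ b′ ≡ combine a b × d′ Fin.< d) → Satisfies R φ (constraint a′ b′ d′)
        by-ab (inj₁ ab′<ab)         = by-a (lex-split a′ a b′ b ab′<ab)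
        by-ab (inj₂ (ab′≡ab , d′<d)) = subst₂ (λ a b → Satisfies R φ (constraint a b d′))
          (sym (Fin.combine-injectiveˡ a′ b′ a b ab′≡ab)) (sym (Fin.combine-injectiveʳ a′ b′ a b ab′≡ab)) (earlier-d d′ d′<d)

    at : Fin (k * k * k) → Vec (Fin n) 4
    at i = let ab , d = remQuot {k * k} k i ; a , b = remQuot {k} k ab in constraint a b d

    chain : Instance n 4 (k * k * k)
    chain = tabulate at

    chain-witness : ChainWitness R chain
    chain-witness i = φ , ¬sat , sat
      where
      position : Fin (k * k * k) → Fin (k * k * k)
      position i = let ab , d = remQuot {k * k} k i ; a , b = remQuot {k} k ab in combine (combine a b) d
      position≡ : ∀ i → position i ≡ i
      position≡ i = trans (cong (λ ab → combine ab (proj₂ (remQuot {k * k} k i))) (Fin.combine-remQuot {k} k (proj₁ (remQuot {k * k} k i))))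
        (Fin.combine-remQuot {k * k} k i)
      ab = proj₁ (remQuot {k * k} k i)
      d = proj₂ (remQuot {k * k} k i)
      a = proj₁ (remQuot {k} k ab)
      b = proj₂ (remQuot {k} k ab)
      open Assignment a b d
      ¬sat : ¬ Satisfies R φ (lookup chain i)
      ¬sat = subst (λ S → ¬ Satisfies R φ S) (sym (lookup∘tabulate at i))
        violated
      sat : ∀ j → j Fin.< i → Satisfies R φ (lookup chain j)
      sat j j<i = subst (Satisfies R φ) (sym (lookup∘tabulate at j))
        (earlier a′ b′ d′ (subst₂ Fin._<_ (sym (position≡ j)) (sym (position≡ i)) j<i))
        where
        ab′ = proj₁ (remQuot {k * k} k j)
        d′ = proj₂ (remQuot {k * k} k j)
        a′ = proj₁ (remQuot {k} k ab′)
        b′ = proj₂ (remQuot {k} k ab′)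

  ChainOfLength : ℕ → ℕ → Set
  ChainOfLength n m = ∃ λ (I : Instance n 4 m) → ChainWitness R I

  length≤CL : ∀ {n m} → ChainOfLength n m → m ≤ CL R n
  length≤CL {n} {m} (I , chain) = chain≤CL {Sign} {{Sign-finite}} {4} R {n} {m} I chain

  -- Since `k ≥ 1`, the remainder is absorbed by `n ≤ 5 * k + 4 ≤ 9 * k`, and 729 is the cube of 9.
  cube-bound : ∀ n {l} → 5 ≤ n → (n / 5) * (n / 5) * (n / 5) ≤ l → n ^ 3 ≤ 729 * l
  cube-bound n {l} 5≤n k³≤l = begin
    n ^ 3  ≤⟨ ^-monoˡ-≤ 3 n≤9k ⟩
    (9 * k) ^ 3  ≡⟨ lemma 9 k ⟩
    729 * (k * k * k)  ≤⟨ *-monoʳ-≤ 729 k³≤l ⟩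
    729 * l  ∎
    where
    open ≤-Reasoning
    k = n / 5
    n≤5k+4 : n ≤ k * 5 + 4
    n≤5k+4 = ≤-trans (≤-reflexive (trans (m≡m%n+[m/n]*n n 5) (+-comm (n % 5) (k * 5))))
      (+-monoʳ-≤ (k * 5) (s≤s⁻¹ (m%n<n n 5)))
    1≤k : 1 ≤ k
    1≤k = *-cancelʳ-< 5 0 k (+-cancelʳ-< 4 0 (k * 5) (≤-trans 5≤n n≤5k+4))
    n≤9k : n ≤ 9 * k
    n≤9k = ≤-trans n≤5k+4 (≤-trans (+-monoʳ-≤ (k * 5) (*-monoʳ-≤ 4 1≤k)) (≤-reflexive (lemma′ k)))
      where
      lemma′ : ∀ k → k * 5 + 4 * k ≡ 9 * k
      lemma′ = solve-∀
    lemma : ∀ c k → c * k * (c * k * (c * k * 1)) ≡ c * c * c * (k * k * k)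
    lemma = solve-∀

  n³≤729CL : ∀ n → 5 ≤ n → n ^ 3 ≤ 729 * CL R n
  n³≤729CL n 5≤n = cube-bound n {CL {{Sign-finite}} R n} 5≤n (length≤CL {n} {k * k * k}
    (subst (λ n → ChainOfLength n (k * k * k)) (sym n≡) (Chain.chain k r , Chain.chain-witness k r)))
    where
    k = n / 5
    r = n % 5
    n≡ : n ≡ k + (k + ((k + k) + (k + r)))
    n≡ = trans (m≡m%n+[m/n]*n n 5) (lemma k r)
      where
      lemma : ∀ k r → r + k * 5 ≡ k + (k + ((k + k) + (k + r)))
      lemma = solve-∀

  -- From tower heights to the exponent of the saving.

  ^-*-distrib : ∀ a b k → (a * b) ^ k ≡ a ^ k * b ^ k
  ^-*-distrib a b zero    = refl
  ^-*-distrib a b (suc k) = trans (cong (a * b *_) (^-*-distrib a b k)) (lemma a b (a ^ k) (b ^ k))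
    where
    lemma : ∀ a b x y → a * b * (x * y) ≡ a * x * (b * y)
    lemma = solve-∀

  height : ℕ → ℕ
  height h = 10 + (suc (192 * suc h) * 8 + (10 + h))

  height-linear : ∃ λ A → ∃ λ B → 1 ≤ B × ∀ g → height (11 + g) ≤ A + B * g
  height-linear = height 11 , 192 * 8 + 1 , s≤s z≤n , λ g → ≤-reflexive (lemma 192 8 10 11 g)
    where
    lemma : ∀ a b c d g → c + (suc (a * suc (d + g)) * b + (c + (d + g))) ≡
            c + (suc (a * suc d) * b + (c + d)) + (a * b + 1) * g
    lemma = solve-∀

  -- `g` is the largest exponent whose threshold tower still lies below `n`. That it is positive
  -- lets the additive constants be absorbed into a multiple of `g`.
  greatest-multiple : ∀ A B l → 1 ≤ B → A + B < l → ∃ λ g → 1 ≤ g × A + B * g < l × l ≤ A + B * suc g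
  greatest-multiple A B l 1≤B A+B<l = search l (≤-trans l≤Bl (≤-trans (*-monoʳ-≤ B (n≤1+n l)) (m≤n+m (B * suc l) A)))
    where
    l≤Bl : l ≤ B * l
    l≤Bl = m≤n*m l B {{>-nonZero 1≤B}}
    search : ∀ j → l ≤ A + B * suc j → ∃ λ g → 1 ≤ g × A + B * g < l × l ≤ A + B * suc g
    search zero    l≤ = contradiction (≤-trans l≤ (≤-reflexive (cong (A +_) (*-identityʳ B)))) (<⇒≱ A+B<l)
    search (suc j) l≤ with A + B * suc j <? l
    ... | yes <l = suc j , s≤s z≤n , <l , l≤
    ... | no ≮l  = search j (≮⇒≥ ≮l)

  -- The constants to be paid are `c`, the 2 of `F ≤ 2 * m` and the 10 of `few-triangles`. With
  -- `c = 96` this is 1920, below `2 ^ 11`; so `h = 11 + g` leaves the saving `2 ^ g`.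
  scale-bound : ∀ K G c {n m F} .{{_ : NonZero K}} → c * 20 ≤ K → F ≤ 2 * m → K * G * m ≤ 10 * (n * n) →
                G * (c * (n * F)) ≤ n ^ 3
  scale-bound K G c {n} {m} {F} 20c≤K F≤2m few = *-cancelˡ-≤ K (begin
    K * (G * (c * (n * F)))  ≤⟨ *-monoʳ-≤ K (*-monoʳ-≤ G (*-monoʳ-≤ c (*-monoʳ-≤ n F≤2m))) ⟩
    K * (G * (c * (n * (2 * m))))  ≡⟨ lemma K G c n m ⟩
    c * n * 2 * (K * G * m)  ≤⟨ *-monoʳ-≤ (c * n * 2) few ⟩
    c * n * 2 * (10 * (n * n))  ≡⟨ lemma′ c n ⟩
    c * 20 * n ^ 3  ≤⟨ *-monoˡ-≤ (n ^ 3) 20c≤K ⟩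
    K * n ^ 3  ∎)
    where
    open ≤-Reasoning
    lemma : ∀ K G c n m → K * (G * (c * (n * (2 * m)))) ≡ c * n * 2 * (K * G * m)
    lemma = solve-∀
    lemma′ : ∀ c n → c * n * 2 * (10 * (n * n)) ≡ c * 20 * (n * (n * (n * 1)))
    lemma′ = solve-∀

  nf-small : ∀ n g → 6 ≤ n → tower (height (11 + g)) < n → 2 ^ g * (96 * (n * f 3 n 6 3)) ≤ n ^ 3
  nf-small n g 6≤n large =
    let m , f≤2m , T = f-triangleSystem n 6≤n
        few = Threshold.few-triangles (11 + g) T (≤-trans (Threshold.demand-tower (11 + g)) (<⇒≤ large)) (≤-trans (s≤s z≤n) 6≤n)
    in scale-bound (2 ^ 11) (2 ^ g) 96 {n} {m} {f 3 n 6 3} (m≤m+n 1920 128) f≤2m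
         (subst (λ e → e * m ≤ 10 * (n * n)) (^-distribˡ-+-* 2 11 g) (<⇒≤ few))

  abstract
    saving : ∃ λ q → ∃ λ n₀ → ∀ n → n₀ ≤ n → 6 ≤ n × 1 ≤ log* n ×
             (96 * (n * f 3 n 6 3)) ^ suc q * 2 ^ log* n ≤ (n ^ 3) ^ suc q
    saving = choose height-linear
      where
      choose : (∃ λ A → ∃ λ B → 1 ≤ B × ∀ g → height (11 + g) ≤ A + B * g) →
               ∃ λ q → ∃ λ n₀ → ∀ n → n₀ ≤ n → 6 ≤ n × 1 ≤ log* n ×
               (96 * (n * f 3 n 6 3)) ^ suc q * 2 ^ log* n ≤ (n ^ 3) ^ suc q
      -- For `g ≥ 1`, `log* n ≤ A + B * suc g ≤ g * suc (A + 2 * B)`. Hence the power `suc q` of `2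
      -- ^ g` is at least `2 ^ log* n`. The threshold `n₀` ensures `A + B < log* n`, which gives `g
      -- ≥ 1`, as well as `6 ≤ n`.
      choose (A , B , 1≤B , linear) = A + 2 * B , 6 + suc (tower (A + B)) , λ n n₀≤n →
        let large = tower<⇒<log* (A + B) (≤-trans (m≤n+m (suc (tower (A + B))) 6) n₀≤n)
            6≤n = ≤-trans (m≤m+n 6 (suc (tower (A + B)))) n₀≤n
            g , 1≤g , below , above = greatest-multiple A B (log* n) 1≤B large
        in 6≤n , ≤-trans (s≤s z≤n) large ,
           raise-power n g (96 * (n * f 3 n 6 3)) (log* n)
             (≤-trans above (exponent g 1≤g))
             (nf-small n g 6≤n (≤-<-trans (tower-mono (height (11 + g)) (A + B * g) (linear g)) (<log*⇒tower< (A + B * g) below)))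
        where
        exponent : ∀ g → 1 ≤ g → A + B * suc g ≤ g * suc (A + 2 * B)
        exponent (suc g) _ = ≤-trans (m≤m+n (A + B * suc (suc g)) (suc g + g * A + g * B)) (≤-reflexive (lemma A B g))
          where
          lemma : ∀ A B g → A + B * suc (suc g) + (suc g + g * A + g * B) ≡ suc g * suc (A + 2 * B)
          lemma = solve-∀
        raise-power : ∀ n g x l {q} → l ≤ g * q → 2 ^ g * x ≤ n ^ 3 → x ^ q * 2 ^ l ≤ (n ^ 3) ^ q
        raise-power n g x l {q} l≤ small = begin
          x ^ q * 2 ^ l  ≤⟨ *-monoʳ-≤ (x ^ q) (^-monoʳ-≤ 2 l≤) ⟩
          x ^ q * 2 ^ (g * q)  ≡⟨ cong (x ^ q *_) (^-*-assoc 2 g q) ⟨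
          x ^ q * (2 ^ g) ^ q  ≡⟨ *-comm (x ^ q) ((2 ^ g) ^ q) ⟩
          (2 ^ g) ^ q * x ^ q  ≡⟨ ^-*-distrib (2 ^ g) x q ⟨
          (2 ^ g * x) ^ q  ≤⟨ ^-monoˡ-≤ q small ⟩
          (n ^ 3) ^ q  ∎
          where open ≤-Reasoning

open import Defs
import Data.Integer.Base as ℤ
import Data.Integer.Properties as ℤ
open import Data.Integer.Base using (+_)
open import Data.Nat.Base using (zero; suc)
open import Data.Nat.Base as ℕ using (ℕ)
import Data.Nat.Properties as ℕ
open import Data.Product.Base using (∃-syntax; _×_; _,_)
open import Data.Rational.Unnormalised.Base using (mkℚᵘ; *≤*; *<*)
open import Data.Rational.Unnormalised.Base using (ℚᵘ; 0ℚᵘ; _<_; _≤_; _*_)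
open import Relation.Binary.PropositionalEquality using (_≡_; refl; sym; trans; cong; cong₂; subst; subst₂)

-- Transfer of the bounds to rational numbers.

⟦⟧-* : ∀ a b → ⟦ a ⟧ * ⟦ b ⟧ ≡ ⟦ a ℕ.* b ⟧
⟦⟧-* a b = cong (λ i → mkℚᵘ i 0) (sym (ℤ.pos-* a b))

⟦⟧-^ : ∀ a k → ⟦ a ⟧ ^ k ≡ ⟦ a ℕ.^ k ⟧
⟦⟧-^ a zero    = refl
⟦⟧-^ a (suc k) = trans (cong (⟦ a ⟧ *_) (⟦⟧-^ a k)) (⟦⟧-* a (a ℕ.^ k))

⟦⟧-mono : ∀ {a b} → a ℕ.≤ b → ⟦ a ⟧ ≤ ⟦ b ⟧
⟦⟧-mono {a} {b} a≤b = *≤* (subst₂ ℤ._≤_ (sym (ℤ.*-identityʳ (+ a))) (sym (ℤ.*-identityʳ (+ b))) (ℤ.+≤+ a≤b))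

*⟦⟧-mono : ∀ {a} b c → a ℕ.≤ b ℕ.* c → ⟦ a ⟧ ≤ ⟦ b ⟧ * ⟦ c ⟧
*⟦⟧-mono {a} b c a≤bc = subst (⟦ a ⟧ ≤_) (sym (⟦⟧-* b c)) (⟦⟧-mono a≤bc)

reciprocal-* : ∀ d {a b} → a ℕ.≤ suc d ℕ.* b → mkℚᵘ (+ 1) d * ⟦ a ⟧ ≤ ⟦ b ⟧
reciprocal-* d {a} {b} a≤ = *≤* (subst₂ ℤ._≤_
  (trans (sym (ℤ.*-identityˡ (+ a))) (sym (ℤ.*-identityʳ (+ 1 ℤ.* + a))))
  (trans (cong +_ (trans (ℕ.*-comm (suc d) b) (cong (λ k → b ℕ.* suc k) (sym (ℕ.*-identityʳ d))))) (ℤ.pos-* b (suc (d ℕ.* 1))))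
  (ℤ.+≤+ a≤))

-- With c₂ = 1 / (q + 1) and a positive number l the exponent c₂ l has numerator l and denominator q + 1.
power-saving : ∀ q x y l → 1 ℕ.≤ l → x ℕ.^ suc q ℕ.* 2 ℕ.^ l ℕ.≤ y ℕ.^ suc q →
               ⟦ x ⟧ ≤[ ⟦ y ⟧ /2^ mkℚᵘ (+ 1) q * ⟦ l ⟧ ]
power-saving q x y (suc l) _ bound = subst₂ (λ q l → ⟦ x ⟧ ^ suc q * ⟦ 2 ⟧ ^ suc l ≤ ⟦ y ⟧ ^ suc q)
  (sym (ℕ.*-identityʳ q)) (sym (ℕ.+-identityʳ l))
  (subst₂ _≤_
    (trans (sym (⟦⟧-* (x ℕ.^ suc q) (2 ℕ.^ suc l))) (sym (cong₂ _*_ (⟦⟧-^ x (suc q)) (⟦⟧-^ 2 (suc l)))))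
    (sym (⟦⟧-^ y (suc q)))
    (⟦⟧-mono bound))

reciprocal-positive : ∀ d → 0ℚᵘ < mkℚᵘ (+ 1) d
reciprocal-positive d = *<* (ℤ.+<+ (ℕ.s≤s ℕ.z≤n))

rational-bounds : ∀ q {N F C n l} → N ℕ.≤ 96 ℕ.* (n ℕ.* F) → 1 ℕ.≤ l →
  (96 ℕ.* (n ℕ.* F)) ℕ.^ suc q ℕ.* 2 ℕ.^ l ℕ.≤ (n ℕ.^ 3) ℕ.^ suc q → n ℕ.^ 3 ℕ.≤ 729 ℕ.* C →
  ⟦ N ⟧ ≤ ⟦ 96 ⟧ * ⟦ n ℕ.* F ⟧ ×
  ⟦ 96 ⟧ * ⟦ n ℕ.* F ⟧ ≤[ ⟦ n ℕ.^ 3 ⟧ /2^ mkℚᵘ (+ 1) q * ⟦ l ⟧ ] ×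
  mkℚᵘ (+ 1) 728 * ⟦ n ℕ.^ 3 ⟧ ≤ ⟦ C ⟧
rational-bounds q {N} {F} {C} {n} {l} N≤ 1≤l saving n³≤ =
  *⟦⟧-mono 96 (n ℕ.* F) N≤ ,
  subst (λ x → x ≤[ ⟦ n ℕ.^ 3 ⟧ /2^ mkℚᵘ (+ 1) q * ⟦ l ⟧ ]) (sym (⟦⟧-* 96 (n ℕ.* F)))
    (power-saving q (96 ℕ.* (n ℕ.* F)) (n ℕ.^ 3) l 1≤l saving) ,
  reciprocal-* 728 n³≤

theorem3p5 : ∃[ c₁ ] ∃[ c₂ ] ∃[ c₃ ] ∃[ n₀ ]
    0ℚᵘ < c₁ × 0ℚᵘ < c₂ × 0ℚᵘ < c₃ ×
    (∀ (n : ℕ) → n₀ ℕ.≤ n →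
    ⟦ NRD R n ⟧ ≤ c₁ * ⟦ n ℕ.* f 3 n 6 3 ⟧ ×
    c₁ * ⟦ n ℕ.* f 3 n 6 3 ⟧ ≤[ ⟦ n ℕ.^ 3 ⟧ /2^ c₂ * ⟦ log* n ⟧ ] ×
    c₃ * ⟦ n ℕ.^ 3 ⟧ ≤ ⟦ CL R n ⟧)
theorem3p5 =
  let q , n₀ , saving = Combinatorics.saving in
  -- `mkℚᵘ` takes the denominator minus one, so these are 96, `1 / (q + 1)` and 1/729.
  ⟦ 96 ⟧ , mkℚᵘ (+ 1) q , mkℚᵘ (+ 1) 728 , n₀ ,
  *<* (ℤ.+<+ (ℕ.s≤s ℕ.z≤n)) , reciprocal-positive q , reciprocal-positive 728 , λ n n₀≤n →
  let 6≤n , 1≤l , bound = saving n n₀≤n in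
  rational-bounds q {NRD {{Sign-finite}} R n} {f 3 n 6 3} {CL {{Sign-finite}} R n} {n} {log* n}
    (Combinatorics.NRD≤96nf n 6≤n) 1≤l bound (Combinatorics.n³≤729CL n (ℕ.≤-trans (ℕ.n≤1+n 5) 6≤n))
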